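{- Let $k\ge 1$ and $m\ge 1$ be integers. There is an equivariant bijection from $\mathcal{Z}_m^k$, the set of alcoves in the $m$-fold dilation of the fundamental alcove of type $A_k$ with its cyclic action of order $k+1$ (generated by $\rho$), to $\mathcal{W}_m^k$, the set of words of length $k+1$ on $\mathbb{Z}/m\mathbb{Z}$ with sum $m-1 \pmod m$, under rotation. That is, there is a bijection $F:\mathcal{Z}_m^k\to\mathcal{W}_m^k$ such that $F(\rho(A))$ is the left rotation of $F(A)$ for every $A\in\mathcal{Z}_m^k$.
   Context: Let $\alpha_1,\dots,\alpha_k$ be simple roots of the root system $\Phi$ of type $A_k$ in a $k$-dimensional real vector space $V$ with positive definite symmetric bilinear form $\langle\cdot,\cdot\rangle$ (normalized so that $\langle\alpha,\alpha\rangle=2$ for all roots), and let $\alpha_0=-\sum_{i=1}^k\alpha_i$ be the negative of the highest root. For $v\in V$, $p\in\mathbb{Z}$ put $H_{v,p}=\{x\in V:\langle v,x\rangle=p\}$. The alcoves are the connected components of $V\setminus\bigcup_{\alpha\in\Phi,\,p\in\mathbb{Z}}H_{\alpha,p}$. The fundamental alcove is the one contained in $\{x:\langle\alpha_i,x\rangle\ge 0\ (1\le i\le k),\ \langle-\alpha_0,x\rangle\le 1\}$. $\mathcal{Z}_m^k$ is the set of (the $m^k$) alcoves contained in the $m$-fold dilation of the fundamental alcove, i.e. in the simplex $\{x:\langle\alpha_i,x\rangle\ge 0\ (1\le i\le k),\ \langle-\alpha_0,x\rangle\le m\}$. Cyclic action on $\mathcal{Z}_m^k$: this simplex has vertices $v_0=0$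 and $v_1,\dots,v_k$, where $\langle\alpha_j,v_i\rangle=m\,\delta_{ij}$ for $1\le i,j\le k$. Let $\rho$ be the affine map of $V$ with $\rho(v_i)=v_{i+1}$, indices mod $k+1$ (equivalently, the affine isometry whose linear part cyclically permutes $\alpha_0,\alpha_1,\dots,\alpha_k$). It permutes the hyperplanes $H_{\alpha,p}$ and the alcoves in the simplex, and generates a cyclic action of order $k+1$ on $\mathcal{Z}_m^k$. $\mathcal{W}_m^k$ is the set of words $w_1w_2\cdots w_{k+1}$ with letters in $\mathbb{Z}/m\mathbb{Z}$ and $\sum_i w_i\equiv m-1\pmod m$; the cyclic group $C_{k+1}$ acts on it by left rotation $w_1w_2\cdots w_{k+1}\mapsto w_2\cdots w_{k+1}w_1$. -}

module Defs where

open import Level using (Level; 0ℓ) renaming (suc to lsuc)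
open import Algebra.Apartness.Bundles using (HeytingField)
open import Algebra.Bundles using (CommutativeRing)
open import Algebra.Module.Bundles using (LeftModule)
open import Algebra.Module.Morphism.Structures using (module LeftModuleMorphisms)
import Algebra.Definitions.RawMonoid as Multiples
open import Data.Bool.Base using (if_then_else_)
open import Data.Fin.Base using (Fin; toℕ)
open import Data.Fin.Properties using (_≟_)
open import Data.Integer.Base using (ℤ; +_; -[1+_])
open import Data.Nat.Base as ℕ using (ℕ; suc; NonZero; _∸_; ∣_-_∣)
open import Data.Nat.DivMod using (_%_; _mod_)
open import Data.Nat.Properties using (+-assoc; +-comm)
open import Data.Product.Base using (∃; ∃-syntax; Σ; _×_; _,_; proj₁)
open import Data.Sum.Base using (_⊎_)
open import Data.Vec.Base as Vec using (Vec; []; _∷_; _∷ʳ_)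
open import Data.Vec.Functional using (Vector)
open import Function.Bundles using (_⇔_)
open import Relation.Binary.Bundles using (Setoid)
open import Relation.Binary.Core using (Rel)
open import Relation.Binary.PropositionalEquality.Core
  using (_≡_; cong; sym; trans)
import Relation.Binary.PropositionalEquality.Properties as ≡
import Relation.Binary.Construct.On as On
open import Relation.Binary.Structures using (IsStrictPartialOrder)
open import Relation.Nullary.Decidable.Core using (does)
open import Relation.Nullary.Negation.Core using (¬_)
open import Relation.Unary using (Pred; _⊆_; _∪_)
open import Relation.Unary.Relation.Binary.Equality using (≐-setoid)

-- The apartness _#_ is the positive form of inequality, and the order is
-- not assumed trichotomous, so that constructively defined reals qualify.
record OrderedField (ℓ : Level) : Set (lsuc ℓ) where
  infix 4 _<_ _≤_
  field
    heytingField : HeytingField ℓ ℓ ℓ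

  open HeytingField heytingField public

  ℝ-commutativeRing : CommutativeRing ℓ ℓ
  ℝ-commutativeRing = record { isCommutativeRing = isCommutativeRing }

  open CommutativeRing ℝ-commutativeRing public using (ring; +-rawMonoid)

  field
    _<_                  : Rel Carrier ℓ
    isStrictPartialOrder : IsStrictPartialOrder _≈_ _<_
    #⇔<⊎>                : ∀ {x y} → (x # y) ⇔ (x < y ⊎ y < x)
    +-monoˡ-<            : ∀ z {x y} → x < y → x + z < y + z
    *-pos                : ∀ {x y} → 0# < x → 0# < y → 0# < x * y

  _≤_ : Rel Carrier ℓ
  x ≤ y = ¬ (y < x)

  fromℕ : ℕ → Carrier
  fromℕ n = Multiples._×_ +-rawMonoid n 1#

  fromℤ : ℤ → Carrier
  fromℤ (+ n)    = fromℕ n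
  fromℤ -[1+ n ] = - fromℕ (suc n)

  -- Both bounds on x i - x j are covered, since i and j are
  -- interchangeable.
  Cauchy : Pred (ℕ → Carrier) ℓ
  Cauchy x = ∀ ε → 0# < ε →
    ∃[ N ] (∀ i j → N ℕ.≤ i → N ℕ.≤ j → x i < x j + ε)

  _ConvergesTo_ : (ℕ → Carrier) → Carrier → Set ℓ
  x ConvergesTo l = ∀ ε → 0# < ε →
    ∃[ N ] (∀ n → N ℕ.≤ n → x n < l + ε × l < x n + ε)


-- Classically, these axioms determine ℝ up to unique isomorphism.
record Reals (ℓ : Level) : Set (lsuc ℓ) where
  field
    orderedField : OrderedField ℓ

  open OrderedField orderedField public

  field
    archimedean : ∀ x → ∃[ n ] x < fromℕ n
    complete    : ∀ x → Cauchy x → ∃[ l ] x ConvergesTo l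


record EuclideanSpace {ℓ} (ℝ : Reals ℓ) : Set (lsuc ℓ) where
  open Reals ℝ
  field
    vectorSpace : LeftModule ring ℓ ℓ

  open LeftModule vectorSpace public

  field
    ⟨_,_⟩     : Carrierᴹ → Carrierᴹ → Carrier
    ⟨⟩-cong   : ∀ {x x′ y y′} → x ≈ᴹ x′ → y ≈ᴹ y′ → ⟨ x , y ⟩ ≈ ⟨ x′ , y′ ⟩
    ⟨⟩-sym    : ∀ x y → ⟨ x , y ⟩ ≈ ⟨ y , x ⟩
    ⟨⟩-+ˡ     : ∀ x y z → ⟨ x +ᴹ y , z ⟩ ≈ ⟨ x , z ⟩ + ⟨ y , z ⟩
    ⟨⟩-*ˡ     : ∀ c x y → ⟨ c *ₗ x , y ⟩ ≈ c * ⟨ x , y ⟩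
    nonNeg    : ∀ x → 0# ≤ ⟨ x , x ⟩
    definite  : ∀ {x} → ⟨ x , x ⟩ ≈ 0# → x ≈ᴹ 0ᴹ

  infixl 6 _-ᴹ_
  _-ᴹ_ : Carrierᴹ → Carrierᴹ → Carrierᴹ
  x -ᴹ y = x +ᴹ (-ᴹ y)

  ∑ : ∀ {n} → Vector Carrierᴹ n → Carrierᴹ
  ∑ = Multiples.sum +ᴹ-rawMonoid

  comb : ∀ {n} → Vector Carrier n → Vector Carrierᴹ n → Carrierᴹ
  comb c v = ∑ (λ i → c i *ₗ v i)

  Spanning : ∀ {n} → Vector Carrierᴹ n → Set ℓ
  Spanning v = ∀ x → ∃[ c ] x ≈ᴹ comb c v

  LinearlyIndependent : ∀ {n} → Vector Carrierᴹ n → Set ℓ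
  LinearlyIndependent v = ∀ c → comb c v ≈ᴹ 0ᴹ → ∀ i → c i ≈ 0#

  record IsAffine (f : Carrierᴹ → Carrierᴹ) : Set ℓ where
    open LeftModuleMorphisms rawLeftModule rawLeftModule
    field
      linearPart    : Carrierᴹ → Carrierᴹ
      isLinear      : IsLeftModuleHomomorphism linearPart
      translation   : Carrierᴹ
      decomposition : ∀ x → f x ≈ᴹ linearPart x +ᴹ translation

  Image : (Carrierᴹ → Carrierᴹ) → Pred Carrierᴹ ℓ → Pred Carrierᴹ ℓ
  Image f A y = ∃[ x ] A x × f x ≈ᴹ y

  -- The open ball around x whose radius is the square root of ε.
  Ball : Carrierᴹ → Carrier → Pred Carrierᴹ ℓ
  Ball x ε y = ⟨ y -ᴹ x , y -ᴹ x ⟩ < ε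

  -- P ∩ C is open in the subspace C.
  OpenIn : Pred Carrierᴹ ℓ → Pred Carrierᴹ ℓ → Set ℓ
  OpenIn C P = ∀ {x} → C x → P x →
    ∃[ ε ] 0# < ε × (∀ {y} → C y → Ball x ε y → P y)

  Connected : Pred Carrierᴹ ℓ → Set (lsuc ℓ)
  Connected C = ∀ P Q → OpenIn C P → OpenIn C Q → C ⊆ P ∪ Q →
    (∀ {x} → C x → ¬ (P x × Q x)) →
    ¬ ((∃[ x ] C x × P x) × (∃[ y ] C y × Q y))

  record IsConnectedComponent (U A : Pred Carrierᴹ ℓ) : Set (lsuc ℓ) where
    field
      inhabited : ∃ A
      within    : A ⊆ U
      connected : Connected A
      maximal   : ∀ C → C ⊆ U → Connected C → A ⊆ C → C ⊆ A


module _ {ℓ} {ℝ : Reals ℓ} (V : EuclideanSpace ℝ) where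
  open Reals ℝ
  open EuclideanSpace V

  record IsRootSystem (Φ : Pred Carrierᴹ ℓ) : Set ℓ where
    field
      size       : ℕ
      root       : Vector Carrierᴹ size
      enumerates : ∀ x → Φ x ⇔ (∃[ i ] x ≈ᴹ root i)
      spanning   : Spanning root
      nonzero    : ∀ {β} → Φ β → ¬ (β ≈ᴹ 0ᴹ)
      -- The integer n is 2⟨β,γ⟩/⟨γ,γ⟩, so β - nγ is the reflection of β
      -- in the hyperplane orthogonal to γ.
      reflection : ∀ {β γ} → Φ β → Φ γ →
        ∃[ n ] fromℤ n * ⟨ γ , γ ⟩ ≈ fromℕ 2 * ⟨ β , γ ⟩
             × Φ (β -ᴹ fromℤ n *ₗ γ)
      reduced    : ∀ {β} c → Φ β → Φ (c *ₗ β) → c ≈ 1# ⊎ c ≈ - 1#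

  record AreSimpleRoots {k} (Φ : Pred Carrierᴹ ℓ) (α : Vector Carrierᴹ k)
                        : Set ℓ where
    field
      α∈Φ         : ∀ i → Φ (α i)
      spanning    : Spanning α
      independent : LinearlyIndependent α
      sameSign    : ∀ {β} → Φ β → ∃ λ (c : Vector ℕ k) →
        β ≈ᴹ comb (λ i → fromℕ (c i)) α ⊎ β ≈ᴹ -ᴹ comb (λ i → fromℕ (c i)) α

  cartanA : ∀ {k} → Fin k → Fin k → ℤ
  cartanA i j with ∣ toℕ i - toℕ j ∣
  ... | 0 = + 2
  ... | 1 = -[1+ 0 ]
  ... | _ = + 0

  record TypeA (k : ℕ) : Set (lsuc ℓ) where
    field
      Φ            : Pred Carrierᴹ ℓ
      isRootSystem : IsRootSystem Φ
      α            : Vector Carrierᴹ k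
      simple       : AreSimpleRoots Φ α
      normalised   : ∀ {β} → Φ β → ⟨ β , β ⟩ ≈ fromℕ 2
      -- By the normalisation the Cartan integers are the ⟨αᵢ,αⱼ⟩.
      cartan       : ∀ i j → ⟨ α i , α j ⟩ ≈ fromℤ (cartanA i j)

    α₀ : Carrierᴹ
    α₀ = -ᴹ ∑ α

    -- Being off a hyperplane is expressed by apartness, the positive form
    -- of "⟨β,x⟩ is not p".
    Complement : Pred Carrierᴹ ℓ
    Complement x = ∀ {β} → Φ β → ∀ p → ⟨ β , x ⟩ # fromℤ p

    IsAlcove : Pred Carrierᴹ ℓ → Set (lsuc ℓ)
    IsAlcove = IsConnectedComponent Complement

    DilatedSimplex : ℕ → Pred Carrierᴹ ℓ
    DilatedSimplex m x =
      (∀ i → 0# ≤ ⟨ α i , x ⟩) × ⟨ -ᴹ α₀ , x ⟩ ≤ fromℕ m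

    InZ : ℕ → Pred Carrierᴹ ℓ → Set (lsuc ℓ)
    InZ m A = IsAlcove A × A ⊆ DilatedSimplex m

    𝒵 : ℕ → Setoid (lsuc ℓ) ℓ
    𝒵 m = On.setoid {B = ∃ (InZ m)} (≐-setoid Carrierᴹ ℓ) proj₁

    record AreVertices (m : ℕ) (v : Vector Carrierᴹ (suc k)) : Set ℓ where
      field
        v₀   : v Fin.zero ≈ᴹ 0ᴹ
        vᵢ₊₁ : ∀ j i →
          ⟨ α j , v (Fin.suc i) ⟩ ≈ (if does (i ≟ j) then fromℕ m else 0#)

    -- The vertices form an affine basis, so ρ is unique.
    record IsCyclicSymmetry (m : ℕ) (v : Vector Carrierᴹ (suc k))
                            (ρ : Carrierᴹ → Carrierᴹ) : Set ℓ where
      field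
        vertices : AreVertices m v
        affine   : IsAffine ρ
        cycles   : ∀ i → ρ (v i) ≈ᴹ v (suc (toℕ i) mod suc k)


-- Letters in ℤ/mℤ are given by their least nonnegative representatives.
total : ∀ {m n} → Vec (Fin m) n → ℕ
total w = Vec.sum (Vec.map toℕ w)

InW : ∀ m .{{_ : NonZero m}} {n} → Pred (Vec (Fin m) n) 0ℓ
InW m w = total w % m ≡ (m ∸ 1) % m

𝒲 : (k m : ℕ) .{{_ : NonZero m}} → Setoid 0ℓ 0ℓ
𝒲 k m = On.setoid {B = Σ (Vec (Fin m) (suc k)) (InW m)}
                  (≡.setoid (Vec (Fin m) (suc k))) proj₁

total-∷ʳ : ∀ {m n} (w : Vec (Fin m) n) a → total (w ∷ʳ a) ≡ total (a ∷ w)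
total-∷ʳ []      a = _≡_.refl
total-∷ʳ (b ∷ w) a = trans (cong (toℕ b ℕ.+_) (total-∷ʳ w a))
  (trans (sym (+-assoc (toℕ b) (toℕ a) (total w)))
  (trans (cong (ℕ._+ total w) (+-comm (toℕ b) (toℕ a)))
         (+-assoc (toℕ a) (toℕ b) (total w))))

rotate : ∀ {k m} .{{_ : NonZero m}} →
         Setoid.Carrier (𝒲 k m) → Setoid.Carrier (𝒲 k m)
rotate {m = m} (a ∷ w , p) =
  w ∷ʳ a , trans (cong (_% m) (total-∷ʳ w a)) p

{-# OPTIONS --safe #-}
module Submission where

-- An alcove is determined by the integer parts q i j of r i - r j, where the
-- coordinates r 0 ≤ … ≤ r k ≤ r 0 + m are, up to sign and order, the partial sums
-- of the ⟨αᵢ,x⟩, and the differences of the r i are the roots.  Extended by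
-- r (i + N) = r i + m, with N = k + 1, they form a periodic set of points, which ρ
-- merely renumbers.  Replacing each point by its rank in ⋃ᵢ (r i + ℤ) gives integers
-- a i, pairwise distinct modulo N.  The letter w i of the word of the alcove is the
-- number of turns, modulo m, from a i to the next residue class modulo N:
-- a j ≡ a i + 1 + N w i modulo m N for some j.
--
-- That each word comes from exactly one alcove is a fixed point argument.  For a
-- word w let Φ displace every point a i by 1 + N w i and sort the result.  This map
-- is monotone and preserves the sum, so Φ b ≤ b already implies Φ b = b; hence the
-- pointwise minimum of two fixed points, or of a cycle of Φ, is a fixed point.  The
-- orbits of Φ are bounded, which gives a cycle and therefore existence.  In a fixed
-- point all points are congruent modulo 1, because following the displacements
-- visits every index; taking the minimum of a fixed point and a translate of another
-- by a half-integer, one sees that the two differ by a constant: uniqueness.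

open import Defs
open import Algebra.Bundles using (CommutativeRing)
import Algebra.Apartness.Properties.HeytingCommutativeRing as HeytingProperties
open import Algebra.Module.Morphism.Structures using (module LeftModuleMorphisms)
import Algebra.Properties.CommutativeMonoid.Sum as CommutativeMonoidSum
import Algebra.Properties.Ring as RingProperties
import Algebra.Properties.Semiring.Mult as Mult
import Algebra.Solver.Ring as RingSolver
open import Algebra.Solver.Ring.AlmostCommutativeRing
  using (fromCommutativeRing; _-Raw-AlmostCommutative⟶_)
open import Data.Bool.Base using (if_then_else_)
open import Data.Empty using (⊥-elim)
open import Data.Fin.Base using (Fin; zero; suc; toℕ; inject₁; opposite; fromℕ<)
  renaming (fromℕ to last)
open import Data.Fin.Induction using (<-weakInduction)
import Data.Fin.Properties as Fin
open import Data.Fin.Relation.Unary.Top using (view; ‵fromℕ; ‵inject₁)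
open import Data.Integer.Base as ℤ using (ℤ; +_; -[1+_]; _⊖_; 0ℤ; 1ℤ; -1ℤ)
open import Data.Integer.DivMod using ([n/ℕd]*d≤n)
import Data.Integer.Properties as ℤ
open import Data.Integer.Tactic.RingSolver using (solve-∀)
open import Data.Maybe.Base using (Maybe; just; nothing)
open import Data.Nat.Base as ℕ using (ℕ; zero; suc; NonZero)
open import Data.Nat.DivMod
  using (_/_; _%_; _mod_; m%n<n; n%n≡0; m<n⇒m%n≡m; m≡m%n+[m/n]*n)
import Data.Nat.Properties as ℕ
open import Data.Product.Base using (∃; ∃₂; Σ-syntax; _×_; _,_; proj₁; proj₂)
open import Data.Sum.Base using (_⊎_; inj₁; inj₂; [_,_]′)
open import Data.Vec.Base using (Vec; _∷_; _∷ʳ_; tabulate; lookup)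
open import Data.Vec.Functional using (Vector)
open import Data.Vec.Properties using (lookup∘tabulate; tabulate∘lookup; tabulate-cong)
open import Function.Base using (_∘_)
open import Function.Bundles using (Bijection; Equivalence)
open import Function.Definitions using (Injective)
open import Relation.Binary.Bundles using (Setoid)
open import Relation.Binary.Definitions using (tri<; tri≈; tri>)
open import Relation.Binary.PropositionalEquality as ≡ using (_≡_; _≢_)
import Relation.Binary.Reasoning.Setoid as SetoidReasoning
open import Relation.Binary.Structures using (IsStrictPartialOrder)
open import Relation.Nullary using (¬_; yes; no; contradiction)
open import Relation.Nullary.Decidable using (does)
open import Relation.Unary using (Pred; _⊆_)
open import Algebra.Properties.CommutativeMonoid.Sum ℤ.+-0-commutativeMonoid
  using () renaming (sum to sumℤ; sum-cong-≗ to sumℤ-cong)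

-- The sum condition on words is what makes `Φ` preserve sums: the displacements add up to
-- `N (1 + Σ w)`, which is a multiple `m N J` of the period exactly when `Σ w` is `m - 1` modulo
-- `m`, and renumbering the sorted points by `J` compensates for this total. Sorting is never
-- carried out. A nondecreasing quasiperiodic sequence is exchanged for its counting function
-- `dual`, for which the order of the points is irrelevant; displacing, counting and taking the dual
-- once more yields the sorted sequence. `Φ` is monotone because `dual` reverses the order, and its
-- sum comes from Hermite's identity. The map from alcoves to words is never inverted by a formula:
-- injectivity and surjectivity are the uniqueness and the existence of the fixed point. On the
-- geometric side the order of the field is not assumed decidable. Floors exist because points of an
-- alcove are apart from every hyperplane, and convex sets are shown connected by a bisection that
-- uses only Cauchy completeness and the Archimedean property.

module Counting where
  open import Data.Fin.Base using (punchOut; funToFin; finToFun)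
  open import Data.Fin.Permutation using (permutation)
  open import Data.Fin.Properties
    using (toℕ<n; toℕ-fromℕ<; any?; pigeonhole; injective⇒≤; punchOut-injective; finToFun-funToFin)
  open import Data.Integer.Base hiding (suc)
  open import Data.Integer.DivMod using (a≡a%ℕn+[a/ℕn]*n; n%ℕd<d; [n/ℕd]*d≤n; n<s[n/ℕd]*d)
  open import Data.Integer.Properties
  open import Function.Base using (it)
  open import Relation.Binary.PropositionalEquality hiding ([_]; J)
  open import Algebra.Properties.AbelianGroup +-0-abelianGroup using ()
    renaming (∙-cancelˡ to +-cancelˡ-≡; ∙-cancelʳ to +-cancelʳ-≡)
  open import Algebra.Properties.CommutativeMonoid.Sum +-0-commutativeMonoid
    using (sum; ∑-comm; ∑-distrib-+; sum-cong-≗; sum-permute)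
  open import Algebra.Properties.Semiring.Sum +-*-semiring using (*-distribˡ-sum)

  -- Linear arithmetic: an inequality follows from a known one as soon as the two differences agree,
  -- and that identity is left to the ring solver. Most of the local `eq` below are such identities.
  ≤-transfer : ∀ {a b c d} → a ≤ b → b - a ≡ d - c → c ≤ d
  ≤-transfer {a} {b} {c} {d} a≤b eq =
    0≤i-j⇒j≤i (subst (0ℤ ≤_) eq (i≤j⇒0≤j-i a≤b))

  ≡-transfer : ∀ {a b c d : ℤ} → a ≡ b → b - a ≡ d - c → c ≡ d
  ≡-transfer {a} {b} {c} {d} a≡b eq =
    sym (i-j≡0⇒i≡j d c (trans (sym eq) (i≡j⇒i-j≡0 (sym a≡b))))

  <⇒+1≤ : ∀ {a b} → a < b → a + 1ℤ ≤ b
  <⇒+1≤ {a} a<b = subst (_≤ _) (+-comm 1ℤ a) (i<j⇒suc[i]≤j a<b)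

  +1≤⇒< : ∀ {a b} → a + 1ℤ ≤ b → a < b
  +1≤⇒< {a} a<b = suc[i]≤j⇒i<j (subst (_≤ _) (+-comm a 1ℤ) a<b)

  <+1⇒≤ : ∀ {a b} → a < b + 1ℤ → a ≤ b
  <+1⇒≤ {a} {b} a<b+1 = ≤-transfer (<⇒+1≤ a<b+1) (eq a b)
    where eq : ∀ a b → b + 1ℤ - (a + 1ℤ) ≡ b - a
          eq = solve-∀

  -1<⇒≤ : ∀ {a b} → a - 1ℤ < b → a ≤ b
  -1<⇒≤ {a} {b} a-1<b = ≤-transfer (<⇒+1≤ a-1<b) (eq a b)
    where eq : ∀ a b → b - (a - 1ℤ + 1ℤ) ≡ b - a
          eq = solve-∀

  -1< : ∀ a → a - 1ℤ < a
  -1< a = +1≤⇒< (≤-reflexive (eq a))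
    where eq : ∀ a → a - 1ℤ + 1ℤ ≡ a
          eq = solve-∀

  -- Floor division and sums over windows of integers.

  module _ {P : ℕ} .{{_ : ℕ.NonZero P}} where

    */≤⇒≤/ : ∀ {q x} → q * + P ≤ x → q ≤ x /ℕ P
    */≤⇒≤/ {q} {x} qP≤x = ≮⇒≥ λ x/P<q → ≤⇒≯
      (≤-trans (*-monoʳ-≤-nonNeg (+ P) (i<j⇒suc[i]≤j x/P<q)) qP≤x)
      (n<s[n/ℕd]*d x P)

    ≤/⇒*/≤ : ∀ {q x} → q ≤ x /ℕ P → q * + P ≤ x
    ≤/⇒*/≤ {q} {x} q≤x/P = ≤-trans (*-monoʳ-≤-nonNeg (+ P) q≤x/P) ([n/ℕd]*d≤n x P)

    /-mono : ∀ {x y} → x ≤ y → x /ℕ P ≤ y /ℕ P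
    /-mono {x} x≤y = */≤⇒≤/ (≤-trans ([n/ℕd]*d≤n x P) x≤y)

    /-+-* : ∀ x q → (x + q * + P) /ℕ P ≡ x /ℕ P + q
    /-+-* x q = ≤-antisym
      (≤-transfer (*/≤⇒≤/ {q = X - q} {x}
                   (≤-transfer ([n/ℕd]*d≤n (x + q * + P) P) (eq₁ x q X (+ P))))
                  (eq₂ X (x /ℕ P) q))
      (*/≤⇒≤/ {x = x + q * + P} (≤-transfer ([n/ℕd]*d≤n x P) (eq₃ x q (x /ℕ P) (+ P))))
      where
      X = (x + q * + P) /ℕ P
      eq₁ : ∀ x q y p → (x + q * p) - y * p ≡ x - (y - q) * p
      eq₁ = solve-∀
      eq₂ : ∀ a b q → b - (a - q) ≡ (b + q) - a
      eq₂ = solve-∀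
      eq₃ : ∀ x q y p → x - y * p ≡ (x + q * p) - (y + q) * p
      eq₃ = solve-∀

    /-unique : ∀ {q x} → q * + P ≤ x → x < (q + 1ℤ) * + P → x /ℕ P ≡ q
    /-unique {q} {x} lo hi = ≤-antisym
      (<+1⇒≤ (*-cancelʳ-<-nonNeg (+ P) (≤-<-trans ([n/ℕd]*d≤n x P) hi)))
      (*/≤⇒≤/ lo)

    toℕ/ : ∀ (i : Fin P) → + toℕ i /ℕ P ≡ 0ℤ
    toℕ/ i = /-unique {q = 0ℤ} (+≤+ ℕ.z≤n)
      (subst (+ toℕ i <_) (sym (*-identityˡ (+ P))) (+<+ (toℕ<n i)))
      where open import Data.Fin.Properties using (toℕ<n)

  sum-mono : ∀ {n} {f g : Fin n → ℤ} → (∀ i → f i ≤ g i) → sum f ≤ sum g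
  sum-mono {zero}  f≤g = ≤-refl
  sum-mono {suc n} f≤g = +-mono-≤ (f≤g zero) (sum-mono (f≤g ∘ suc))

  sum-mono-≡ : ∀ {n} {f g : Fin n → ℤ} → (∀ i → f i ≤ g i) →
               sum g ≤ sum f → ∀ i → f i ≡ g i
  sum-mono-≡ {suc n} {f} {g} f≤g Σg≤Σf zero = ≤-antisym (f≤g zero)
    (≤-transfer (≤-trans Σg≤Σf (+-monoʳ-≤ (f zero) (sum-mono (f≤g ∘ suc))))
                (eq (f zero) (g zero) (sum (g ∘ suc))))
    where
    eq : ∀ a b c → (a + c) - (b + c) ≡ a - b
    eq = solve-∀
  sum-mono-≡ {suc n} {f} {g} f≤g Σg≤Σf (suc i) = sum-mono-≡ (f≤g ∘ suc)
    (≤-transfer (≤-trans Σg≤Σf (+-monoˡ-≤ _ (f≤g zero)))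
                (eq (g zero) (sum (f ∘ suc)) (sum (g ∘ suc)))) i
    where
    eq : ∀ a b c → (a + b) - (a + c) ≡ b - c
    eq = solve-∀

  sum-const : ∀ n c → sum {n} (λ _ → c) ≡ + n * c
  sum-const zero    c = sym (*-zeroˡ c)
  sum-const (suc n) c = trans (cong (_+_ c) (sum-const n c)) (sym (suc-* (+ n) c))

  sum-*ˡ : ∀ {n} c (f : Fin n → ℤ) → sum (λ i → c * f i) ≡ c * sum f
  sum-*ˡ c f = sym (*-distribˡ-sum c f)

  sum-- : ∀ {n} (f g : Fin n → ℤ) → sum (λ i → f i - g i) ≡ sum f - sum g
  sum-- f g = trans (∑-distrib-+ f (λ i → - g i)) (cong (_+_ (sum f))
    (trans (sum-cong-≗ (λ i → sym (-1*i≡-i (g i)))) (trans (sum-*ˡ -1ℤ g) (-1*i≡-i _))))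

  ℤ-linear : ∀ {c} (W : ℤ → ℤ) → (∀ z → W (z + 1ℤ) ≡ W z + c) →
             ∀ z → W z ≡ W 0ℤ + z * c
  ℤ-linear {c} W step (+ zero)  = eq (W 0ℤ) c
    where eq : ∀ a c → a ≡ a + 0ℤ * c
          eq = solve-∀
  ℤ-linear {c} W step (+ suc n) = begin
    W (+ suc n)            ≡⟨ cong W (+-comm 1ℤ (+ n)) ⟩
    W (+ n + 1ℤ)           ≡⟨ step (+ n) ⟩
    W (+ n) + c            ≡⟨ cong (_+ c) (ℤ-linear W step (+ n)) ⟩
    W 0ℤ + + n * c + c     ≡⟨ eq (W 0ℤ) (+ n) c ⟩
    W 0ℤ + (1ℤ + + n) * c  ∎
    where open ≡-Reasoning
          eq : ∀ a n c → a + n * c + c ≡ a + (1ℤ + n) * c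
          eq = solve-∀
  ℤ-linear {c} W step -[1+ n ] = begin
    W -[1+ n ]                    ≡⟨ eq (W -[1+ n ]) c ⟩
    (W -[1+ n ] + c) - c          ≡⟨ cong (_- c) (step -[1+ n ]) ⟨
    W (-[1+ n ] + 1ℤ) - c         ≡⟨ cong (λ z → W z - c) (-suc n) ⟩
    W (- + n) - c                 ≡⟨ cong (_- c) (ℤ-linear′ n) ⟩
    W 0ℤ + (- + n) * c - c        ≡⟨ eq′ (W 0ℤ) (+ n) c ⟩
    W 0ℤ + - (1ℤ + + n) * c       ∎
    where
    open ≡-Reasoning
    eq : ∀ a c → a ≡ (a + c) - c
    eq = solve-∀
    eq′ : ∀ a n c → a + (- n) * c - c ≡ a + - (1ℤ + n) * c
    eq′ = solve-∀
    -suc : ∀ n → -[1+ n ] + 1ℤ ≡ - + n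
    -suc zero    = refl
    -suc (suc n) = refl
    ℤ-linear′ : ∀ n → W (- + n) ≡ W 0ℤ + (- + n) * c
    ℤ-linear′ zero    = ℤ-linear W step 0ℤ
    ℤ-linear′ (suc n) = ℤ-linear W step -[1+ n ]

  module _ (g : ℤ → ℤ) where

    private
      window : ℕ → ℤ → ℤ
      window n z = sum {n} (λ i → g (z + + toℕ i))

      slide : ∀ n z → window n (z + 1ℤ) + g z ≡ window n z + g (z + + n)
      slide zero    z = cong (λ y → 0ℤ + g y) (sym (+-identityʳ z))
      slide (suc n) z = begin
        (g (z + 1ℤ + 0ℤ) + sum {n} (λ i → g (z + 1ℤ + + suc (toℕ i)))) + g z
          ≡⟨ cong₂ (λ a b → (a + b) + g z) (cong g (+-identityʳ _))
               (sum-cong-≗ {n} (λ i → cong g (assoc (z + 1ℤ) (+ toℕ i)))) ⟩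
        (g (z + 1ℤ) + window n (z + 1ℤ + 1ℤ)) + g z
          ≡⟨ eq (g (z + 1ℤ)) _ (g z) ⟩
        (window n (z + 1ℤ + 1ℤ) + g (z + 1ℤ)) + g z
          ≡⟨ cong (_+ g z) (slide n (z + 1ℤ)) ⟩
        (window n (z + 1ℤ) + g (z + 1ℤ + + n)) + g z
          ≡⟨ eq′ (window n (z + 1ℤ)) _ (g z) ⟩
        (g z + window n (z + 1ℤ)) + g (z + 1ℤ + + n)
          ≡⟨ cong₂ _+_ (cong₂ _+_ (cong g (sym (+-identityʳ z)))
               (sum-cong-≗ {n} (λ i → cong g (sym (assoc z (+ toℕ i))))))
               (cong g (sym (assoc z (+ n)))) ⟩
        (g (z + 0ℤ) + sum {n} (λ i → g (z + + suc (toℕ i)))) + g (z + + suc n) ∎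
        where
        open ≡-Reasoning
        assoc : ∀ a b → a + (1ℤ + b) ≡ a + 1ℤ + b
        assoc = solve-∀
        eq : ∀ a b c → (a + b) + c ≡ (b + a) + c
        eq = solve-∀
        eq′ : ∀ a b c → (a + b) + c ≡ (c + a) + b
        eq′ = solve-∀

    -- Moving the window by one loses `g z` and gains `g (z + n) = g z + c`, so the window sum is
    -- affine in `z` with slope `c`.
    window-shift : ∀ {n c} → (∀ x → g (x + + n) ≡ g x + c) → ∀ z →
      sum {n} (λ i → g (z + + toℕ i)) ≡ sum {n} (λ i → g (+ toℕ i)) + z * c
    window-shift {n} {c} per z = trans
      (ℤ-linear (window n) step z)
      (cong (_+ z * c) (sum-cong-≗ {n} (λ i → cong g (+-identityˡ (+ toℕ i)))))
      where
      step : ∀ z → window n (z + 1ℤ) ≡ window n z + c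
      step z = begin
        window n (z + 1ℤ)              ≡⟨ eq (window n (z + 1ℤ)) (g z) ⟩
        window n (z + 1ℤ) + g z - g z  ≡⟨ cong (_- g z) (slide n z) ⟩
        window n z + g (z + + n) - g z ≡⟨ cong (λ y → window n z + y - g z) (per z) ⟩
        window n z + (g z + c) - g z   ≡⟨ eq′ (window n z) (g z) c ⟩
        window n z + c                 ∎
        where open ≡-Reasoning
              eq : ∀ a b → a ≡ a + b - b
              eq = solve-∀
              eq′ : ∀ a b c → a + (b + c) - b ≡ a + c
              eq′ = solve-∀

  -- Hermite's identity: division by `P` grows by 1 over a period `P`, and vanishes on the window
  -- that starts at 0.
  hermite : ∀ {P} .{{_ : ℕ.NonZero P}} y → sum {P} (λ i → (+ toℕ i - y) /ℕ P) ≡ - y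
  hermite {P} y = begin
    sum {P} (λ i → (+ toℕ i - y) /ℕ P)
      ≡⟨ sum-cong-≗ {P} (λ i → cong (_/ℕ P) (+-comm (+ toℕ i) (- y))) ⟩
    sum {P} (λ i → (- y + + toℕ i) /ℕ P)
      ≡⟨ window-shift (_/ℕ P) (λ x → trans (cong (λ p → (x + p) /ℕ P) (sym (*-identityˡ (+ P))))
        (/-+-* x 1ℤ)) (- y) ⟩
    sum {P} (λ i → + toℕ i /ℕ P) + - y * 1ℤ
      ≡⟨ cong₂ _+_ (trans (sum-cong-≗ {P} toℕ/) (trans (sum-const P 0ℤ) (*-zeroʳ (+ P))))
        (*-identityʳ (- y)) ⟩
    0ℤ + - y
      ≡⟨ +-identityˡ (- y) ⟩
    - y ∎
    where open ≡-Reasoning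

  -- Quasiperiodic sequences and their counting functions.

  [_] : ∀ {n} → (ℤ → ℤ) → Fin n → ℤ
  [ g ] i = g (+ toℕ i)

  Quasiperiodic : ℕ → ℕ → (ℤ → ℤ) → Set
  Quasiperiodic P Q g = ∀ x → g (x + + P) ≡ g x + + Q

  Nondecreasing : (ℤ → ℤ) → Set
  Nondecreasing g = ∀ {x y} → x ≤ y → g x ≤ g y

  module _ {P Q g} (per : Quasiperiodic P Q g) where

    per-* : ∀ x q → g (x + q * + P) ≡ g x + q * + Q
    per-* x q = trans
      (ℤ-linear (λ q → g (x + q * + P))
        (λ q → trans (cong g (eq x q (+ P))) (per _)) q)
      (cong (λ y → g y + q * + Q) (eq′ x (+ P)))
      where
      eq : ∀ x q p → x + (q + 1ℤ) * p ≡ x + q * p + p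
      eq = solve-∀
      eq′ : ∀ x p → x + 0ℤ * p ≡ x
      eq′ = solve-∀

  -- The sums over windows starting at any `x` differ from those at 0 by the same amount for `f` and
  -- `g`, so the comparison of sums holds at every window and forces termwise equality there. This
  -- turns one-sided estimates into equalities, both for the minimum of two solutions and for the
  -- minimum over a cycle.
  ≤∧sum≥⇒≗ : ∀ {P Q f g} .{{_ : ℕ.NonZero P}} →
    Quasiperiodic P Q f → Quasiperiodic P Q g → (∀ x → f x ≤ g x) →
    sum {P} [ g ] ≤ sum {P} [ f ] → ∀ x → f x ≡ g x
  ≤∧sum≥⇒≗ {P} {Q} {f} {g} pf pg f≤g Σg≤Σf x =
    trans (cong f x≡) (trans
      (sum-mono-≡ {P} (λ i → f≤g (x + + toℕ i)) sums i₀)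
      (sym (cong g x≡)))
    where
    i₀ : Fin P
    i₀ = fromℕ< (ℕ.>-nonZero⁻¹ P)
    x≡ : x ≡ x + + toℕ i₀
    x≡ = trans (sym (+-identityʳ x))
      (cong (λ n → x + + n) (sym (toℕ-fromℕ< (ℕ.>-nonZero⁻¹ P))))
    sums : sum {P} (λ i → g (x + + toℕ i)) ≤ sum {P} (λ i → f (x + + toℕ i))
    sums = subst₂ _≤_ (sym (window-shift g pg x)) (sym (window-shift f pf x))
      (+-monoˡ-≤ (x * + Q) Σg≤Σf)

  -- For a nondecreasing sequence g with g (x + P) = g x + Q, dual g i counts
  -- the x ≥ 0 with g x ≤ i minus the x < 0 with g x > i.
  module _ {P : ℕ} (Q : ℕ) .{{_ : ℕ.NonZero Q}} where

    dual : (Fin P → ℤ) → ℤ → ℤ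
    dual g i = sum {P} (λ x → (i - g x) /ℕ Q + 1ℤ)

    dual-antimono : ∀ {g h} → (∀ x → g x ≤ h x) → ∀ i → dual h i ≤ dual g i
    dual-antimono g≤h i = sum-mono {P} λ x →
      +-monoˡ-≤ 1ℤ (/-mono (+-monoʳ-≤ i (neg-mono-≤ (g≤h x))))

    dual-mono : ∀ g → Nondecreasing (dual g)
    dual-mono g i≤j = sum-mono {P} λ x → +-monoˡ-≤ 1ℤ (/-mono (+-monoˡ-≤ (- g x) i≤j))

    dual-per : ∀ g → Quasiperiodic Q P (dual g)
    dual-per g i = begin
      sum {P} (λ x → (i + + Q - g x) /ℕ Q + 1ℤ)
        ≡⟨ sum-cong-≗ {P} (λ x → trans
             (cong (λ y → y /ℕ Q + 1ℤ) (eq i (+ Q) (g x)))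
             (cong (_+ 1ℤ) (/-+-* (i - g x) 1ℤ))) ⟩
      sum {P} (λ x → (i - g x) /ℕ Q + 1ℤ + 1ℤ)
        ≡⟨ ∑-distrib-+ {P} (λ x → (i - g x) /ℕ Q + 1ℤ) (λ _ → 1ℤ) ⟩
      dual g i + sum {P} (λ _ → 1ℤ)
        ≡⟨ cong (_+_ (dual g i)) (trans (sum-const P 1ℤ) (*-identityʳ (+ P))) ⟩
      dual g i + + P ∎
      where
      open ≡-Reasoning
      eq : ∀ i q g → i + q - g ≡ (i - g) + 1ℤ * q
      eq = solve-∀

    -- Exchange the sums and apply Hermite's identity to each `g x`. Only the sum of `g` remains, so
    -- sums can be tracked through sorting.
    sum-dual : ∀ g → sum {Q} [ dual g ] ≡ + P * + Q - sum {P} g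
    sum-dual g = begin
      sum {Q} (λ i → sum {P} (λ x → (+ toℕ i - g x) /ℕ Q + 1ℤ))
        ≡⟨ ∑-comm {Q} {P} (λ i x → (+ toℕ i - g x) /ℕ Q + 1ℤ) ⟩
      sum {P} (λ x → sum {Q} (λ i → (+ toℕ i - g x) /ℕ Q + 1ℤ))
        ≡⟨ sum-cong-≗ {P} (λ x → trans
             (∑-distrib-+ {Q} (λ i → (+ toℕ i - g x) /ℕ Q) (λ _ → 1ℤ))
             (trans (cong₂ _+_ (hermite {Q} (g x)) (trans (sum-const Q 1ℤ) (*-identityʳ (+ Q))))
                    (+-comm (- g x) (+ Q)))) ⟩
      sum {P} (λ x → + Q - g x)
        ≡⟨ sum-- {P} (λ _ → + Q) g ⟩
      sum {P} (λ _ → + Q) - sum {P} g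
        ≡⟨ cong (_- sum {P} g) (sum-const P (+ Q)) ⟩
      + P * + Q - sum {P} g ∎
      where open ≡-Reasoning

    module _ {g : ℤ → ℤ} (mono : Nondecreasing g) (per : Quasiperiodic P Q g) (i : ℤ) where

      private
        G : ℤ → ℤ
        G y = (i - g y) /ℕ Q + 1ℤ

        G-per : ∀ y → G (y + + P) ≡ G y + -1ℤ
        G-per y = begin
          (i - g (y + + P)) /ℕ Q + 1ℤ       ≡⟨ cong (λ z → (i - z) /ℕ Q + 1ℤ) (per y) ⟩
          (i - (g y + + Q)) /ℕ Q + 1ℤ       ≡⟨ cong (λ z → z /ℕ Q + 1ℤ) (eq i (g y) (+ Q)) ⟩
          (i - g y + -1ℤ * + Q) /ℕ Q + 1ℤ   ≡⟨ cong (_+ 1ℤ) (/-+-* (i - g y) -1ℤ) ⟩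
          (i - g y) /ℕ Q + -1ℤ + 1ℤ         ≡⟨ eq′ ((i - g y) /ℕ Q) ⟩
          (i - g y) /ℕ Q + 1ℤ + -1ℤ         ∎
          where
          open ≡-Reasoning
          eq : ∀ i g q → i - (g + q) ≡ i - g + -1ℤ * q
          eq = solve-∀
          eq′ : ∀ a → a + -1ℤ + 1ℤ ≡ a + 1ℤ + -1ℤ
          eq′ = solve-∀

        shifted : ∀ z → sum {P} (λ x → G (z + + toℕ x)) ≡ dual [ g ] i + z * -1ℤ
        shifted = window-shift G G-per

      -- Together with `dual-≤` this says that `g x ≤ i` exactly when `x < dual [ g ] i`. By
      -- `shifted` the sum may be taken over another window: here the one ending at `x`, whose `P`
      -- summands are all at least 1; in `dual-≤` the one starting at `x`, whose summands are all at
      -- most 0.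
      dual-> : ∀ {x} → g x ≤ i → x < dual [ g ] i
      dual-> {x} gx≤i = +1≤⇒< (≤-transfer P≤ (trans (cong (_- + P) (shifted z))
          (eq (dual [ g ] i) x (+ P))))
        where
        z = x + 1ℤ - + P
        eq : ∀ d x p → d + (x + 1ℤ - p) * -1ℤ - p ≡ d - (x + 1ℤ)
        eq = solve-∀
        eq₂ : ∀ x t p → p - (1ℤ + t) ≡ x - (x + 1ℤ - p + t)
        eq₂ = solve-∀
        eq₃ : ∀ p → p * 1ℤ ≡ p
        eq₃ = solve-∀
        G≥1 : ∀ {y} → y ≤ x → 1ℤ ≤ G y
        G≥1 {y} y≤x = +-monoˡ-≤ 1ℤ (*/≤⇒≤/ {q = 0ℤ} (i≤j⇒0≤j-i (≤-trans (mono y≤x) gx≤i)))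
        P≤ : + P ≤ sum {P} (λ t → G (z + + toℕ t))
        P≤ = subst (_≤ sum {P} (λ t → G (z + + toℕ t))) (trans (sum-const P 1ℤ) (*-identityʳ (+ P)))
          (sum-mono {P} {λ _ → 1ℤ} λ t → G≥1
            (≤-transfer (+≤+ (toℕ<n t)) (eq₂ x (+ toℕ t) (+ P))))

      dual-≤ : ∀ {x} → i < g x → dual [ g ] i ≤ x
      dual-≤ {x} i<gx = ≤-transfer ≤0 (trans (cong (_-_ 0ℤ) (shifted x)) (eq (dual [ g ] i) x))
        where
        eq : ∀ d x → 0ℤ - (d + x * -1ℤ) ≡ x - d
        eq = solve-∀
        G≤0 : ∀ {y} → x ≤ y → G y ≤ 0ℤ
        G≤0 {y} x≤y = <⇒+1≤ (≰⇒> λ 0≤ → <⇒≱ (<-≤-trans i<gx (mono x≤y))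
          (0≤i-j⇒j≤i (≤/⇒*/≤ {q = 0ℤ} 0≤)))
        ≤0 : sum {P} (λ t → G (x + + toℕ t)) ≤ 0ℤ
        ≤0 = subst (sum {P} (λ t → G (x + + toℕ t)) ≤_) (trans (sum-const P 0ℤ) (*-zeroʳ (+ P)))
          (sum-mono {P} {g = λ _ → 0ℤ} λ t → G≤0 (i≤i+j x (+ toℕ t)))

  -- Permutations of finite index sets and chains of successors.

  injective⇒surjective : ∀ {n} {f : Fin n → Fin n} → Injective _≡_ _≡_ f →
                         ∀ j → ∃ λ i → f i ≡ j
  injective⇒surjective {suc n} {f} inj j with any? (λ i → f i Fin.≟ j)
  ... | yes hit = hit
  ... | no miss = contradiction
    (injective⇒≤ {f = λ i → punchOut (j≢ i)} λ {x} {y} eq →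
      inj (punchOut-injective (j≢ x) (j≢ y) eq))
    ℕ.1+n≰n
    where
    j≢ : ∀ i → j ≢ f i
    j≢ i j≡fi = miss (i , sym j≡fi)

  sum-injective : ∀ {n} {f : Fin n → Fin n} → Injective _≡_ _≡_ f →
                  ∀ g → sum (g ∘ f) ≡ sum g
  sum-injective {n} {f} inj g = sym (sum-permute {n} {n} g
    (permutation f (proj₁ ∘ surj) (proj₂ ∘ surj) (λ i → inj (proj₂ (surj (f i))))))
    where surj = injective⇒surjective inj

  toℕ-mod-injective : ∀ {n} .{{_ : ℕ.NonZero n}} {s t : Fin n} {y z} →
    + toℕ s + y * + n ≡ + toℕ t + z * + n → s ≡ t
  toℕ-mod-injective {n} {s} {t} {y} {z} eq = Fin.toℕ-injective (+-injective
    (+-cancelʳ-≡ (y * + n) (+ toℕ s) (+ toℕ t)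
      (trans eq (cong (λ q → + toℕ t + q * + n) (sym y≡z)))))
    where
    y≡z : y ≡ z
    y≡z = begin
      y                             ≡⟨ trans (sym (+-identityˡ y)) (cong (_+ y) (sym (toℕ/ s))) ⟩
      + toℕ s /ℕ n + y              ≡⟨ /-+-* (+ toℕ s) y ⟨
      (+ toℕ s + y * + n) /ℕ n      ≡⟨ cong (_/ℕ n) eq ⟩
      (+ toℕ t + z * + n) /ℕ n      ≡⟨ /-+-* (+ toℕ t) z ⟩
      + toℕ t /ℕ n + z              ≡⟨ trans (cong (_+ z) (toℕ/ t)) (+-identityˡ z) ⟩
      z                             ∎
      where open ≡-Reasoning

  -- Following successors from any starting index runs through all residues
  -- modulo N, hence through all indices.
  module Orbit {N} (h : ℕ) .{{_ : ℕ.NonZero N}} .{{_ : ℕ.NonZero h}} {y : Fin N → ℤ}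
    (next : ∀ i → ∃₂ λ j z → y j ≡ y i + (1ℤ + z * + N) * + h) where

    private
      step : Fin N → ℕ → Fin N
      step i zero    = i
      step i (suc t) = proj₁ (next (step i t))

      at : ∀ i t → ∃ λ z → y (step i t) ≡ y i + (+ t + z * + N) * + h
      at i zero = 0ℤ , eq (y i) (+ N) (+ h)
        where eq : ∀ a n h → a ≡ a + (0ℤ + 0ℤ * n) * h
              eq = solve-∀
      at i (suc t) with at i t | next (step i t)
      ... | z , e | j , z′ , e′ = z + z′ , trans e′ (trans (cong (_+ (1ℤ + z′ * + N) * + h) e)
        (eq (y i) (+ t) z z′ (+ N) (+ h)))
        where
        eq : ∀ a t z z′ n h → a + (t + z * n) * h + (1ℤ + z′ * n) * h ≡ a + (1ℤ + t + (z + z′) * n) * h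
        eq = solve-∀

      step-injective : ∀ i {s t : Fin N} → step i (toℕ s) ≡ step i (toℕ t) → s ≡ t
      step-injective i {s} {t} eq with at i (toℕ s) | at i (toℕ t)
      ... | z , e | z′ , e′ = toℕ-mod-injective {y = z} {z′}
        (*-cancelʳ-≡ _ _ (+ h) {{ℕ.>-nonZero (ℕ.>-nonZero⁻¹ h)}}
          (+-cancelˡ-≡ (y i) _ _ (trans (sym e) (trans (cong y eq) e′))))

      reach : ∀ i j → ∃ λ (t : Fin N) → step i (toℕ t) ≡ j
      reach i = injective⇒surjective (step-injective i)

    all-congruent : ∀ i j → ∃ λ z → y j ≡ y i + z * + h
    all-congruent i j =
      let t , t≡ = reach i j
          z , e  = at i (toℕ t)
      in  + toℕ t + z * + N , trans (cong y (sym t≡)) e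

    -- Both `i` and `j` are reached from `i` in fewer than `N` steps, and the value reached
    -- determines the number of steps modulo `N`.
    residues-distinct : ∀ {i j} z → y i ≡ y j + z * + N * + h → i ≡ j
    residues-distinct {i} {j} z eq = trans (sym s≡) (trans (cong (step i ∘ toℕ) s≡t) t≡)
      where
      s  = proj₁ (reach i i)
      s≡ = proj₂ (reach i i)
      t  = proj₁ (reach i j)
      t≡ = proj₂ (reach i j)
      z₁ = proj₁ (at i (toℕ s))
      e₁ = proj₂ (at i (toℕ s))
      z₂ = proj₁ (at i (toℕ t))
      e₂ = proj₂ (at i (toℕ t))
      eq′ : ∀ a t z₂ z n h → (a + (t + z₂ * n) * h) + z * n * h ≡ a + (t + (z₂ + z) * n) * h
      eq′ = solve-∀
      s≡t : s ≡ t
      s≡t = toℕ-mod-injective {y = z₁} {z₂ + z}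
        (*-cancelʳ-≡ _ _ (+ h) {{ℕ.>-nonZero (ℕ.>-nonZero⁻¹ h)}} (+-cancelˡ-≡ (y i) _ _ (begin
          y i + (+ toℕ s + z₁ * + N) * + h ≡⟨ e₁ ⟨
          y (step i (toℕ s))               ≡⟨ cong y s≡ ⟩
          y i                              ≡⟨ eq ⟩
          y j + z * + N * + h              ≡⟨ cong (λ x → y x + z * + N * + h) t≡ ⟨
          y (step i (toℕ t)) + z * + N * + h ≡⟨ cong (_+ z * + N * + h) e₂ ⟩
          (y i + (+ toℕ t + z₂ * + N) * + h) + z * + N * + h
                                           ≡⟨ eq′ (y i) (+ toℕ t) z₂ z (+ N) (+ h) ⟩
          y i + (+ toℕ t + (z₂ + z) * + N) * + h ∎)))
        where open ≡-Reasoning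

  -- Periodic point sets that a displacement maps to themselves.

  Closed : ∀ {N} → ℕ → (Fin N → ℤ) → (Fin N → ℤ) → Set
  Closed P e y = ∀ i → ∃₂ λ j ε → y i + e i ≡ y j + ε * + P

  _⊞_ : ∀ {N} → (Fin N → ℤ) → (Fin N → ℤ) → Fin N → ℤ
  (y ⊞ e) i = y i + e i

  -- The multiset form of Closed, in terms of counting functions.
  Balanced : ∀ {N} (P : ℕ) .{{_ : ℕ.NonZero P}} → (Fin N → ℤ) → ℤ → (Fin N → ℤ) → Set
  Balanced P e J y = ∀ x → J + dual P (y ⊞ e) x ≡ dual P y x

  module _ {N} {P : ℕ} {e y : Fin N → ℤ} (cl : Closed P e y)
           (inj : Injective _≡_ _≡_ (proj₁ ∘ cl)) where

    private
      nx : Fin N → Fin N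
      nx = proj₁ ∘ cl
      ε : Fin N → ℤ
      ε = proj₁ ∘ proj₂ ∘ cl

    -- Summing the closing relations over all `i`, the values of `y` cancel because the successor
    -- map is a permutation.
    sum-displacement : sum e ≡ + P * sum ε
    sum-displacement = begin
      sum e
        ≡⟨ sum-cong-≗ {N} (λ i → ≡-transfer (proj₂ (proj₂ (cl i)))
          (eq (y i) (e i) (y (nx i)) (ε i) (+ P))) ⟩
      sum (λ i → (+ P * ε i + y (nx i)) - y i)
        ≡⟨ sum-- {N} _ y ⟩
      sum (λ i → + P * ε i + y (nx i)) - sum y
        ≡⟨ cong (_- sum y) (trans (∑-distrib-+ {N} (λ i → + P * ε i) (y ∘ nx))
             (cong₂ _+_ (sum-*ˡ {N} (+ P) ε) (sum-injective inj y))) ⟩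
      (+ P * sum ε + sum y) - sum y
        ≡⟨ eq′ (+ P * sum ε) (sum y) ⟩
      + P * sum ε ∎
      where
      open ≡-Reasoning
      eq : ∀ a e b ε p → b + ε * p - (a + e) ≡ (p * ε + b) - a - e
      eq = solve-∀
      eq′ : ∀ a b → (a + b) - b ≡ a
      eq′ = solve-∀

    -- A translation by `ε i` periods changes the corresponding summand of the count by `ε i`; what
    -- is left is a permutation of the summands.
    closed⇒balanced : .{{_ : ℕ.NonZero P}} → Balanced P e (sum ε) y
    closed⇒balanced x = begin
      sum ε + sum (λ i → (x - (y i + e i)) /ℕ P + 1ℤ)
        ≡⟨ ∑-distrib-+ {N} ε _ ⟨
      sum (λ i → ε i + ((x - (y i + e i)) /ℕ P + 1ℤ))
        ≡⟨ sum-cong-≗ {N} (λ i → begin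
             ε i + ((x - (y i + e i)) /ℕ P + 1ℤ)
               ≡⟨ eq (ε i) ((x - (y i + e i)) /ℕ P) ⟩
             (x - (y i + e i)) /ℕ P + ε i + 1ℤ
               ≡⟨ cong (_+ 1ℤ) (/-+-* (x - (y i + e i)) (ε i)) ⟨
             (x - (y i + e i) + ε i * + P) /ℕ P + 1ℤ
               ≡⟨ cong (λ z → (x - z + ε i * + P) /ℕ P + 1ℤ) (proj₂ (proj₂ (cl i))) ⟩
             (x - (y (nx i) + ε i * + P) + ε i * + P) /ℕ P + 1ℤ
               ≡⟨ cong (λ z → z /ℕ P + 1ℤ) (eq′ x (y (nx i)) (ε i * + P)) ⟩
             (x - y (nx i)) /ℕ P + 1ℤ ∎) ⟩
      sum (λ i → (x - y (nx i)) /ℕ P + 1ℤ)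
        ≡⟨ sum-injective inj (λ i → (x - y i) /ℕ P + 1ℤ) ⟩
      sum (λ i → (x - y i) /ℕ P + 1ℤ) ∎
      where
      open ≡-Reasoning
      eq : ∀ a b → a + (b + 1ℤ) ≡ b + a + 1ℤ
      eq = solve-∀
      eq′ : ∀ a b c → a - (b + c) + c ≡ a - b
      eq′ = solve-∀

  -- All summands are monotone, and the one belonging to `y i` rises from 0 to 1 at `y i`.
  dual-jump : ∀ {N} P .{{_ : ℕ.NonZero P}} (y : Fin N → ℤ) i →
              dual P y (y i - 1ℤ) < dual P y (y i)
  dual-jump {N} P y i = ≰⇒> λ d≤d → contradiction
    (trans (sym at₋₁) (trans (sum-mono-≡ {N}
      (λ j → +-monoˡ-≤ 1ℤ (/-mono {x = y i - 1ℤ - y j} {y i - y j}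
      (+-monoˡ-≤ (- y j) (≤-transfer {a = 0ℤ} {1ℤ} {y i - 1ℤ} {y i} (+≤+ ℕ.z≤n) (eq (y i)))))) d≤d i) at₀))
    λ ()
    where
    eq : ∀ a → 1ℤ - 0ℤ ≡ a - (a - 1ℤ)
    eq = solve-∀
    eq₀ : ∀ a → a - a ≡ 0ℤ
    eq₀ = solve-∀
    eq₁ : ∀ a → a - 1ℤ - a ≡ -1ℤ
    eq₁ = solve-∀
    0<P : + 0 < + P
    0<P = +<+ (ℕ.>-nonZero⁻¹ P)
    at₋₁ : (y i - 1ℤ - y i) /ℕ P + 1ℤ ≡ 0ℤ
    at₋₁ = cong (_+ 1ℤ) (trans (cong (_/ℕ P) (eq₁ (y i)))
      (/-unique {q = -1ℤ} (subst (_≤ -1ℤ) (sym (-1*i≡-i (+ P))) (neg-mono-≤ (<⇒+1≤ 0<P))) -<+))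
    at₀ : (y i - y i) /ℕ P + 1ℤ ≡ 1ℤ
    at₀ = cong (_+ 1ℤ) (trans (cong (_/ℕ P) (eq₀ (y i)))
      (/-unique {q = 0ℤ} ≤-refl (subst (0ℤ <_) (sym (*-identityˡ (+ P))) 0<P)))

  module _ {N P : ℕ} .{{_ : ℕ.NonZero N}} .{{_ : ℕ.NonZero P}} {g : ℤ → ℤ}
           (mono : Nondecreasing g) (per : Quasiperiodic N P g) where

    -- The counting function of the displaced points jumps at each of them. By balance so does that
    -- of `g`, which can jump only at a value of the periodic sequence.
    balanced⇒closed : ∀ {e J} → Balanced P e J [ g ] → Closed P e [ g ]
    balanced⇒closed {e} {J} bal i = fromℕ< j% , (j /ℕ N) , trans (sym gj≡x) (trans
        (cong g (a≡a%ℕn+[a/ℕn]*n j N))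
        (trans (per-* {N} {P} {g} per (+ (j %ℕ N)) (j /ℕ N))
          (cong (λ t → g (+ t) + (j /ℕ N) * + P) (sym (toℕ-fromℕ< j%)))))
      where
      x = g (+ toℕ i) + e i
      -- The first index with a value above `x - 1`; as it lies below the count at `x`, its value is
      -- `x`.
      j = dual P ([_] {N} g) (x - 1ℤ)
      j% = n%ℕd<d j N
      j<dual : j < dual P ([_] {N} g) x
      j<dual = subst₂ _<_ (bal (x - 1ℤ)) (bal x) (+-monoʳ-< J (dual-jump P ([ g ] ⊞ e) i))
      gj≡x : g j ≡ x
      gj≡x = ≤-antisym
        (≮⇒≥ λ x<gj → <⇒≱ j<dual (dual-≤ P mono per x x<gj))
        (≮⇒≥ λ gj<x → <-irrefl refl (dual-> P mono per (x - 1ℤ)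
          (≤-transfer (<⇒+1≤ gj<x) (eq (g j) x))))
        where eq : ∀ a b → b - (a + 1ℤ) ≡ b - 1ℤ - a
              eq = solve-∀

  -- The word of a sequence of integers.

  Distinct : ∀ {N} → (Fin N → ℤ) → Set
  Distinct {N} a = ∀ {i j} z → a i ≡ a j + z * + N → i ≡ j

  module _ {N m : ℕ} where

    displacement : (Fin N → Fin m) → Fin N → ℤ
    displacement w i = 1ℤ + + toℕ (w i) * + N

    -- w i counts the turns of length N, modulo m, from a i to the point of the
    -- next residue class modulo N.
    IsWord : (Fin N → ℤ) → (Fin N → Fin m) → Set
    IsWord a w = Closed (m ℕ.* N) (displacement w) a

    private
      split : ∀ ε → ε * + (m ℕ.* N) ≡ ε * + m * + N
      split ε = trans (cong (ε *_) (pos-* m N)) (sym (*-assoc ε (+ m) (+ N)))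

    word-translate : ∀ {a b w} t → (∀ i → b i ≡ a i + t) → IsWord a w → IsWord b w
    word-translate {a} {b} {w} t b≡ isW i =
      let j , ε , e = isW i
      in  j , ε , (begin
        b i + displacement w i             ≡⟨ cong (_+ displacement w i) (b≡ i) ⟩
        a i + t + displacement w i         ≡⟨ eq (a i) t (displacement w i) ⟩
        a i + displacement w i + t         ≡⟨ cong (_+ t) e ⟩
        a j + ε * + (m ℕ.* N) + t          ≡⟨ eq (a j) (ε * + (m ℕ.* N)) t ⟩
        a j + t + ε * + (m ℕ.* N)          ≡⟨ cong (_+ ε * + (m ℕ.* N)) (b≡ j) ⟨
        b j + ε * + (m ℕ.* N)              ∎)
      where
      open ≡-Reasoning
      eq : ∀ a b c → a + b + c ≡ a + c + b
      eq = solve-∀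

    module _ .{{_ : ℕ.NonZero N}} where

      -- Modulo `N` every displacement is 1, so following successors runs through all residue
      -- classes.
      word⇒distinct : ∀ {a w} → IsWord a w → Distinct a
      word⇒distinct {a} {w} isW {i} {j} z ai≡ =
        Orbit.residues-distinct 1 {y = a} next z
          (trans ai≡ (cong (_+_ (a j)) (sym (*-identityʳ (z * + N)))))
        where
        next : ∀ i → ∃₂ λ j z → a j ≡ a i + (1ℤ + z * + N) * 1ℤ
        next i =
          let j , ε , e = isW i
          in  j , + toℕ (w i) - ε * + m ,
              ≡-transfer (sym (trans e (cong (_+_ (a j)) (split ε))))
                (eq (a i) (a j) (+ toℕ (w i)) (ε * + m) (+ N))
          where
          eq : ∀ a b w ε n → (a + (1ℤ + w * n)) - (b + ε * n) ≡ a + (1ℤ + (w - ε) * n) * 1ℤ - b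
          eq = solve-∀

      -- Two points with the same successor are congruent modulo `N`.
      word-successor-injective : ∀ {a w} (isW : IsWord a w) → Injective _≡_ _≡_ (proj₁ ∘ isW)
      word-successor-injective {a} {w} isW {i} {i′} j≡j′ =
        let j  , ε  , e  = isW i
            j′ , ε′ , e′ = isW i′
        in  word⇒distinct {a} {w} isW {i} {i′} (ε * + m - ε′ * + m - (+ toℕ (w i) - + toℕ (w i′)))
              (≡-transfer
              (cong₂ _-_ (trans e (cong (_+_ (a j)) (split ε)))
                         (trans e′ (trans (cong (_+_ (a j′)) (split ε′))
                           (cong (λ x → a x + ε′ * + m * + N) (sym j≡j′)))))
              (eq (a i) (a i′) (a j) (+ toℕ (w i)) (+ toℕ (w i′)) (ε * + m) (ε′ * + m) (+ N)))
        where
        eq : ∀ a a′ b w w′ ε ε′ n →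
             ((b + ε * n) - (b + ε′ * n)) - ((a + (1ℤ + w * n)) - (a′ + (1ℤ + w′ * n))) ≡
             (a′ + ((ε - ε′) - (w - w′)) * n) - a
        eq = solve-∀

      -- The successor of `a i` is fixed by its residue class modulo `N`; then the number of turns
      -- is fixed modulo `m`.
      word-unique : ∀ {a w w′} .{{_ : ℕ.NonZero m}} → IsWord a w → IsWord a w′ → ∀ i → w i ≡ w′ i
      word-unique {a} {w} {w′} isW isW′ i =
        let j  , ε  , e  = isW i
            j′ , ε′ , e′ = isW′ i
            e₁ = trans e (cong (_+_ (a j)) (split ε))
            e₂ = trans e′ (cong (_+_ (a j′)) (split ε′))
            j≡j′ = word⇒distinct {a} {w} isW {j} {j′} (+ toℕ (w i) - + toℕ (w′ i) - (ε - ε′) * + m)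
              (≡-transfer (cong₂ _-_ e₂ e₁)
                (eq (a i) (a j) (a j′) (+ toℕ (w i)) (+ toℕ (w′ i)) ε ε′ (+ m) (+ N)))
        in  toℕ-mod-injective {y = ε′} {ε} (*-cancelʳ-≡ _ _ (+ N) {{ℕ.>-nonZero (ℕ.>-nonZero⁻¹ N)}}
              (≡-transfer (cong₂ _-_ e₁ (trans e₂ (cong (λ x → a x + ε′ * + m * + N) (sym j≡j′))))
                (eq′ (a i) (a j) (+ toℕ (w i)) (+ toℕ (w′ i)) ε ε′ (+ m) (+ N))))
        where
        eq : ∀ a b b′ w w′ ε ε′ m n →
          ((b′ + ε′ * m * n) - (b + ε * m * n)) - ((a + (1ℤ + w′ * n)) - (a + (1ℤ + w * n))) ≡
          (b′ + ((w - w′ - (ε - ε′) * m)) * n) - b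
        eq = solve-∀
        eq′ : ∀ a b w w′ ε ε′ m n →
          ((b + ε * m * n) - (b + ε′ * m * n)) - ((a + (1ℤ + w * n)) - (a + (1ℤ + w′ * n))) ≡
          (w′ + ε * m) * n - (w + ε′ * m) * n
        eq′ = solve-∀

      -- `N` distinct residues exhaust all residues, so some `a j` lies in the class of `a i + 1`.
      -- The letter is the number `z i` of turns in between, reduced modulo `m`.
      word-exists : ∀ {a} .{{_ : ℕ.NonZero m}} → Distinct a → ∃ (IsWord a)
      word-exists {a} dist = w , λ i → j i , - (z i /ℕ m) , sym (begin
        a (j i) + - (z i /ℕ m) * + (m ℕ.* N)
          ≡⟨ cong₂ _+_ (aj≡ i) (split (- (z i /ℕ m))) ⟩
        a i + (1ℤ + z i * + N) + - (z i /ℕ m) * + m * + N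
          ≡⟨ cong (λ z′ → a i + (1ℤ + z′ * + N) + - (z i /ℕ m) * + m * + N) (a≡a%ℕn+[a/ℕn]*n (z i) m) ⟩
        a i + (1ℤ + (+ (z i %ℕ m) + (z i /ℕ m) * + m) * + N) + - (z i /ℕ m) * + m * + N
          ≡⟨ eq (a i) (+ (z i %ℕ m)) (z i /ℕ m) (+ m) (+ N) ⟩
        a i + (1ℤ + + (z i %ℕ m) * + N)
          ≡⟨ cong (λ r → a i + (1ℤ + + r * + N)) (toℕ-fromℕ< (n%ℕd<d (z i) m)) ⟨
        a i + (1ℤ + + toℕ (w i) * + N) ∎)
        where
        open ≡-Reasoning
        eq : ∀ a r q m n → a + (1ℤ + (r + q * m) * n) + - q * m * n ≡ a + (1ℤ + r * n)
        eq = solve-∀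
        residue : ℤ → Fin N
        residue x = fromℕ< (n%ℕd<d x N)
        residue-≡ : ∀ {x y} → residue x ≡ residue y → x ≡ y + (x /ℕ N - y /ℕ N) * + N
        residue-≡ {x} {y} r≡ = ≡-transfer
          (cong₂ _-_
            (trans (a≡a%ℕn+[a/ℕn]*n x N) (cong (λ r → + r + (x /ℕ N) * + N)
              (trans (sym (toℕ-fromℕ< (n%ℕd<d x N))) (trans (cong toℕ r≡) (toℕ-fromℕ< (n%ℕd<d y N))))))
            (a≡a%ℕn+[a/ℕn]*n y N))
          (eq′ x y (+ (y %ℕ N)) (x /ℕ N) (y /ℕ N) (+ N))
          where
          eq′ : ∀ x y r q q′ n → ((r + q * n) - (r + q′ * n)) - (x - y) ≡ (y + (q - q′) * n) - x
          eq′ = solve-∀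
        res-inj : Injective _≡_ _≡_ (residue ∘ a)
        res-inj {x} {y} e = dist (a x /ℕ N - a y /ℕ N) (residue-≡ {a x} {a y} e)
        j : Fin N → Fin N
        j i = proj₁ (injective⇒surjective res-inj (residue (a i + 1ℤ)))
        z : Fin N → ℤ
        z i = a (j i) /ℕ N - (a i + 1ℤ) /ℕ N
        aj≡ : ∀ i → a (j i) ≡ a i + (1ℤ + z i * + N)
        aj≡ i = trans (residue-≡ {a (j i)} {a i + 1ℤ}
          (proj₂ (injective⇒surjective res-inj (residue (a i + 1ℤ)))))
          (+-assoc (a i) 1ℤ (z i * + N))
        w : Fin N → Fin m
        w i = fromℕ< (n%ℕd<d (z i) m)

      -- The defining congruence of words: the displacements add up to a multiple of `m N`, and a
      -- factor `N` cancels.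
      sum-word : ∀ {a w} .{{_ : ℕ.NonZero m}} → IsWord a w →
                 ∃ λ J → 1ℤ + sum (λ i → + toℕ (w i)) ≡ + m * J
      sum-word {a} {w} isW = Σε ,
        *-cancelʳ-≡ _ _ (+ N) {{ℕ.>-nonZero (ℕ.>-nonZero⁻¹ N)}} (begin
          (1ℤ + S) * + N                    ≡⟨ eq S (+ N) ⟩
          + N * 1ℤ + + N * S                ≡⟨ cong₂ _+_ (sum-const N 1ℤ)
            (sum-*ˡ {N} (+ N) (λ i → + toℕ (w i))) ⟨
          sum {N} (λ _ → 1ℤ) + sum (λ i → + N * + toℕ (w i))
                                            ≡⟨ ∑-distrib-+ {N} (λ _ → 1ℤ) (λ i → + N * + toℕ (w i)) ⟨
          sum (λ i → 1ℤ + + N * + toℕ (w i)) ≡⟨ sum-cong-≗ {N}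
            (λ i → cong (_+_ 1ℤ) (*-comm (+ N) (+ toℕ (w i)))) ⟩
          sum (displacement w)              ≡⟨ sum-displacement {P = m ℕ.* N} {displacement w} {a} isW
            (word-successor-injective {a} {w} isW) ⟩
          + (m ℕ.* N) * Σε                   ≡⟨ trans (cong (_* Σε) (pos-* m N)) (eq′ (+ m) (+ N) Σε) ⟩
          + m * Σε * + N                     ∎)
        where
        open ≡-Reasoning
        S = sum (λ i → + toℕ (w i))
        Σε = sum (proj₁ ∘ proj₂ ∘ isW)
        eq : ∀ s n → (1ℤ + s) * n ≡ n * 1ℤ + n * s
        eq = solve-∀
        eq′ : ∀ m n j → m * n * j ≡ m * j * n
        eq′ = solve-∀

      -- The closing relation survives scaling by `h` and translation by `t`; scaling makes room for
      -- translations by a fraction of the original unit. The constant `J` depends only on the sum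
      -- of `e`.
      word⇒balanced : ∀ {a w P e} h t .{{_ : ℕ.NonZero P}} → P ≡ h ℕ.* (m ℕ.* N) →
        (∀ i → e i ≡ displacement w i * + h) → IsWord a w →
        ∃ λ J → sum e ≡ + P * J × Balanced P e J (λ i → a i * + h + t)
      word⇒balanced {a} {w} {P} {e} h t P≡ e≡ isW =
        sum ε , sum-displacement {P = P} {e} {λ i → a i * + h + t} cl inj , closed⇒balanced cl inj
        where
        ε = proj₁ ∘ proj₂ ∘ isW
        inj = word-successor-injective {a} {w} isW
        cl : Closed P e (λ i → a i * + h + t)
        cl i = proj₁ (isW i) , ε i , (begin
          a i * + h + t + e i                      ≡⟨ cong (_+_ (a i * + h + t)) (e≡ i) ⟩
          a i * + h + t + displacement w i * + h   ≡⟨ eq (a i) (+ h) t (displacement w i) ⟩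
          (a i + displacement w i) * + h + t       ≡⟨ cong (λ x → x * + h + t) (proj₂ (proj₂ (isW i))) ⟩
          (a _ + ε i * + (m ℕ.* N)) * + h + t      ≡⟨ eq′ (a _) (ε i) (+ (m ℕ.* N)) (+ h) t ⟩
          a _ * + h + t + ε i * (+ h * + (m ℕ.* N)) ≡⟨ cong (λ p → a _ * + h + t + ε i * p)
            (trans (cong +_ P≡) (pos-* h (m ℕ.* N))) ⟨
          a _ * + h + t + ε i * + P                ∎)
          where
          open ≡-Reasoning
          eq : ∀ a h t d → a * h + t + d * h ≡ (a + d) * h + t
          eq = solve-∀
          eq′ : ∀ a ε M h t → (a + ε * M) * h + t ≡ a * h + t + ε * (h * M)
          eq′ = solve-∀

  -- Minima of balanced sequences, and uniqueness of the sequence with a given word.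

  extend : ∀ {N} M .{{_ : ℕ.NonZero N}} → (Fin N → ℤ) → ℤ → ℤ
  extend {N} M a x = a (fromℕ< (n%ℕd<d x N)) + (x /ℕ N) * + M

  module _ {N M : ℕ} .{{_ : ℕ.NonZero N}} {a : Fin N → ℤ} where

    extend-[] : ∀ i → [_] {N} (extend M a) i ≡ a i
    extend-[] i = trans (cong₂ (λ j q → a j + q * + M) j≡i (toℕ/ i)) (eq (a i) (+ M))
      where
      eq : ∀ a m → a + 0ℤ * m ≡ a
      eq = solve-∀
      j≡i : fromℕ< (n%ℕd<d (+ toℕ i) N) ≡ i
      j≡i = toℕ-mod-injective {y = + toℕ i /ℕ N} {0ℤ} (trans
        (cong (λ r → + r + (+ toℕ i /ℕ N) * + N) (toℕ-fromℕ< (n%ℕd<d (+ toℕ i) N)))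
        (trans (sym (a≡a%ℕn+[a/ℕn]*n (+ toℕ i) N)) (eq′ (+ toℕ i) (+ N))))
        where
        eq′ : ∀ a n → a ≡ a + 0ℤ * n
        eq′ = solve-∀

    extend-per : Quasiperiodic N M (extend M a)
    extend-per x = trans
      (cong₂ (λ j q → a j + q * + M) j≡ x/≡)
      (eq (a _) (x /ℕ N) (+ M))
      where
      eq : ∀ a q m → a + (q + 1ℤ) * m ≡ a + q * m + m
      eq = solve-∀
      x/≡ : (x + + N) /ℕ N ≡ x /ℕ N + 1ℤ
      x/≡ = trans (cong (λ n → (x + n) /ℕ N) (sym (*-identityˡ (+ N)))) (/-+-* x 1ℤ)
      j≡ : fromℕ< (n%ℕd<d (x + + N) N) ≡ fromℕ< (n%ℕd<d x N)
      j≡ = Fin.toℕ-injective (trans (toℕ-fromℕ< (n%ℕd<d (x + + N) N)) (trans (+-injective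
        (+-cancelʳ-≡ ((x + + N) /ℕ N * + N) _ _ (trans (sym (a≡a%ℕn+[a/ℕn]*n (x + + N) N))
          (trans (cong (_+ + N) (a≡a%ℕn+[a/ℕn]*n x N))
            (trans (eq′ (+ (x %ℕ N)) (x /ℕ N) (+ N)) (cong (λ q → + (x %ℕ N) + q * + N) (sym x/≡)))))))
        (sym (toℕ-fromℕ< (n%ℕd<d x N)))))
        where
        eq′ : ∀ r q n → r + q * n + n ≡ r + (q + 1ℤ) * n
        eq′ = solve-∀

    extend-mono : (∀ {i j} → toℕ i ℕ.≤ toℕ j → a i ≤ a j) → (∀ i j → a i ≤ a j + + M) →
                  Nondecreasing (extend M a)
    extend-mono mono wrap {x} {y} x≤y with <-cmp (x /ℕ N) (y /ℕ N)
    ... | tri> _ _ y/<x/ = contradiction (/-mono x≤y) (<⇒≱ y/<x/)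
    ... | tri≈ _ x/≡y/ _ = +-mono-≤
      (mono (subst₂ ℕ._≤_ (sym (toℕ-fromℕ< (n%ℕd<d x N))) (sym (toℕ-fromℕ< (n%ℕd<d y N))) %≤))
      (≤-reflexive (cong (_* + M) x/≡y/))
      where
      %≤ : x %ℕ N ℕ.≤ y %ℕ N
      %≤ = drop‿+≤+ (≤-transfer (subst₂ _≤_ (a≡a%ℕn+[a/ℕn]*n x N) (a≡a%ℕn+[a/ℕn]*n y N) x≤y)
        (trans (cong (λ q → + (y %ℕ N) + (y /ℕ N) * + N - (+ (x %ℕ N) + q * + N)) x/≡y/)
          (eq (+ (x %ℕ N)) (+ (y %ℕ N)) (y /ℕ N) (+ N))))
        where
        eq : ∀ r r′ q n → r′ + q * n - (r + q * n) ≡ r′ - r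
        eq = solve-∀
    ... | tri< x/<y/ _ _ = ≤-trans (+-monoˡ-≤ ((x /ℕ N) * + M) (wrap _ (fromℕ< (n%ℕd<d y N))))
      (≤-trans (≤-reflexive (eq (a _) (+ M) (x /ℕ N)))
        (+-monoʳ-≤ (a (fromℕ< (n%ℕd<d y N))) (*-monoʳ-≤-nonNeg (+ M) (<⇒+1≤ x/<y/))))
      where
      eq : ∀ a m q → a + m + q * m ≡ a + (q + 1ℤ) * m
      eq = solve-∀

  module _ {N P : ℕ} .{{_ : ℕ.NonZero N}} .{{_ : ℕ.NonZero P}} {g h : ℤ → ℤ}
           (g-mono : Nondecreasing g) (g-per : Quasiperiodic N P g)
           (h-mono : Nondecreasing h) (h-per : Quasiperiodic N P h) where

    ⊓-mono : Nondecreasing (λ x → g x ⊓ h x)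
    ⊓-mono x≤y = ⊓-mono-≤ (g-mono x≤y) (h-mono x≤y)

    ⊓-per : Quasiperiodic N P (λ x → g x ⊓ h x)
    ⊓-per x = trans (cong₂ _⊓_ (g-per x) (h-per x))
      (sym (mono-≤-distrib-⊓ {_+ + P} (+-monoˡ-≤ (+ P)) (g x) (h x)))

    -- The displaced minimum counts at least as many points as the minimum;
    -- equality follows because both counting functions have the same sum.
    ⊓-balanced : ∀ {e J} → sum e ≡ + P * J →
      Balanced P e J ([_] {N} g) → Balanced P e J ([_] {N} h) →
      Balanced P e J ([_] {N} (λ x → g x ⊓ h x))
    ⊓-balanced {e} {J} Σe bal-g bal-h x = sym (≤∧sum≥⇒≗ {P} {N}
      (dual-per P c) right-per below (≤-reflexive sums) x)
      where
      c : Fin N → ℤ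
      c = [ (λ x → g x ⊓ h x) ]
      right : ℤ → ℤ
      right x = J + dual P (c ⊞ e) x
      right-per : Quasiperiodic P N right
      right-per x = trans (cong (_+_ J) (dual-per P (c ⊞ e) x)) (sym (+-assoc J _ _))

      below′ : ∀ x {f} → Nondecreasing f → Quasiperiodic N P f → Balanced P e J ([_] {N} f) →
        (∀ i → c i ≤ [ f ] i) → f (dual P c x - 1ℤ) ≤ x → dual P c x ≤ right x
      below′ x {f} f-mono f-per bal c≤f f≤x = begin
        dual P c x              ≤⟨ -1<⇒≤ (dual-> {N} P f-mono f-per x f≤x) ⟩
        dual {N} P [ f ] x      ≡⟨ bal x ⟨
        J + dual P ([ f ] ⊞ e) x ≤⟨ +-monoʳ-≤ J (dual-antimono P (λ i → +-monoˡ-≤ (e i) (c≤f i)) x) ⟩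
        J + dual P (c ⊞ e) x    ∎
        where
        open ≤-Reasoning

      below : ∀ x → dual P c x ≤ right x
      below x = choose (⊓-sel (g i) (h i))
        where
        -- The last index at which the minimum is at most `x`. Whichever of `g` and `h` attains it
        -- there counts at least as many points up to `x` as the minimum does.
        i = dual P c x - 1ℤ
        c≤x : g i ⊓ h i ≤ x
        c≤x = ≮⇒≥ λ x<c → <-irrefl refl (<-≤-trans
          (-1< (dual P c x)) (dual-≤ P ⊓-mono ⊓-per x {i} x<c))
        choose : g i ⊓ h i ≡ g i ⊎ g i ⊓ h i ≡ h i → dual P c x ≤ right x
        choose (inj₁ c≡g) = below′ x g-mono g-per bal-g (λ _ → i⊓j≤i _ _) (subst (_≤ x) c≡g c≤x)
        choose (inj₂ c≡h) = below′ x h-mono h-per bal-h (λ _ → i⊓j≤j _ _) (subst (_≤ x) c≡h c≤x)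

      sums : sum {P} [ right ] ≡ sum {P} [ dual P c ]
      sums = begin
        sum {P} [ right ]
          ≡⟨ ∑-distrib-+ {P} (λ _ → J) [ dual P (c ⊞ e) ] ⟩
        sum {P} (λ _ → J) + sum {P} [ dual P (c ⊞ e) ]
          ≡⟨ cong₂ _+_ (sum-const P J) (sum-dual P (c ⊞ e)) ⟩
        + P * J + (+ N * + P - sum (c ⊞ e))
          ≡⟨ cong₂ (λ a b → a + (+ N * + P - b)) (sym Σe) (∑-distrib-+ {N} c e) ⟩
        sum e + (+ N * + P - (sum c + sum e))
          ≡⟨ eq (sum e) (+ N * + P) (sum c) ⟩
        + N * + P - sum c
          ≡⟨ sum-dual P c ⟨
        sum {P} [ dual P c ] ∎
        where
        open ≡-Reasoning
        eq : ∀ e p c → e + (p - (c + e)) ≡ p - c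
        eq = solve-∀

  even≢odd : ∀ x y → x * + 2 ≢ y * + 2 + 1ℤ
  even≢odd x y eq = Fin.0≢1+n (toℕ-mod-injective {2} {zero} {suc zero} {x} {y}
    (trans (+-identityˡ _) (trans eq (+-comm (y * + 2) 1ℤ))))

  module _ {N m : ℕ} .{{_ : ℕ.NonZero N}} .{{_ : ℕ.NonZero m}} {w : Fin N → Fin m}
           {a b : ℤ → ℤ}
           (a-mono : Nondecreasing a) (a-per : Quasiperiodic N (m ℕ.* N) a)
           (b-mono : Nondecreasing b) (b-per : Quasiperiodic N (m ℕ.* N) b)
           (a-word : IsWord {N} [ a ] w) (b-word : IsWord {N} [ b ] w) where

    private
      M P : ℕ
      M = m ℕ.* N
      P = 2 ℕ.* M

      instance
        P≢0 : ℕ.NonZero P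
        P≢0 = ℕ.m*n≢0 2 M {{_}} {{ℕ.m*n≢0 m N}}

      module _ (s : ℤ) where

        -- Doubling leaves room for a translation of b by the half-integer
        -- s + 1/2.
        g h : ℤ → ℤ
        g x = a x * + 2 + 0ℤ
        h x = b x * + 2 + (s * + 2 + 1ℤ)

        e : Fin N → ℤ
        e i = displacement w i * + 2

        doubled : ∀ {f} → Nondecreasing f → ∀ t → Nondecreasing (λ x → f x * + 2 + t)
        doubled f-mono t x≤y = +-monoˡ-≤ t (*-monoʳ-≤-nonNeg (+ 2) (f-mono x≤y))

        doubled-per : ∀ f → Quasiperiodic N M f → ∀ t → Quasiperiodic N P (λ x → f x * + 2 + t)
        doubled-per f f-per t x = trans (cong (λ y → y * + 2 + t) (f-per x))
          (trans (eq (f x) (+ M) t) (cong (_+_ (f x * + 2 + t)) (sym (pos-* 2 M))))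
          where eq : ∀ a m t → (a + m) * + 2 + t ≡ (a * + 2 + t) + + 2 * m
                eq = solve-∀

        c : ℤ → ℤ
        c x = g x ⊓ h x

        c-closed : Closed P e ([_] {N} c)
        c-closed = balanced⇒closed {g = c} (⊓-mono gm gp hm hp) (⊓-per gm gp hm hp) {e} {proj₁ A}
          (⊓-balanced gm gp hm hp (proj₁ (proj₂ A)) (proj₂ (proj₂ A))
            (subst (λ J → Balanced P e J ([_] {N} h)) J₂≡J₁ (proj₂ (proj₂ B))))
          where
          gm : Nondecreasing g
          gm = doubled a-mono 0ℤ
          gp : Quasiperiodic N P g
          gp = doubled-per a a-per 0ℤ
          hm : Nondecreasing h
          hm = doubled b-mono (s * + 2 + 1ℤ)
          hp : Quasiperiodic N P h
          hp = doubled-per b b-per (s * + 2 + 1ℤ)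
          A = word⇒balanced {a = [ a ]} {w} {P} {e} 2 0ℤ refl (λ _ → refl) a-word
          B = word⇒balanced {a = [ b ]} {w} {P} {e} 2 (s * + 2 + 1ℤ) refl (λ _ → refl) b-word
          -- The minimum is balanced only for a common constant; both constants are the sum of `e`
          -- divided by `P`.
          J₂≡J₁ : proj₁ B ≡ proj₁ A
          J₂≡J₁ = *-cancelˡ-≡ (+ P) _ _ {{ℕ.>-nonZero (ℕ.>-nonZero⁻¹ P)}}
            (trans (sym (proj₁ (proj₂ B))) (proj₁ (proj₂ A)))

        -- After doubling, every displacement is twice a number congruent to 1 modulo `N`, so the
        -- chain of successors visits all indices in even steps.
        same-parity : ∀ i j → ∃ λ z → [_] {N} c j ≡ [_] {N} c i + z * + 2
        same-parity = Orbit.all-congruent 2 {y = [ c ]} λ i →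
          let j , ε , eq = c-closed i
          in  j , + toℕ (w i) - ε * + m ,
              ≡-transfer (sym (trans eq (cong (λ p → [ c ] j + ε * p)
                  (trans (pos-* 2 M) (cong (_*_ (+ 2)) (pos-* m N))))))
                (eq′ ([ c ] i) ([ c ] j) (+ toℕ (w i)) ε (+ m) (+ N))
          where
          eq′ : ∀ a b w ε m n → (a + (1ℤ + w * n) * + 2) - (b + ε * (+ 2 * (m * n))) ≡
                                a + (1ℤ + (w - ε * m) * n) * + 2 - b
          eq′ = solve-∀

        -- Values of `g` are even and values of `h` odd, so by `same-parity` the minimum is attained
        -- by the same one of the two at every index.
        split-level : (i j : Fin N) → [ a ] i ≤ [ b ] i + s → [ a ] j ≤ [ b ] j + s
        split-level i j ai≤ = ≮⇒≥ λ bj< →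
          let z , cj≡ = same-parity j i
          in  even≢odd ([ a ] i) ([ b ] j + s + z) (begin
            [ a ] i * + 2                           ≡⟨ +-identityʳ _ ⟨
            [ a ] i * + 2 + 0ℤ                      ≡⟨ i≤j⇒i⊓j≡i {g (+ toℕ i)} {h (+ toℕ i)}
              (≤-transfer {b = ([ b ] i + s) * + 2 + 1ℤ}
              (≤-trans (*-monoʳ-≤-nonNeg (+ 2) ai≤) (i≤i+j _ 1ℤ)) (eq₁ ([ a ] i) ([ b ] i) s)) ⟨
            [ c ] i                                 ≡⟨ cj≡ ⟩
            [ c ] j + z * + 2                       ≡⟨ cong (_+ z * + 2)
              (i≥j⇒i⊓j≡j {g (+ toℕ j)} {h (+ toℕ j)}
              (≤-transfer {a = ([ b ] j + s + 1ℤ) * + 2}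
              (≤-trans (*-monoʳ-≤-nonNeg (+ 2) (<⇒+1≤ bj<)) (i≤i+j _ 1ℤ))
              (eq₂ ([ a ] j) ([ b ] j) s))) ⟩
            [ b ] j * + 2 + (s * + 2 + 1ℤ) + z * + 2 ≡⟨ eq₃ ([ b ] j) s z ⟩
            ([ b ] j + s + z) * + 2 + 1ℤ            ∎)
          where
          open ≡-Reasoning
          eq₁ : ∀ a b s → (b + s) * + 2 + 1ℤ - a * + 2 ≡ b * + 2 + (s * + 2 + 1ℤ) - (a * + 2 + 0ℤ)
          eq₁ = solve-∀
          eq₂ : ∀ a b s → a * + 2 + 1ℤ - (b + s + 1ℤ) * + 2 ≡ (a * + 2 + 0ℤ) -
            (b * + 2 + (s * + 2 + 1ℤ))
          eq₂ = solve-∀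
          eq₃ : ∀ b s z → b * + 2 + (s * + 2 + 1ℤ) + z * + 2 ≡ (b + s + z) * + 2 + 1ℤ
          eq₃ = solve-∀

    -- With `δ` the difference at one index, the level `s = δ` spreads the bound `a ≤ b + δ` from
    -- there to all indices. A strict inequality anywhere would hold at level `s = δ - 1` and spread
    -- back to that index, where equality holds.
    word-determines : ∃ λ t → ∀ i → [_] {N} a i ≡ [_] {N} b i + t
    word-determines = δ , λ i → ≤-antisym
      (split-level δ i₀ i (≤-reflexive (eq ([ a ] i₀) ([ b ] i₀))))
      (≮⇒≥ λ a< → <⇒≱ (+1≤⇒< (≤-reflexive (eq₂ ([ a ] i₀) ([ b ] i₀))))
        (split-level (δ - 1ℤ) i i₀ (≤-transfer (<⇒+1≤ a<) (eq′ ([ a ] i) ([ b ] i) δ))))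
      where
      i₀ : Fin N
      i₀ = fromℕ< (ℕ.>-nonZero⁻¹ N)
      δ = [ a ] i₀ - [ b ] i₀
      eq : ∀ a b → a ≡ b + (a - b)
      eq = solve-∀
      eq′ : ∀ a b δ → (b + δ) - (a + 1ℤ) ≡ b + (δ - 1ℤ) - a
      eq′ = solve-∀
      eq₂ : ∀ a b → b + (a - b - 1ℤ) + 1ℤ ≡ a
      eq₂ = solve-∀

  -- Existence of a sequence with a given word: orbits and cycles of `Φ`.

  minimum : ℕ → (ℕ → ℤ) → ℤ
  minimum zero    f = f 0
  minimum (suc n) f = minimum n f ⊓ f (suc n)

  minimum-≤ : ∀ {n t} f → t ℕ.≤ n → minimum n f ≤ f t
  minimum-≤ {zero}  f ℕ.z≤n = ≤-refl
  minimum-≤ {suc n} f t≤ with ℕ.m≤n⇒m<n∨m≡n t≤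
  ... | inj₁ t<   = ≤-trans (i⊓j≤i _ _) (minimum-≤ f (ℕ.s≤s⁻¹ t<))
  ... | inj₂ refl = i⊓j≤j (minimum n f) _

  minimum-glb : ∀ {n z} f → (∀ {t} → t ℕ.≤ n → z ≤ f t) → z ≤ minimum n f
  minimum-glb {zero}  f z≤ = z≤ ℕ.z≤n
  minimum-glb {suc n} f z≤ = ⊓-glb (minimum-glb f (z≤ ∘ ℕ.m≤n⇒m≤1+n)) (z≤ ℕ.≤-refl)

  minimum-mono : ∀ {n f g} → (∀ t → f t ≤ g t) → minimum n f ≤ minimum n g
  minimum-mono {n} {f} f≤g = minimum-glb {n} _ λ t≤ → ≤-trans (minimum-≤ f t≤) (f≤g _)

  minimum-+ : ∀ n f c → minimum n (λ t → f t + c) ≡ minimum n f + c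
  minimum-+ zero    f c = refl
  minimum-+ (suc n) f c = trans (cong (_⊓ (f (suc n) + c)) (minimum-+ n f c))
    (sym (mono-≤-distrib-⊓ {_+ c} (+-monoˡ-≤ c) (minimum n f) (f (suc n))))

  -- Bounded vectors are coded by `B ^ N` numbers, so two of the first `B ^ N + 1` times carry the
  -- same vector.
  recurrence : ∀ {N B} (o : ℕ → Fin N → ℤ) → (∀ t i → 0ℤ ≤ o t i × o t i < + B) →
               ∃₂ λ s d → ∀ i → o (s ℕ.+ suc d) i ≡ o s i
  recurrence {N} {B} o bnd = found (pigeonhole (ℕ.n<1+n (B ℕ.^ N)) (funToFin ∘ code ∘ toℕ))
    where
    code< : ∀ t i → ∣ o t i ∣ ℕ.< B
    code< t i = drop‿+<+ (subst (_< + B) (sym (0≤i⇒+∣i∣≡i (proj₁ (bnd t i)))) (proj₂ (bnd t i)))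
    code : ℕ → Fin N → Fin B
    code t i = fromℕ< (code< t i)
    decode : ∀ {s t} → funToFin (code s) ≡ funToFin (code t) → ∀ i → o s i ≡ o t i
    decode {s} {t} eq i = begin
      o s i               ≡⟨ 0≤i⇒+∣i∣≡i (proj₁ (bnd s i)) ⟨
      + ∣ o s i ∣         ≡⟨ cong +_ (toℕ-fromℕ< (code< s i)) ⟨
      + toℕ (code s i)    ≡⟨ cong (+_ ∘ toℕ) (finToFun-funToFin (code s) i) ⟨
      + toℕ (finToFun (funToFin (code s)) i) ≡⟨ cong (λ c → + toℕ (finToFun c i)) eq ⟩
      + toℕ (finToFun (funToFin (code t)) i) ≡⟨ cong (+_ ∘ toℕ) (finToFun-funToFin (code t) i) ⟩
      + toℕ (code t i)    ≡⟨ cong +_ (toℕ-fromℕ< (code< t i)) ⟩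
      + ∣ o t i ∣         ≡⟨ 0≤i⇒+∣i∣≡i (proj₁ (bnd t i)) ⟩
      o t i               ∎
      where open ≡-Reasoning
    found : (∃₂ λ i j → toℕ i ℕ.< toℕ j × funToFin (code (toℕ i)) ≡ funToFin (code (toℕ j))) →
            ∃₂ λ s d → ∀ i → o (s ℕ.+ suc d) i ≡ o s i
    found (i , j , i<j , eq) = toℕ i , toℕ j ℕ.∸ suc (toℕ i) , λ x →
      trans (cong (λ t → o t x) (trans (ℕ.+-suc (toℕ i) _) (ℕ.m+[n∸m]≡n i<j)))
            (sym (decode eq x))

  module _ {N M : ℕ} .{{_ : ℕ.NonZero N}} .{{_ : ℕ.NonZero M}}
           {e : Fin N → ℤ} {J : ℤ} (Σe : sum e ≡ + M * J) where

    private
      counts : (Fin N → ℤ) → ℤ → ℤ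
      counts a x = J + dual M (a ⊞ e) x

      -- Sorts the displaced points, shifting the indices by J so that the sum
      -- is preserved.
      Φ : (Fin N → ℤ) → ℤ → ℤ
      Φ a = dual {M} N [ counts a ]

      Φ-mono : ∀ {a b} → (∀ i → a i ≤ b i) → ∀ x → Φ a x ≤ Φ b x
      Φ-mono a≤b = dual-antimono {M} N λ x → +-monoʳ-≤ J
        (dual-antimono M (λ i → +-monoˡ-≤ (e i) (a≤b i)) (+ toℕ x))

      sum-Φ : ∀ a → sum {N} [ Φ a ] ≡ sum a
      sum-Φ a = begin
        sum {N} [ Φ a ]
          ≡⟨ sum-dual {M} N [ counts a ] ⟩
        + M * + N - sum {M} [ counts a ]
          ≡⟨ cong (_-_ (+ M * + N)) (trans (∑-distrib-+ {M} (λ _ → J) [ dual M (a ⊞ e) ])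
               (cong₂ _+_ (sum-const M J) (trans (sum-dual M (a ⊞ e))
                 (cong (_-_ (+ N * + M)) (trans (∑-distrib-+ {N} a e) (cong (_+_ (sum a)) Σe)))))) ⟩
        + M * + N - (+ M * J + (+ N * + M - (sum a + + M * J)))
          ≡⟨ eq (+ M) (+ N) J (sum a) ⟩
        sum a ∎
        where
        open ≡-Reasoning
        eq : ∀ m n j a → m * n - (m * j + (n * m - (a + m * j))) ≡ a
        eq = solve-∀

      orbit : ℕ → ℤ → ℤ
      orbit zero    = extend M {{it}} (λ (_ : Fin N) → 0ℤ)
      orbit (suc t) = Φ [ orbit t ]

      orbit-mono : ∀ t → Nondecreasing (orbit t)
      orbit-mono zero    = extend-mono (λ _ → ≤-refl) (λ _ _ → +≤+ ℕ.z≤n)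
      orbit-mono (suc t) = dual-mono {M} N _

      orbit-per : ∀ t → Quasiperiodic N M (orbit t)
      orbit-per zero    = extend-per {N} {M} {λ _ → 0ℤ}
      orbit-per (suc t) = dual-per {M} N _

      sum-orbit : ∀ t → sum {N} [ orbit t ] ≡ 0ℤ
      sum-orbit zero    = trans (sum-cong-≗ {N} (extend-[] {N} {M}))
                                (trans (sum-const N 0ℤ) (*-zeroʳ (+ N)))
      sum-orbit (suc t) = trans (sum-Φ [ orbit t ]) (sum-orbit t)

      module _ (t : ℕ) where

        lo : ∀ i → orbit t 0ℤ ≤ [_] {N} (orbit t) i
        lo i = orbit-mono t (+≤+ ℕ.z≤n)

        hi : ∀ i → [_] {N} (orbit t) i ≤ orbit t 0ℤ + + M
        hi i = ≤-trans (orbit-mono t (<⇒≤ (+<+ (toℕ<n i))))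
          (≤-reflexive (trans (cong (orbit t) (sym (+-identityˡ (+ N)))) (orbit-per t 0ℤ)))

        private
          N*-cancel : ∀ {x} → 0ℤ ≤ + N * x → 0ℤ ≤ x
          N*-cancel {x} 0≤ = *-cancelˡ-≤-pos 0ℤ x (+ N) {{positive (+<+ (ℕ.>-nonZero⁻¹ N))}}
            (subst (_≤ + N * x) (sym (*-zeroʳ (+ N))) 0≤)

          lo≤0 : orbit t 0ℤ ≤ 0ℤ
          lo≤0 = neg-cancel-≤ (N*-cancel (subst₂ _≤_ refl (neg-distribʳ-* (+ N) (orbit t 0ℤ))
            (neg-mono-≤ (subst₂ _≤_ (sum-const N _) (sum-orbit t) (sum-mono {N} lo)))))

          0≤hi : 0ℤ ≤ orbit t 0ℤ + + M
          0≤hi = N*-cancel (subst₂ _≤_ (sum-orbit t) (sum-const N _) (sum-mono {N} hi))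

        -- Monotonicity and quasiperiodicity confine a window to an interval of length `M`, and the
        -- sum 0 forces this interval to contain 0. Adding `M` puts the entries between 0 and `2 M`.
        orbit-bounded : ∀ i → 0ℤ ≤ [_] {N} (orbit t) i + + M ×
                              [_] {N} (orbit t) i + + M < + suc (M ℕ.+ M)
        orbit-bounded i =
          ≤-trans 0≤hi (+-monoˡ-≤ (+ M) (lo i)) ,
          ≤-<-trans (+-monoˡ-≤ (+ M)
            (≤-trans (hi i) (subst (orbit t 0ℤ + + M ≤_) (+-identityˡ (+ M)) (+-monoˡ-≤ (+ M) lo≤0))))
                    (+<+ (ℕ.n<1+n (M ℕ.+ M)))

      cycle : ∃₂ λ s d → ∀ i → [_] {N} (orbit (s ℕ.+ suc d)) i ≡ [ orbit s ] i
      cycle =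
        let s , d , eq = recurrence (λ t i → [ orbit t ] i + + M) orbit-bounded
        in  s , d , λ i → +-cancelʳ-≡ (+ M) _ _ (eq i)

      s d : ℕ
      s = proj₁ cycle
      d = proj₁ (proj₂ cycle)

      -- The minimum over a cycle of Φ satisfies Φ b ≤ b by monotonicity, hence
      -- Φ b = b by the equality of sums.
      b : ℤ → ℤ
      b x = minimum d (λ t → orbit (suc (s ℕ.+ t)) x)

      b-mono : Nondecreasing b
      b-mono x≤y = minimum-mono {d} λ t → orbit-mono (suc (s ℕ.+ t)) x≤y

      b-per : Quasiperiodic N M b
      b-per x = trans (cong-minimum d (λ t → orbit-per (suc (s ℕ.+ t)) x))
                      (minimum-+ d _ (+ M))
        where
        cong-minimum : ∀ n {f g} → (∀ t → f t ≡ g t) → minimum n f ≡ minimum n g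
        cong-minimum n f≡g = ≤-antisym (minimum-mono {n} (≤-reflexive ∘ f≡g))
                                       (minimum-mono {n} (≤-reflexive ∘ sym ∘ f≡g))

      -- `b` is the minimum over the times `s + 1` to `s + d + 1`, the last of which repeats time
      -- `s`. Hence `b` lies below every predecessor of a term of its minimum, which is what
      -- `Φ b ≤ b` requires.
      b-≤ : ∀ t → t ℕ.≤ d → ∀ i → [_] {N} b i ≤ [ orbit (s ℕ.+ t) ] i
      b-≤ zero    _  i = ≤-trans (minimum-≤ {d} (λ t → orbit (suc (s ℕ.+ t)) (+ toℕ i)) ℕ.≤-refl)
        (≤-reflexive (trans (cong (λ n → orbit n (+ toℕ i)) (sym (ℕ.+-suc s d)))
          (trans (proj₂ (proj₂ cycle) i) (cong (λ n → orbit n (+ toℕ i)) (sym (ℕ.+-identityʳ s))))))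
      b-≤ (suc t) t< i = ≤-trans
        (minimum-≤ {d} {t} (λ t → orbit (suc (s ℕ.+ t)) (+ toℕ i)) (ℕ.<⇒≤ t<))
        (≤-reflexive (cong (λ n → orbit n (+ toℕ i)) (sym (ℕ.+-suc s t))))

      Φb≤b : ∀ x → Φ [ b ] x ≤ b x
      Φb≤b x = minimum-glb {d} (λ t → orbit (suc (s ℕ.+ t)) x) λ {t} t≤ → Φ-mono (b-≤ t t≤) x

      Φb≡b : ∀ x → Φ [ b ] x ≡ b x
      Φb≡b = ≤∧sum≥⇒≗ {N} {M} (dual-per {M} N _) b-per Φb≤b (≤-reflexive (sym (sum-Φ [ b ])))

      b-balanced : Balanced M e J ([_] {N} b)
      b-balanced x = ≤-antisym
        (-1<⇒≤ (dual-> {N} M b-mono b-per x {counts [ b ] x - 1ℤ}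
          (subst (_≤ x) (Φb≡b (counts [ b ] x - 1ℤ))
          (dual-≤ {M} N counts-mono counts-per (counts [ b ] x - 1ℤ) (-1< (counts [ b ] x))))))
        (dual-≤ {N} M b-mono b-per x (subst (x <_) (Φb≡b (counts [ b ] x))
          (dual-> {M} N counts-mono counts-per (counts [ b ] x) ≤-refl)))
        where
        counts-mono : Nondecreasing (counts [ b ])
        counts-mono x≤y = +-monoʳ-≤ J (dual-mono M ([ b ] ⊞ e) x≤y)
        counts-per : Quasiperiodic M N (counts [ b ])
        counts-per x = trans (cong (_+_ J) (dual-per M ([ b ] ⊞ e) x)) (sym (+-assoc J _ _))

    closed-exists : ∃ λ b → Nondecreasing b × Quasiperiodic N M b × Closed M e ([_] {N} b)
    closed-exists = b , b-mono , b-per , balanced⇒closed b-mono b-per {e} {J} b-balanced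

  -- Addresses, their positions and their words.

  -- The combinatorial properties of the integer parts q i j = ⌊r i - r j⌋ of
  -- real numbers r i no two of which differ by an integer.
  record IsAddress {N} (q : Fin N → Fin N → ℤ) : Set where
    field
      diagonal : ∀ i → q i i ≡ 0ℤ
      antisym  : ∀ {i j} → i ≢ j → q i j + q j i ≡ -1ℤ
      super    : ∀ i j l → q i j + q j l ≤ q i l

  -- The chain `r 0 ≤ … ≤ r k ≤ r 0 + m` expressed through the floors of the differences.
  record InDilation {N} (m : ℕ) (q : Fin N → Fin N → ℤ) : Set where
    field
      increasing : ∀ {i j} → toℕ i ℕ.≤ toℕ j → 0ℤ ≤ q j i
      bounded    : ∀ i j → - + m ≤ q i j

  -- The number of points of ⋃ⱼ (r j + ℤ) up to r i, up to an additive constant.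
  position : ∀ {N} → (Fin N → Fin N → ℤ) → Fin N → ℤ
  position q i = sum (q i)

  module _ {N} .{{_ : ℕ.NonZero N}} {q : Fin N → Fin N → ℤ} (isA : IsAddress q) where
    open IsAddress isA

    -- Sum `q j l + p ≤ q i l` over `l`, which is `super`. Together with `position-<` this makes
    -- `q i j` the floor of `(position q i - position q j) / N`, so the positions determine the
    -- address.
    position-≥ : ∀ {i j p} → p ≤ q i j → position q j + p * + N ≤ position q i
    position-≥ {i} {j} {p} p≤q = subst (_≤ position q i)
      (trans (∑-distrib-+ {N} (q j) (λ _ → p))
        (cong (_+_ (position q j)) (trans (sum-const N p) (*-comm (+ N) p))))
      (sum-mono {N} λ l → ≤-trans
        (subst (q j l + p ≤_) (+-comm (q j l) (q i j)) (+-monoʳ-≤ (q j l) p≤q))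
                                  (super i j l))

    -- Here `q i l ≤ q j l + p` for every `l`, by `super` through `q j i`, and strictly for `l = j`
    -- because `q j j = 0`.
    position-< : ∀ {i j p} → q i j < p → position q i < position q j + p * + N
    position-< {i} {j} {p} q<p = ≰⇒> λ ≥ → <⇒≢ q<p (trans (sum-mono-≡ {N} {q i} {λ l → q j l + p} below
        (subst (_≤ position q i) (sym Σ≡) ≥) j)
        (trans (cong (_+ p) (diagonal j)) (+-identityˡ p)))
      where
      Σ≡ : sum (λ l → q j l + p) ≡ position q j + p * + N
      Σ≡ = trans (∑-distrib-+ {N} (q j) (λ _ → p))
        (cong (_+_ (position q j)) (trans (sum-const N p) (*-comm (+ N) p)))
      -p≤ : - p ≤ q j i
      -p≤ with i Fin.≟ j
      ... | yes refl = ≤-trans (neg-mono-≤ (≤-trans (≤-reflexive (sym (diagonal i))) (<⇒≤ q<p)))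
        (≤-reflexive (sym (diagonal i)))
      ... | no i≢j = ≤-transfer (<⇒+1≤ q<p) (trans (cong (λ z → p - (q i j + - z)) (sym (antisym i≢j)))
                       (eq p (q i j) (q j i)))
        where eq : ∀ p a b → p - (a + - (a + b)) ≡ b - - p
              eq = solve-∀
      below : ∀ l → q i l ≤ q j l + p
      below l = ≤-transfer (≤-trans (+-monoˡ-≤ (q i l) -p≤) (super j i l)) (eq p (q i l) (q j l))
        where eq : ∀ p a b → b - (- p + a) ≡ b + p - a
              eq = solve-∀

    -- A congruence with quotient `z` would give `z ≤ q i j` and `- z ≤ q j i`, against `antisym`.
    position-distinct : Distinct (position q)
    position-distinct {i} {j} z eq with i Fin.≟ j
    ... | yes i≡j = i≡j
    ... | no i≢j = contradiction (subst (0ℤ ≤_) (antisym i≢j)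
      (subst (_≤ q i j + q j i) (+-inverseʳ z) (+-mono-≤ {z} {q i j} { - z} {q j i}
        (≮⇒≥ λ q<z → <-irrefl eq (position-< q<z))
        (≮⇒≥ λ q<-z → <-irrefl (trans (sym (eq′ (position q j) z (+ N))) (cong (_+ - z * + N) (sym eq)))
          (position-< q<-z)))))
      λ ()
      where
      eq′ : ∀ a z n → a + z * n + - z * n ≡ a
      eq′ = solve-∀

    module _ {m} (inD : InDilation m q) where
      open InDilation inD

      position-mono : ∀ {i j} → toℕ i ℕ.≤ toℕ j → position q i ≤ position q j
      position-mono {i} {j} i≤j = subst (_≤ position q j) (eq (position q i) (+ N))
        (position-≥ (increasing i≤j))
        where eq : ∀ a n → a + 0ℤ * n ≡ a
              eq = solve-∀

      position-wrap : ∀ i j → position q i ≤ position q j + + (m ℕ.* N)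
      position-wrap i j = ≤-transfer (position-≥ {j} {i} (bounded j i))
        (trans (eq (position q i) (position q j) (+ m) (+ N))
          (cong (λ M → position q j + M - position q i) (sym (pos-* m N))))
        where eq : ∀ a b m n → b - (a + - m * n) ≡ b + m * n - a
              eq = solve-∀

  module _ {N m} .{{_ : ℕ.NonZero N}} .{{_ : ℕ.NonZero m}} where

    address-≤ : ∀ {q q′} → IsAddress {N} q → IsAddress q′ → ∀ t →
      (∀ i → position q i ≡ position q′ i + t) → ∀ i j → q i j ≤ q′ i j
    address-≤ {q} {q′} isA isA′ t eq i j = ≮⇒≥ λ q′<q → <⇒≱ (position-< isA′ q′<q)
      (≤-transfer (position-≥ isA {i} {j} ≤-refl)
        (trans (cong₂ (λ a b → a - (b + q i j * + N)) (eq i) (eq j))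
          (eq′ (position q′ i) (position q′ j) t (q i j * + N))))
      where eq′ : ∀ a b t p → a + t - (b + t + p) ≡ a - (b + p)
            eq′ = solve-∀

    -- By `word-determines` the two position sequences differ by a constant, and an address depends
    -- only on differences of positions.
    address-unique : ∀ {q q′ w} → IsAddress {N} q → IsAddress q′ → InDilation m q → InDilation m q′ →
      IsWord {N} {m} (position q) w → IsWord (position q′) w → ∀ i j → q i j ≡ q′ i j
    address-unique {q} {q′} {w} isA isA′ inD inD′ isW isW′ i j = ≤-antisym
      (address-≤ isA isA′ t eq i j)
      (address-≤ isA′ isA (- t) (λ i → trans (eq″ (position q′ i) t) (cong (_+ - t) (sym (eq i)))) i j)
      where
      M = m ℕ.* N
      a = extend M (position q)
      a′ = extend M (position q′)
      ext : ∀ {q} → IsWord {N} {m} (position q) w → IsWord {N} {m} [ extend M (position q) ] w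
      ext {q} = word-translate {N} {m} {position q} {[ extend M (position q) ]} {w} 0ℤ λ i →
        trans (extend-[] {N} {M} {position q} i) (sym (+-identityʳ (position q i)))
      det : ∃ λ t → ∀ i → [_] {N} a i ≡ [ a′ ] i + t
      det = word-determines {N} {m} {w} {a} {a′}
        (extend-mono (position-mono isA inD) (position-wrap isA inD)) (extend-per {a = position q})
        (extend-mono (position-mono isA′ inD′) (position-wrap isA′ inD′)) (extend-per {a = position q′})
        (ext {q} isW) (ext {q′} isW′)
      t = proj₁ det
      eq : ∀ i → position q i ≡ position q′ i + t
      eq i = trans (sym (extend-[] {N} {M} {position q} i)) (trans (proj₂ det i)
        (cong (_+ t) (extend-[] {N} {M} {position q′} i)))
      eq″ : ∀ a t → a ≡ a + t + - t
      eq″ = solve-∀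

    -- The combinatorial effect of `ρ`: renumbering by `p` and raising some coordinates by multiples
    -- of `m`. Positions are renumbered and change by multiples of `m N` and a common constant `κ`,
    -- neither of which affects the letters.
    word-reindex : ∀ {q q′ w} {p : Fin N → Fin N} (δ : Fin N → ℤ) → Injective _≡_ _≡_ p →
      (∀ i j → q′ i j ≡ q (p i) (p j) + + m * (δ i - δ j)) →
      IsWord {N} {m} (position q) w → IsWord (position q′) (w ∘ p)
    word-reindex {q} {q′} {w} {p} δ p-inj q′≡ isW i =
      let j , ε , e = isW (p i)
          j′ , pj′≡j = injective⇒surjective p-inj j
      in  j′ , ε + δ i - δ j′ , (begin
        position q′ i + displacement w (p i)
          ≡⟨ cong (_+ displacement w (p i)) (pos≡ i) ⟩
        position q (p i) + + M * δ i - κ + displacement w (p i)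
          ≡⟨ eq₁ (position q (p i)) (+ M) (δ i) κ (displacement w (p i)) ⟩
        position q (p i) + displacement w (p i) + (+ M * δ i - κ)
          ≡⟨ cong (_+ (+ M * δ i - κ)) (trans e (cong (λ j → position q j + ε * + M) (sym pj′≡j))) ⟩
        position q (p j′) + ε * + M + (+ M * δ i - κ)
          ≡⟨ eq₂ (position q (p j′)) ε (+ M) (δ i) (δ j′) κ ⟩
        position q (p j′) + + M * δ j′ - κ + (ε + δ i - δ j′) * + M
          ≡⟨ cong (_+ (ε + δ i - δ j′) * + M) (pos≡ j′) ⟨
        position q′ j′ + (ε + δ i - δ j′) * + M ∎)
      where
      open ≡-Reasoning
      M = m ℕ.* N
      κ = + m * sum δ
      eq₁ : ∀ a M δ κ d → a + M * δ - κ + d ≡ a + d + (M * δ - κ)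
      eq₁ = solve-∀
      eq₂ : ∀ a ε M δ δ′ κ → a + ε * M + (M * δ - κ) ≡ a + M * δ′ - κ + (ε + δ - δ′) * M
      eq₂ = solve-∀
      eq₃ : ∀ a n m d s → a + m * (n * d - s) ≡ a + m * n * d - m * s
      eq₃ = solve-∀
      pos≡ : ∀ i → position q′ i ≡ position q (p i) + + M * δ i - κ
      pos≡ i = begin
        sum (q′ i)
          ≡⟨ sum-cong-≗ {N} (q′≡ i) ⟩
        sum (λ j → q (p i) (p j) + + m * (δ i - δ j))
          ≡⟨ ∑-distrib-+ {N} (q (p i) ∘ p) (λ j → + m * (δ i - δ j)) ⟩
        sum (q (p i) ∘ p) + sum (λ j → + m * (δ i - δ j))
          ≡⟨ cong₂ _+_ (sum-injective p-inj (q (p i))) (trans (sum-*ˡ {N} (+ m) (λ j → δ i - δ j))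
               (cong (_*_ (+ m)) (trans (sum-- {N} (λ _ → δ i) δ)
                 (cong (_- sum δ) (sum-const N (δ i)))))) ⟩
        position q (p i) + + m * (+ N * δ i - sum δ)
          ≡⟨ eq₃ (position q (p i)) (+ N) (+ m) (δ i) (sum δ) ⟩
        position q (p i) + + m * + N * δ i - κ
          ≡⟨ cong (λ M → position q (p i) + M * δ i - κ) (sym (pos-* m N)) ⟩
        position q (p i) + + M * δ i - κ ∎

    module _ {b : Fin N → ℤ} (dist : Distinct b) where

      floors : Fin N → Fin N → ℤ
      floors i j = (b i - b j) /ℕ N

      floors-isAddress : IsAddress floors
      floors-isAddress = record
        { diagonal = λ i → trans (cong (_/ℕ N) (+-inverseʳ (b i)))
            (/-unique {q = 0ℤ} ≤-refl (subst (0ℤ <_) (sym (*-identityˡ (+ N))) (+<+ (ℕ.>-nonZero⁻¹ N))))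
        ; antisym = λ {i} {j} i≢j → ≤-antisym
            (≮⇒≥ λ -1< → i≢j (dist (floors i j) (touch i j -1<)))
            (-1<⇒≤ (+1≤⇒< (≤-transfer (<⇒+1≤ (gap i j)) (eq₁ (floors i j) (floors j i)))))
        ; super = super
        }
        where
        eq : ∀ a b c p q n → (a - b) + (b - c) - (p * n + q * n) ≡ a - c - (p + q) * n
        eq = solve-∀
        eq₁ : ∀ p q → p + q + + 2 - (0ℤ + 1ℤ) ≡ p + q - (-1ℤ - 1ℤ + 1ℤ)
        eq₁ = solve-∀
        eq₂ : ∀ p q n → (1ℤ + p) * n + (1ℤ + q) * n ≡ (p + q + + 2) * n
        eq₂ = solve-∀
        eq₃ : ∀ a b → (a - b) + (b - a) ≡ 0ℤ
        eq₃ = solve-∀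
        eq₄ : ∀ a b p n → a - b - p * n ≡ a - (b + p * n)
        eq₄ = solve-∀
        lower : ∀ i j → floors i j * + N ≤ b i - b j
        lower i j = ≤/⇒*/≤ {N} {floors i j} {b i - b j} ≤-refl
        super : ∀ i j l → floors i j + floors j l ≤ floors i l
        super i j l = */≤⇒≤/ {N} {floors i j + floors j l} {b i - b l} (≤-transfer
            (+-mono-≤ (lower i j) (lower j l))
            (eq (b i) (b j) (b l) (floors i j) (floors j l) (+ N)))
        gap : ∀ i j → 0ℤ < floors i j + floors j i + + 2
        gap i j = *-cancelʳ-<-nonNeg (+ N)
          (subst₂ _<_ (eq₃ (b i) (b j)) (eq₂ (floors i j) (floors j i) (+ N))
          (+-mono-< (n<s[n/ℕd]*d (b i - b j) N) (n<s[n/ℕd]*d (b j - b i) N)))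
        touch : ∀ i j → -1ℤ < floors i j + floors j i → b i ≡ b j + floors i j * + N
        touch i j -1<p+q = ≤-antisym
          (≤-transfer (+-mono-≤ (lower j i) (*-monoʳ-≤-nonNeg (+ N) (<⇒+1≤ -1<p+q)))
            (eq₆ (b i) (b j) (floors i j) (floors j i) (+ N)))
          (≤-transfer (lower i j) (eq₄ (b i) (b j) (floors i j) (+ N)))
          where
          eq₆ : ∀ a b p q n → (b - a) + (p + q) * n - (q * n + (-1ℤ + 1ℤ) * n) ≡ b + p * n - a
          eq₆ = solve-∀

      -- The residues of the `b j` modulo `N` run through all classes once. The sum of floors is
      -- therefore, up to a constant, a window sum of `g` starting at `- b i`, and `window-shift`
      -- evaluates it.
      position-floors : ∃ λ t → ∀ i → position floors i ≡ b i + t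
      position-floors = t , pos≡
        where
        open ≡-Reasoning
        r : Fin N → Fin N
        r j = fromℕ< (n%ℕd<d (b j) N)
        b≡ : ∀ j → b j ≡ + toℕ (r j) + (b j /ℕ N) * + N
        b≡ j = trans (a≡a%ℕn+[a/ℕn]*n (b j) N)
          (cong (λ s → + s + (b j /ℕ N) * + N) (sym (toℕ-fromℕ< (n%ℕd<d (b j) N))))
        r-inj : Injective _≡_ _≡_ r
        r-inj {i} {j} ri≡rj = dist (b i /ℕ N - b j /ℕ N) (≡-transfer
          (cong₂ _-_ (b≡ i) (trans (b≡ j) (cong (λ s → + toℕ s + (b j /ℕ N) * + N) (sym ri≡rj))))
          (eq (b i) (b j) (+ toℕ (r i)) (b i /ℕ N) (b j /ℕ N) (+ N)))
          where
          eq : ∀ x y r q q′ n → ((r + q * n) - (r + q′ * n)) - (x - y) ≡ (y + (q - q′) * n) - x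
          eq = solve-∀
        g : ℤ → ℤ
        g x = (- x) /ℕ N
        g-per : ∀ x → g (x + + N) ≡ g x + -1ℤ
        g-per x = trans (cong (_/ℕ N) (eq x (+ N))) (/-+-* (- x) -1ℤ)
          where
          eq : ∀ x n → - (x + n) ≡ - x + -1ℤ * n
          eq = solve-∀
        F = sum (λ j → b j /ℕ N)
        t = sum {N} (λ i → g (+ toℕ i)) - F
        pos≡ : ∀ i → position floors i ≡ b i + t
        pos≡ i = begin
          sum (λ j → (b i - b j) /ℕ N)
            ≡⟨ sum-cong-≗ {N} (λ j → trans (cong (λ y → (b i - y) /ℕ N) (b≡ j))
                 (trans (cong (_/ℕ N) (eq (b i) (+ toℕ (r j)) (b j /ℕ N) (+ N)))
                   (/-+-* (- (- b i + + toℕ (r j))) (- (b j /ℕ N))))) ⟩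
          sum (λ j → g (- b i + + toℕ (r j)) - b j /ℕ N)
            ≡⟨ sum-- {N} (λ j → g (- b i + + toℕ (r j))) (λ j → b j /ℕ N) ⟩
          sum (λ j → g (- b i + + toℕ (r j))) - F
            ≡⟨ cong (_- F) (sum-injective r-inj (λ s → g (- b i + + toℕ s))) ⟩
          sum {N} (λ s → g (- b i + + toℕ s)) - F
            ≡⟨ cong (_- F) (window-shift g g-per (- b i)) ⟩
          sum {N} (λ s → g (+ toℕ s)) + - b i * -1ℤ - F
            ≡⟨ eq′ (sum {N} (λ s → g (+ toℕ s))) (b i) F ⟩
          b i + t ∎
          where
          eq : ∀ x r q n → x - (r + q * n) ≡ - (- x + r) + - q * n
          eq = solve-∀
          eq′ : ∀ s b f → s + - b * -1ℤ - f ≡ b + (s - f)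
          eq′ = solve-∀

    -- The sum condition supplies the constant that `closed-exists` asks for; its solution `b` is
    -- read as the real points `b i / N`.
    word-realised : ∀ w J → 1ℤ + sum (λ i → + toℕ (w i)) ≡ + m * J →
      ∃ λ b → Distinct b × InDilation m (λ i j → (b i - b j) /ℕ N) ×
              IsWord {N} {m} (position (λ i j → (b i - b j) /ℕ N)) w
    word-realised w J Σw =
      let b , b-mono , b-per , b-word = closed-exists {N} {M} {{it}} {{ℕ.m*n≢0 m N}} {displacement w}
            {J} Σdisp
          dist = word⇒distinct {N} {m} {a = [ b ]} {w} b-word
          t , pos≡ = position-floors {[ b ]} dist
      in  [ b ] , dist ,
          record
            { increasing = λ {i} {j} i≤j → */≤⇒≤/ {N} {0ℤ} (i≤j⇒0≤j-i (b-mono (+≤+ i≤j)))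
            ; bounded = λ i j → */≤⇒≤/ {N} { - + m} {[ b ] i - [ b ] j} (≤-transfer
                (≤-trans (b-mono (<⇒≤ (+<+ (toℕ<n j))))
                  (≤-trans (≤-reflexive (trans (cong b (sym (+-identityˡ (+ N)))) (b-per 0ℤ)))
                    (+-monoˡ-≤ (+ M) (b-mono {y = + toℕ i} (+≤+ ℕ.z≤n)))))
                (trans (cong (λ M → [ b ] i + M - [ b ] j) (pos-* m N))
                  (eq ([ b ] i) ([ b ] j) (+ m) (+ N))))
            } ,
          word-translate {N} {m} {[ b ]} {position (λ i j → ([ b ] i - [ b ] j) /ℕ N)} {w} t pos≡ b-word
      where
      M = m ℕ.* N
      eq : ∀ a b m n → a + m * n - b ≡ a - b - - m * n
      eq = solve-∀
      eq′ : ∀ s n → n * 1ℤ + s * n ≡ n * (1ℤ + s)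
      eq′ = solve-∀
      eq″ : ∀ m n j → n * (m * j) ≡ m * n * j
      eq″ = solve-∀
      Σdisp : sum (displacement w) ≡ + M * J
      Σdisp = begin
        sum (displacement w)
          ≡⟨ ∑-distrib-+ {N} (λ _ → 1ℤ) (λ i → + toℕ (w i) * + N) ⟩
        sum {N} (λ _ → 1ℤ) + sum (λ i → + toℕ (w i) * + N)
          ≡⟨ cong₂ _+_ (sum-const N 1ℤ) (trans (sum-cong-≗ {N} (λ i → *-comm (+ toℕ (w i)) (+ N)))
               (trans (sum-*ˡ {N} (+ N) (λ i → + toℕ (w i))) (*-comm (+ N) _))) ⟩
        + N * 1ℤ + sum (λ i → + toℕ (w i)) * + N
          ≡⟨ eq′ (sum (λ i → + toℕ (w i))) (+ N) ⟩
        + N * (1ℤ + sum (λ i → + toℕ (w i)))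
          ≡⟨ cong (_*_ (+ N)) Σw ⟩
        + N * (+ m * J)
          ≡⟨ eq″ (+ m) (+ N) J ⟩
        + m * + N * J
          ≡⟨ cong (_* J) (pos-* m N) ⟨
        + M * J ∎
        where open ≡-Reasoning

open Counting using
  ( ≤-transfer; ≡-transfer; <⇒+1≤; +1≤⇒<; <+1⇒≤; -1<⇒≤; toℕ-mod-injective; injective⇒surjective
  ; Distinct; IsWord; word-translate; word-unique; word-exists; word-reindex; word-realised; sum-word
  ; IsAddress; InDilation; position; position-distinct; address-unique; floors-isAddress)

-- Ordered fields without trichotomy.

module OrderedFieldProperties {ℓ} (F : OrderedField ℓ) where
  open OrderedField F
  open IsStrictPartialOrder isStrictPartialOrder public using (<-respˡ-≈; <-respʳ-≈)
    renaming (trans to <-trans; irrefl to <-irrefl; asym to <-asym)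
  open RingProperties ring using (-0#≈0#; -‿involutive; -‿distribˡ-*; -‿distribʳ-*; -‿+-comm)
  open Mult (CommutativeRing.semiring ℝ-commutativeRing) using (×-homo-+; ×1-homo-*)
  private module Reasoning = SetoidReasoning setoid

  fromℤ-⊖ : ∀ m n → fromℤ (m ⊖ n) ≈ fromℕ m - fromℕ n
  fromℤ-⊖ m       zero    = sym (trans (+-congˡ -0#≈0#) (+-identityʳ _))
  fromℤ-⊖ zero    (suc n) = sym (+-identityˡ _)
  fromℤ-⊖ (suc m) (suc n) = begin
    fromℤ (suc m ⊖ suc n)           ≡⟨ ≡.cong fromℤ (ℤ.[1+m]⊖[1+n]≡m⊖n m n) ⟩
    fromℤ (m ⊖ n)                   ≈⟨ fromℤ-⊖ m n ⟩
    fromℕ m - fromℕ n               ≈⟨ +-congʳ (+-identityˡ _) ⟨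
    (0# + fromℕ m) - fromℕ n        ≈⟨ +-congʳ (+-congʳ (-‿inverseʳ 1#)) ⟨
    (1# - 1# + fromℕ m) - fromℕ n   ≈⟨ +-congʳ
      (trans (+-assoc _ _ _) (trans (+-congˡ (+-comm _ _)) (sym (+-assoc _ _ _)))) ⟩
    (1# + fromℕ m - 1#) - fromℕ n   ≈⟨ +-assoc _ _ _ ⟩
    1# + fromℕ m + (- 1# - fromℕ n) ≈⟨ +-congˡ (-‿+-comm 1# (fromℕ n)) ⟩
    fromℕ (suc m) - fromℕ (suc n)   ∎
    where open Reasoning

  fromℤ-neg : ∀ p → fromℤ (ℤ.- p) ≈ - fromℤ p
  fromℤ-neg (+ zero)  = sym -0#≈0#
  fromℤ-neg (+ suc n) = refl
  fromℤ-neg -[1+ n ]  = sym (-‿involutive _)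

  fromℤ-+ : ∀ p q → fromℤ (p ℤ.+ q) ≈ fromℤ p + fromℤ q
  fromℤ-+ (+ m)    (+ n)    = ×-homo-+ 1# m n
  fromℤ-+ (+ m)    -[1+ n ] = fromℤ-⊖ m (suc n)
  fromℤ-+ -[1+ m ] (+ n)    = trans (fromℤ-⊖ n (suc m)) (+-comm _ _)
  fromℤ-+ -[1+ m ] -[1+ n ] = begin
    - fromℕ (suc (suc (m ℕ.+ n)))        ≡⟨ ≡.cong (λ l → - fromℕ (suc l)) (ℕ.+-suc m n) ⟨
    - fromℕ (suc m ℕ.+ suc n)            ≈⟨ -‿cong (×-homo-+ 1# (suc m) (suc n)) ⟩
    - (fromℕ (suc m) + fromℕ (suc n))    ≈⟨ -‿+-comm _ _ ⟨
    - fromℕ (suc m) - fromℕ (suc n)      ∎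
    where open Reasoning

  fromℤ-* : ∀ p q → fromℤ (p ℤ.* q) ≈ fromℤ p * fromℤ q
  fromℤ-* (+ m)    q = pos m q
    where
    open Reasoning
    pos : ∀ m q → fromℤ (+ m ℤ.* q) ≈ fromℕ m * fromℤ q
    pos m (+ n) = trans (reflexive (≡.cong fromℤ (≡.sym (ℤ.pos-* m n)))) (×1-homo-* m n)
    pos m -[1+ n ] = begin
      fromℤ (+ m ℤ.* -[1+ n ])      ≡⟨ ≡.cong fromℤ (ℤ.neg-distribʳ-* (+ m) (+ suc n)) ⟨
      fromℤ (ℤ.- (+ m ℤ.* + suc n)) ≈⟨ fromℤ-neg (+ m ℤ.* + suc n) ⟩
      - fromℤ (+ m ℤ.* + suc n)     ≈⟨ -‿cong (pos m (+ suc n)) ⟩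
      - (fromℕ m * fromℕ (suc n))   ≈⟨ -‿distribʳ-* _ _ ⟩
      fromℕ m * - fromℕ (suc n)     ∎
  fromℤ-* -[1+ m ] q = begin
    fromℤ (-[1+ m ] ℤ.* q)        ≡⟨ ≡.cong fromℤ (ℤ.neg-distribˡ-* (+ suc m) q) ⟨
    fromℤ (ℤ.- (+ suc m ℤ.* q))   ≈⟨ fromℤ-neg (+ suc m ℤ.* q) ⟩
    - fromℤ (+ suc m ℤ.* q)       ≈⟨ -‿cong (fromℤ-* (+ suc m) q) ⟩
    - (fromℕ (suc m) * fromℤ q)   ≈⟨ -‿distribˡ-* _ _ ⟩
    - fromℕ (suc m) * fromℤ q     ∎
    where open Reasoning

  fromℤ-morphism : ℤ.+-*-rawRing -Raw-AlmostCommutative⟶ fromCommutativeRing ℝ-commutativeRing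
  fromℤ-morphism = record
    { ⟦_⟧    = fromℤ
    ; +-homo = fromℤ-+
    ; *-homo = fromℤ-*
    ; -‿homo = fromℤ-neg
    ; 0-homo = refl
    ; 1-homo = +-identityʳ 1#
    }

  fromℤ-≟ : ∀ p q → Maybe (fromℤ p ≈ fromℤ q)
  fromℤ-≟ p q with p ℤ.≟ q
  ... | yes ≡.refl = just refl
  ... | no _       = nothing

  module Solver = RingSolver ℤ.+-*-rawRing (fromCommutativeRing ℝ-commutativeRing)
    fromℤ-morphism fromℤ-≟
  open Solver using (solve; _:+_; _:*_; :-_; _:-_; con; _:=_) public

  open HeytingProperties heytingCommutativeRing
    using (1#0)

  <-resp : ∀ {x x′ y y′} → x ≈ x′ → y ≈ y′ → x < y → x′ < y′
  <-resp x≈ y≈ x<y = <-respʳ-≈ y≈ (<-respˡ-≈ x≈ x<y)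

  -- Inherited from the cotransitivity of apartness; it takes the place of a comparison of `z` with
  -- a single number.
  <-cotrans : ∀ {x y} → x < y → ∀ z → x < z ⊎ z < y
  <-cotrans {x} {y} x<y z with #-cotrans (Equivalence.from #⇔<⊎> (inj₁ x<y)) z
  ... | inj₁ x#z with Equivalence.to #⇔<⊎> x#z
  ...   | inj₁ x<z = inj₁ x<z
  ...   | inj₂ z<x = inj₂ (<-trans z<x x<y)
  <-cotrans {x} {y} x<y z | inj₂ z#y with Equivalence.to #⇔<⊎> z#y
  ...   | inj₁ z<y = inj₂ z<y
  ...   | inj₂ y<z = inj₁ (<-trans x<y y<z)

  <⇒# : ∀ {x y} → x < y → x # y
  <⇒# x<y = Equivalence.from #⇔<⊎> (inj₁ x<y)

  >⇒# : ∀ {x y} → y < x → x # y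
  >⇒# y<x = Equivalence.from #⇔<⊎> (inj₂ y<x)

  <⇒≤ : ∀ {x y} → x < y → x ≤ y
  <⇒≤ = <-asym

  ≤-reflexive : ∀ {x y} → x ≈ y → x ≤ y
  ≤-reflexive x≈y = <-irrefl (sym x≈y)

  ≤-trans : ∀ {x y z} → x ≤ y → y ≤ z → x ≤ z
  ≤-trans {y = y} x≤y y≤z z<x = [ y≤z , x≤y ]′ (<-cotrans z<x y)

  <-≤-trans : ∀ {x y z} → x < y → y ≤ z → x < z
  <-≤-trans {z = z} x<y y≤z = [ (λ x<z → x<z) , (λ z<y → contradiction z<y y≤z) ]′ (<-cotrans x<y z)

  ≤-<-trans : ∀ {x y z} → x ≤ y → y < z → x < z
  ≤-<-trans {x = x} x≤y y<z = [ (λ y<x → contradiction y<x x≤y) , (λ x<z → x<z) ]′ (<-cotrans y<z x)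

  ≤-antisym : ∀ {x y} → x ≤ y → y ≤ x → x ≈ y
  ≤-antisym x≤y y≤x = proj₁ (tight _ _) λ x#y → [ y≤x , x≤y ]′ (Equivalence.to #⇔<⊎> x#y)

  #∧≤⇒< : ∀ {x y} → x # y → x ≤ y → x < y
  #∧≤⇒< x#y x≤y = [ (λ x<y → x<y) , (λ y<x → contradiction y<x x≤y) ]′ (Equivalence.to #⇔<⊎> x#y)

  <-via : ∀ {e x y} → e ≈ y - x → 0# < e → x < y
  <-via {e} {x} {y} e≈ 0<e = <-resp
    (+-identityˡ x) (solve 2 (λ x y → y :- x :+ x := y) refl x y)
    (+-monoˡ-< x (<-respʳ-≈ e≈ 0<e))

  <⇒0<- : ∀ {x y} → x < y → 0# < y - x
  <⇒0<- {x} {y} x<y = <-respˡ-≈ (-‿inverseʳ x) (+-monoˡ-< (- x) x<y)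

  ≤-via : ∀ {e x y} → e ≈ y - x → 0# ≤ e → x ≤ y
  ≤-via {e} {x} {y} e≈ 0≤e y<x = 0≤e (<-via
    (trans (solve 2 (λ x y → x :- y := con (+ 0) :- (y :- x)) refl x y) (+-congˡ (-‿cong (sym e≈))))
      (<⇒0<- y<x))

  ≤⇒0≤- : ∀ {x y} → x ≤ y → 0# ≤ y - x
  ≤⇒0≤- {x} {y} x≤y y-x<0 = x≤y
    (<-via (solve 2 (λ x y → con (+ 0) :- (y :- x) := x :- y) refl x y) (<⇒0<- y-x<0))

  pos+nonNeg : ∀ {x y} → 0# < x → 0# ≤ y → 0# < x + y
  pos+nonNeg {x} {y} 0<x 0≤y = ≤-<-trans 0≤y (<-via (solve 2 (λ x y → x := x :+ y :- y) refl x y) 0<x)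

  nonNeg+nonNeg : ∀ {x y} → 0# ≤ x → 0# ≤ y → 0# ≤ x + y
  nonNeg+nonNeg {x} {y} 0≤x 0≤y = ≤-trans 0≤y (≤-via (solve 2 (λ x y → x := x :+ y :- y) refl x y) 0≤x)

  neg-mono-< : ∀ {x y} → x < y → - y < - x
  neg-mono-< {x} {y} x<y = <-via (solve 2 (λ x y → y :- x := :- x :- (:- y)) refl x y) (<⇒0<- x<y)

  +-mono-< : ∀ {x y u v} → x < y → u < v → x + u < y + v
  +-mono-< {x} {y} {u} {v} x<y u<v = <-via
    (solve 4 (λ x y u v → (y :- x) :+ (v :- u) := (y :+ v) :- (x :+ u)) refl x y u v)
    (pos+nonNeg (<⇒0<- x<y) (<⇒≤ (<⇒0<- u<v)))

  0<1 : 0# < 1#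
  0<1 with Equivalence.to #⇔<⊎> 1#0
  ... | inj₂ 0<1 = 0<1
  ... | inj₁ 1<0 = contradiction 1<0 (<-asym (<-respʳ-≈
    (trans (solve 1 (λ x → (con (+ 0) :- x) :* (con (+ 0) :- x) := x :* x) refl 1#) (*-identityˡ 1#))
    (*-pos 0<-1 0<-1)))
    where 0<-1 = <⇒0<- 1<0

  #0⇒inverse : ∀ {x} → x # 0# → ∃ λ y → y * x ≈ 1#
  #0⇒inverse {x} x#0 with #⇒invertible x#0
  ... | y , y*x≈1 , _ = y , trans (*-congˡ (sym (trans (+-congˡ -0#≈0#) (+-identityʳ x)))) y*x≈1

  inverse⇒#0 : ∀ {x} y → y * x ≈ 1# → x # 0#
  inverse⇒#0 {x} y yx≈1 = invertible⇒#
    (y , trans (*-congˡ x-0≈x) yx≈1 , trans (*-comm _ _) (trans (*-congˡ x-0≈x) yx≈1))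
    where x-0≈x = trans (+-congˡ -0#≈0#) (+-identityʳ x)

  -- A negative product would be invertible, hence so would both factors; being apart from 0 and
  -- nonnegative, they would be positive.
  nonNeg*nonNeg : ∀ {x y} → 0# ≤ x → 0# ≤ y → 0# ≤ x * y
  nonNeg*nonNeg {x} {y} 0≤x 0≤y xy<0 with #0⇒inverse (<⇒# xy<0)
  ... | z , zxy≈1 = <-asym xy<0 (*-pos
    (#∧≤⇒< (#-sym (inverse⇒#0 (z * y)
      (trans (solve 3 (λ x y z → z :* y :* x := z :* (x :* y)) refl x y z) zxy≈1))) 0≤x)
    (#∧≤⇒< (#-sym (inverse⇒#0 (z * x) (trans (*-assoc z x y) zxy≈1))) 0≤y))

  reciprocal : ∀ {x} → 0# < x → ∃ λ y → 0# < y × y * x ≈ 1#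
  reciprocal {x} 0<x with #0⇒inverse (>⇒# 0<x)
  ... | y , yx≈1 = y , #∧≤⇒< (#-sym (inverse⇒#0 x (trans (*-comm x y) yx≈1))) 0≤y , yx≈1
    where
    0≤y : 0# ≤ y
    0≤y y<0 = <-asym 0<1 (<-via
      (trans (solve 2 (λ x y → (con (+ 0) :- y) :* x := con (+ 0) :- y :* x) refl x y)
        (+-congˡ (-‿cong yx≈1)))
      (*-pos (<⇒0<- y<0) 0<x))

  *-monoˡ-< : ∀ {x y z} → 0# < z → x < y → z * x < z * y
  *-monoˡ-< {x} {y} {z} 0<z x<y = <-via
    (solve 3 (λ x y z → z :* (y :- x) := z :* y :- z :* x) refl x y z)
    (*-pos 0<z (<⇒0<- x<y))

  *-cancelˡ-≈ : ∀ {x y z} → 0# < z → z * x ≈ z * y → x ≈ y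
  *-cancelˡ-≈ {x} {y} {z} 0<z zx≈zy =
    let w , _ , wz≈1 = reciprocal 0<z
    in  trans (trans (sym (*-identityˡ x)) (*-congʳ (sym wz≈1))) (trans (*-assoc w z x)
          (trans (*-congˡ zx≈zy) (trans (sym (*-assoc w z y)) (trans (*-congʳ wz≈1) (*-identityˡ y)))))

  fromℕ-nonNeg : ∀ n → 0# ≤ fromℕ n
  fromℕ-nonNeg zero    = ≤-reflexive refl
  fromℕ-nonNeg (suc n) = nonNeg+nonNeg (<⇒≤ 0<1) (fromℕ-nonNeg n)

  0<fromℕ-suc : ∀ n → 0# < fromℕ (suc n)
  0<fromℕ-suc n = pos+nonNeg 0<1 (fromℕ-nonNeg n)

  fromℤ-- : ∀ p q → fromℤ (p ℤ.- q) ≈ fromℤ p - fromℤ q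
  fromℤ-- p q = trans (fromℤ-+ p (ℤ.- q)) (+-congˡ (fromℤ-neg q))

  fromℤ-mono-≤ : ∀ {p q} → p ℤ.≤ q → fromℤ p ≤ fromℤ q
  fromℤ-mono-≤ {p} {q} p≤q = ≤-via
    (trans (reflexive (≡.cong fromℤ (ℤ.0≤i⇒+∣i∣≡i (ℤ.i≤j⇒0≤j-i p≤q)))) (fromℤ-- q p))
    (fromℕ-nonNeg ℤ.∣ q ℤ.- p ∣)

  fromℤ-mono-< : ∀ {p q} → p ℤ.< q → fromℤ p < fromℤ q
  fromℤ-mono-< {p} {q} p<q = <-≤-trans
    (<-via (trans (solve 1 (λ x → con (+ 1) := con (+ 1) :+ x :- x) refl (fromℤ p))
      (+-congʳ (sym (fromℤ-+ (+ 1) p)))) (0<fromℕ-suc 0))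
    (fromℤ-mono-≤ (ℤ.i<j⇒suc[i]≤j p<q))

  fromℤ-cancel-< : ∀ {p q} → fromℤ p < fromℤ q → p ℤ.< q
  fromℤ-cancel-< p<q = ℤ.≰⇒> λ q≤p → fromℤ-mono-≤ q≤p p<q

  record IsFloor (v : Carrier) (q : ℤ) : Set ℓ where
    constructor _,_
    field
      lower : fromℤ q ≤ v
      upper : v < fromℤ (q ℤ.+ ℤ.1ℤ)
  open IsFloor public

  IsFloor-resp : ∀ {u v q} → u ≈ v → IsFloor u q → IsFloor v q
  IsFloor-resp u≈v (lo , hi) = ≤-trans lo (≤-reflexive u≈v) , <-respˡ-≈ u≈v hi

  floor-unique : ∀ {v q q′} → IsFloor v q → IsFloor v q′ → q ≡ q′
  floor-unique f f′ = ℤ.≤-antisym (below f f′) (below f′ f)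
    where
    below : ∀ {v q q′} → IsFloor v q → IsFloor v q′ → q ℤ.≤ q′
    below (lo , _) (_ , hi) = <+1⇒≤ (fromℤ-cancel-< (≤-<-trans lo hi))

-- Real numbers: floors, powers of one half, bisection.

module RealProperties {ℓ} (ℝ : Reals ℓ) where
  open Reals ℝ
  open OrderedFieldProperties orderedField

  private
    search : ∀ {v} → (∀ p → v # fromℤ p) → ∀ d q → fromℤ q < v → v < fromℤ (q ℤ.+ + d) →
             ∃ λ q → fromℤ q < v × v < fromℤ (q ℤ.+ ℤ.1ℤ)
    search v# zero    q q<v v< = contradiction (<-trans q<v v<)
      (<-irrefl (reflexive (≡.cong fromℤ (≡.sym (ℤ.+-identityʳ q)))))
    search v# (suc d) q q<v v< with Equivalence.to #⇔<⊎> (v# (q ℤ.+ ℤ.1ℤ))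
    ... | inj₁ v<q+1 = q , q<v , v<q+1
    ... | inj₂ q+1<v = search v# d (q ℤ.+ ℤ.1ℤ) q+1<v
      (<-respʳ-≈ (reflexive (≡.cong fromℤ (≡.sym (ℤ.+-assoc q ℤ.1ℤ (+ d))))) v<)

  -- The Archimedean property bounds the search, and apartness from each integer decides every
  -- comparison in it.
  floor-exists : ∀ {v} → (∀ p → v # fromℤ p) → ∃ λ q → fromℤ q < v × v < fromℤ (q ℤ.+ ℤ.1ℤ)
  floor-exists {v} v# =
    let n , v<n  = archimedean v
        k , -v<k = archimedean (- v)
    in  search v# (k ℕ.+ n) (ℤ.- + k)
          (<-resp (sym (fromℤ-neg (+ k))) (solve 1 (λ v → :- (:- v) := v) refl v) (neg-mono-< -v<k))
          (<-respʳ-≈ (reflexive (≡.cong fromℤ (eq (+ k) (+ n)))) v<n)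
    where
    eq : ∀ k n → n ≡ ℤ.- k ℤ.+ (k ℤ.+ n)
    eq = solve-∀

  private
    ½ : Carrier
    ½ = proj₁ (reciprocal (0<fromℕ-suc 1))

    0<½ : 0# < ½
    0<½ = proj₁ (proj₂ (reciprocal (0<fromℕ-suc 1)))

    ½*2≈1 : ½ * fromℕ 2 ≈ 1#
    ½*2≈1 = proj₂ (proj₂ (reciprocal (0<fromℕ-suc 1)))

  ½^ : ℕ → Carrier
  ½^ zero    = 1#
  ½^ (suc n) = ½ * ½^ n

  ½^-pos : ∀ n → 0# < ½^ n
  ½^-pos zero    = 0<1
  ½^-pos (suc n) = *-pos 0<½ (½^-pos n)

  ½^-double : ∀ n → ½^ (suc n) + ½^ (suc n) ≈ ½^ n
  ½^-double n = trans (solve 2 (λ h d → h :* d :+ h :* d := h :* con (+ 2) :* d) refl ½ (½^ n))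
    (trans (*-congʳ ½*2≈1) (*-identityˡ _))

  private
    n½^n≤1 : ∀ n → fromℕ n * ½^ n ≤ 1#
    n½^n≤1 n = ≤-trans (≤-via (trans (sym (*-identityˡ (½^ n)))
      (solve 3 (λ o n d → o :* d := (o :+ n) :* d :- n :* d) refl 1# (fromℕ n) (½^ n)))
      (<⇒≤ (½^-pos n))) (go n)
      where
      -- With the factor `n + 1` the sequence never increases, which makes the induction work;
      -- `n * ½^ n` itself first rises from 0 to one half.
      go : ∀ n → fromℕ (suc n) * ½^ n ≤ 1#
      go zero    = ≤-reflexive (trans (*-identityʳ _) (+-identityʳ 1#))
      go (suc n) = ≤-trans (≤-via
        (trans (solve 4 (λ o n h d → n :* (h :* d) := (o :+ n) :* (h :* d :+ h :* d) :- (o :+ (o :+ n))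
          :* (h :* d)) refl 1# (fromℕ n) ½ (½^ n))
               (+-congʳ (*-congˡ (½^-double n))))
        (nonNeg*nonNeg (fromℕ-nonNeg n) (<⇒≤ (½^-pos (suc n))))) (go n)

  ½^-small : ∀ D {ε} → 0# < ε → ∃ λ n → ½^ n * D < ε
  ½^-small D {ε} 0<ε =
    let ε⁻¹ , _ , ε⁻¹*ε≈1 = reciprocal 0<ε
        n , D/ε<n = archimedean (ε⁻¹ * D)
    in  n , <-≤-trans
          (<-respˡ-≈ (trans (solve 4 (λ h e i d → h :* e :* (i :* d) := i :* e :* (h :* d)) refl (½^ n)
            ε ε⁻¹ D)
                       (trans (*-congʳ ε⁻¹*ε≈1) (*-identityˡ _)))
            (*-monoˡ-< (*-pos (½^-pos n) 0<ε) D/ε<n))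
          (≤-via (trans (solve 4 (λ o h e n → (o :- n :* h) :* e := o :* e :- h :* e :* n) refl 1#
            (½^ n) ε (fromℕ n))
                        (+-congʳ (*-identityˡ ε)))
            (nonNeg*nonNeg (≤⇒0≤- (n½^n≤1 n)) (<⇒≤ 0<ε)))

  -- An intermediate value argument suited to Cauchy completeness: each bracket has `P` at its left
  -- end and `Q` at its right end, `cover` decides which half to keep, and the left ends converge.
  module Bisection (P Q : Pred Carrier ℓ) (cover : ∀ {t} → 0# ≤ t → t ≤ 1# → P t ⊎ Q t)
                   (P0 : P 0#) (Q1 : Q 1#) where

    record Bracket (n : ℕ) : Set ℓ where
      field
        lo hi : Carrier
        P-lo  : P lo
        Q-hi  : Q hi
        0≤lo  : 0# ≤ lo
        hi≤1  : hi ≤ 1#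
        width : lo + ½^ n ≈ hi

      lo≤hi : lo ≤ hi
      lo≤hi = ≤-via (trans (solve 2 (λ l d → d := l :+ d :- l) refl lo (½^ n)) (+-congʳ width))
        (<⇒≤ (½^-pos n))

    open Bracket

    private
      halve : ∀ {n} (b : Bracket n) → ∃ λ (b′ : Bracket (suc n)) → lo b ≤ lo b′ × hi b′ ≤ hi b
      halve {n} b = go (cover 0≤mid mid≤1)
        where
        d mid : Carrier
        d = ½^ (suc n)
        mid = lo b + d
        0≤d = <⇒≤ (½^-pos (suc n))
        mid+d : mid + d ≈ hi b
        mid+d = trans (+-assoc _ _ _) (trans (+-congˡ (½^-double n)) (width b))
        lo≤mid : lo b ≤ mid
        lo≤mid = ≤-via (solve 2 (λ l d → d := l :+ d :- l) refl (lo b) d) 0≤d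
        mid≤hi : mid ≤ hi b
        mid≤hi = ≤-via (trans (solve 2 (λ l d → d := l :+ d :- l) refl mid d) (+-congʳ mid+d)) 0≤d
        0≤mid = ≤-trans (0≤lo b) lo≤mid
        mid≤1 = ≤-trans mid≤hi (hi≤1 b)
        go : P mid ⊎ Q mid → ∃ λ (b′ : Bracket (suc n)) → lo b ≤ lo b′ × hi b′ ≤ hi b
        go (inj₁ Pm) = record { lo = mid ; hi = hi b ; P-lo = Pm ; Q-hi = Q-hi b
          ; 0≤lo = 0≤mid ; hi≤1 = hi≤1 b ; width = mid+d } , lo≤mid , ≤-reflexive refl
        go (inj₂ Qm) = record { lo = lo b ; hi = mid ; P-lo = P-lo b ; Q-hi = Qm
          ; 0≤lo = 0≤lo b ; hi≤1 = mid≤1 ; width = refl } , ≤-reflexive refl , mid≤hi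

    bracket : ∀ n → Bracket n
    bracket zero    = record { lo = 0# ; hi = 1# ; P-lo = P0 ; Q-hi = Q1
      ; 0≤lo = ≤-reflexive refl ; hi≤1 = ≤-reflexive refl ; width = +-identityˡ 1# }
    bracket (suc n) = proj₁ (halve (bracket n))

    private
      nested : ∀ {n i} → n ℕ.≤′ i → lo (bracket n) ≤ lo (bracket i) × hi (bracket i) ≤ hi (bracket n)
      nested ℕ.≤′-refl = ≤-reflexive refl , ≤-reflexive refl
      nested {n} {suc i} (ℕ.≤′-step n≤i) =
        let l , h = nested n≤i
            l′ , h′ = proj₂ (halve (bracket i))
        in  ≤-trans l l′ , ≤-trans h′ h

      lo≤hi′ : ∀ n i → lo (bracket i) ≤ hi (bracket n)
      lo≤hi′ n i with ℕ.≤-total n i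
      ... | inj₁ n≤i = ≤-trans (lo≤hi (bracket i)) (proj₂ (nested (ℕ.≤⇒≤′ n≤i)))
      ... | inj₂ i≤n = ≤-trans (proj₁ (nested (ℕ.≤⇒≤′ i≤n))) (lo≤hi (bracket n))

      limit : ∃ λ l → (λ n → lo (bracket n)) ConvergesTo l
      limit = complete _ λ ε 0<ε →
        let n , small = ½^-small 1# 0<ε
        in  n , λ i j n≤i n≤j → ≤-<-trans (lo≤hi′ n i) (<-respˡ-≈ (width (bracket n))
              (≤-<-trans
                (≤-via (solve 3 (λ a b d → b :- a := b :+ d :- (a :+ d)) refl (lo (bracket n))
                  (lo (bracket j)) (½^ n))
                  (≤⇒0≤- (proj₁ (nested (ℕ.≤⇒≤′ n≤j)))))
                (<-via (solve 3 (λ b d e → e :- d := b :+ e :- (b :+ d)) refl (lo (bracket j)) (½^ n) ε)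
                  (<⇒0<- (<-respˡ-≈ (*-identityʳ (½^ n)) small)))))

    point : Carrier
    point = proj₁ limit

    lo≤point : ∀ n → lo (bracket n) ≤ point
    lo≤point n point<lo =
      let k , near = proj₂ limit _ (<⇒0<- point<lo)
          i = n ℕ.⊔ k
      in  proj₁ (nested (ℕ.≤⇒≤′ (ℕ.m≤m⊔n n k)))
            (<-respʳ-≈ (solve 2 (λ p l → p :+ (l :- p) := l) refl point (lo (bracket n)))
              (proj₁ (near i (ℕ.m≤n⊔m n k))))

    point≤hi : ∀ n → point ≤ hi (bracket n)
    point≤hi n hi<point =
      let k , near = proj₂ limit _ (<⇒0<- hi<point)
      in  lo≤hi′ n k (<-via
            (solve 3 (λ p l h → l :+ (p :- h) :- p := l :- h) refl point (lo (bracket k))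
              (hi (bracket n)))
            (<⇒0<- (proj₂ (near k ℕ.≤-refl))))

-- Euclidean space: connectedness of convex sets, openness of half-spaces.

module EuclideanSpaceProperties {ℓ} {ℝ : Reals ℓ} (V : EuclideanSpace ℝ) where
  open Reals ℝ hiding (zero)
  open OrderedFieldProperties orderedField
  open RealProperties ℝ
  open EuclideanSpace V
  open CommutativeMonoidSum (CommutativeRing.+-commutativeMonoid ℝ-commutativeRing) public
    using (sum; sum-cong-≋; ∑-distrib-+)

  ⟨⟩-+ʳ : ∀ x y z → ⟨ x , y +ᴹ z ⟩ ≈ ⟨ x , y ⟩ + ⟨ x , z ⟩
  ⟨⟩-+ʳ x y z = trans (⟨⟩-sym x _) (trans (⟨⟩-+ˡ y z x) (+-cong (⟨⟩-sym y x) (⟨⟩-sym z x)))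

  ⟨⟩-*ʳ : ∀ c x y → ⟨ x , c *ₗ y ⟩ ≈ c * ⟨ x , y ⟩
  ⟨⟩-*ʳ c x y = trans (⟨⟩-sym x _) (trans (⟨⟩-*ˡ c y x) (*-congˡ (⟨⟩-sym y x)))

  ⟨⟩-congˡ : ∀ {x y z} → x ≈ᴹ y → ⟨ x , z ⟩ ≈ ⟨ y , z ⟩
  ⟨⟩-congˡ x≈y = ⟨⟩-cong x≈y ≈ᴹ-refl

  ⟨⟩-congʳ : ∀ {x y z} → x ≈ᴹ y → ⟨ z , x ⟩ ≈ ⟨ z , y ⟩
  ⟨⟩-congʳ x≈y = ⟨⟩-cong ≈ᴹ-refl x≈y

  ⟨⟩-0ˡ : ∀ x → ⟨ 0ᴹ , x ⟩ ≈ 0#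
  ⟨⟩-0ˡ x = trans (⟨⟩-congˡ (≈ᴹ-sym (*ₗ-zeroˡ 0ᴹ))) (trans (⟨⟩-*ˡ 0# 0ᴹ x) (zeroˡ _))

  ⟨⟩--ˡ : ∀ x y → ⟨ -ᴹ x , y ⟩ ≈ - ⟨ x , y ⟩
  ⟨⟩--ˡ x y = trans (solve 2 (λ a b → b := a :+ b :- a) refl ⟨ x , y ⟩ ⟨ -ᴹ x , y ⟩)
    (trans (+-congʳ (trans (sym (⟨⟩-+ˡ x (-ᴹ x) y)) (trans (⟨⟩-congˡ (-ᴹ‿inverseʳ x)) (⟨⟩-0ˡ y))))
      (+-identityˡ _))

  ⟨⟩--ʳ : ∀ x y → ⟨ x , -ᴹ y ⟩ ≈ - ⟨ x , y ⟩
  ⟨⟩--ʳ x y = trans (⟨⟩-sym x _) (trans (⟨⟩--ˡ y x) (-‿cong (⟨⟩-sym y x)))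

  ⟨⟩-−ˡ : ∀ x y z → ⟨ x -ᴹ y , z ⟩ ≈ ⟨ x , z ⟩ - ⟨ y , z ⟩
  ⟨⟩-−ˡ x y z = trans (⟨⟩-+ˡ x (-ᴹ y) z) (+-congˡ (⟨⟩--ˡ y z))

  ⟨⟩-−ʳ : ∀ x y z → ⟨ x , y -ᴹ z ⟩ ≈ ⟨ x , y ⟩ - ⟨ x , z ⟩
  ⟨⟩-−ʳ x y z = trans (⟨⟩-+ʳ x y (-ᴹ z)) (+-congˡ (⟨⟩--ʳ x z))

  ⟨⟩-∑ˡ : ∀ {n} (v : Vector Carrierᴹ n) x → ⟨ ∑ v , x ⟩ ≈ sum (λ i → ⟨ v i , x ⟩)
  ⟨⟩-∑ˡ {zero}  v x = ⟨⟩-0ˡ x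
  ⟨⟩-∑ˡ {suc n} v x = trans (⟨⟩-+ˡ (v zero) _ x) (+-congˡ (⟨⟩-∑ˡ (λ i → v (suc i)) x))

  ⟨⟩-comb : ∀ {n} (c : Vector Carrier n) v x → ⟨ comb c v , x ⟩ ≈ sum (λ i → c i * ⟨ v i , x ⟩)
  ⟨⟩-comb {n} c v x = trans (⟨⟩-∑ˡ (λ i → c i *ₗ v i) x) (sum-cong-≋ {n} (λ i → ⟨⟩-*ˡ (c i) (v i) x))

  ≈ᴹ-from-− : ∀ {x y} → x -ᴹ y ≈ᴹ 0ᴹ → x ≈ᴹ y
  ≈ᴹ-from-− {x} {y} eq = ≈ᴹ-trans (≈ᴹ-sym (+ᴹ-identityʳ x))
    (≈ᴹ-trans (+ᴹ-congˡ (≈ᴹ-sym (-ᴹ‿inverseˡ y)))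
    (≈ᴹ-trans (≈ᴹ-sym (+ᴹ-assoc x (-ᴹ y) y)) (≈ᴹ-trans (+ᴹ-congʳ eq) (+ᴹ-identityˡ y))))

  ⟨⟩-ext : ∀ {x y} → (∀ z → ⟨ x , z ⟩ ≈ ⟨ y , z ⟩) → x ≈ᴹ y
  ⟨⟩-ext {x} {y} x≈y = ≈ᴹ-from-− (definite (trans (⟨⟩-−ˡ x y (x -ᴹ y))
    (trans (+-congʳ (x≈y (x -ᴹ y))) (-‿inverseʳ _))))

  segment : Carrierᴹ → Carrierᴹ → Carrier → Carrierᴹ
  segment x y t = x +ᴹ t *ₗ (y -ᴹ x)

  ⟨⟩-segment : ∀ z x y t → ⟨ z , segment x y t ⟩ ≈ ⟨ z , x ⟩ + t * (⟨ z , y ⟩ - ⟨ z , x ⟩)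
  ⟨⟩-segment z x y t = trans (⟨⟩-+ʳ z x _) (+-congˡ (trans (⟨⟩-*ʳ t z _) (*-congˡ (⟨⟩-−ʳ z y x))))

  segment-− : ∀ x y s t → segment x y s -ᴹ segment x y t ≈ᴹ (s - t) *ₗ (y -ᴹ x)
  segment-− x y s t = ⟨⟩-ext λ z → begin
    ⟨ segment x y s -ᴹ segment x y t , z ⟩
      ≈⟨ trans (⟨⟩-sym _ z) (⟨⟩-−ʳ z _ _) ⟩
    ⟨ z , segment x y s ⟩ - ⟨ z , segment x y t ⟩
      ≈⟨ +-cong (⟨⟩-segment z x y s) (-‿cong (⟨⟩-segment z x y t)) ⟩
    ⟨ z , x ⟩ + s * (⟨ z , y ⟩ - ⟨ z , x ⟩) - (⟨ z , x ⟩ + t * (⟨ z , y ⟩ - ⟨ z , x ⟩))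
      ≈⟨ solve 4 (λ a b s t → a :+ s :* b :- (a :+ t :* b) := (s :- t) :* b) refl _ _ s t ⟩
    (s - t) * (⟨ z , y ⟩ - ⟨ z , x ⟩)
      ≈⟨ trans (⟨⟩-sym _ z) (trans (⟨⟩-*ʳ (s - t) z _) (*-congˡ (⟨⟩-−ʳ z y x))) ⟨
    ⟨ (s - t) *ₗ (y -ᴹ x) , z ⟩ ∎
    where open SetoidReasoning setoid

  segment-dist : ∀ x y s t → ⟨ segment x y s -ᴹ segment x y t , segment x y s -ᴹ segment x y t ⟩ ≈
                 (s - t) * (s - t) * ⟨ y -ᴹ x , y -ᴹ x ⟩
  segment-dist x y s t = trans (⟨⟩-cong (segment-− x y s t) (segment-− x y s t))
    (trans (⟨⟩-*ˡ (s - t) _ _) (trans (*-congˡ (⟨⟩-*ʳ (s - t) _ _)) (sym (*-assoc _ _ _))))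

  Convex : Pred Carrierᴹ ℓ → Set ℓ
  Convex C = ∀ {x y t} → C x → C y → 0# ≤ t → t ≤ 1# → C (segment x y t)

  -- Bisecting the segment leads to a limit point at which `P` or `Q` holds, and with it on a ball.
  -- The ball contains the ends of a narrow bracket, one of which then satisfies both predicates.
  convex⇒connected : ∀ {C} → Convex C → Connected C
  convex⇒connected {C} convex P Q openP openQ cover disjoint ((x , Cx , Px) , (y , Cy , Qy)) =
    [ inP , inQ ]′ (cover Cz)
    where
    γ = segment x y
    D = ⟨ y -ᴹ x , y -ᴹ x ⟩
    Cγ : ∀ {t} → 0# ≤ t → t ≤ 1# → C (γ t)
    Cγ = convex Cx Cy
    0≤0 = ≤-reflexive {0#} refl
    1≤1 = ≤-reflexive {1#} refl
    0≤1 = <⇒≤ 0<1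

    dist-≈ : ∀ {u v} → (∀ z → ⟨ z , u ⟩ - ⟨ z , v ⟩ ≈ 0#) → ⟨ u -ᴹ v , u -ᴹ v ⟩ ≈ 0#
    dist-≈ {u} {v} eq = trans (⟨⟩-−ʳ _ u v) (eq _)

    -- `P` is not assumed to respect `≈ᴹ`; openness carries it from `x` to `γ 0#`, which is at
    -- distance 0. The same applies to `Q` below.
    Pγ0 : P (γ 0#)
    Pγ0 = let ε , 0<ε , ball = openP Cx Px
          in  ball (Cγ 0≤0 0≤1) (<-respˡ-≈ (sym (dist-≈ λ z → trans (+-congʳ (⟨⟩-segment z x y 0#))
                (solve 2 (λ a b → a :+ con (+ 0) :* b :- a := con (+ 0)) refl ⟨ z , x ⟩
                  (⟨ z , y ⟩ - ⟨ z , x ⟩)))) 0<ε)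
    Qγ1 : Q (γ 1#)
    Qγ1 = let ε , 0<ε , ball = openQ Cy Qy
          in  ball (Cγ 0≤1 1≤1) (<-respˡ-≈
                (sym (dist-≈ λ z → trans (+-congʳ
                (trans (⟨⟩-segment z x y 1#) (+-congˡ (*-identityˡ _))))
                (solve 2 (λ a b → a :+ (b :- a) :- b := con (+ 0)) refl ⟨ z , x ⟩ ⟨ z , y ⟩))) 0<ε)

    open Bisection (λ t → P (γ t)) (λ t → Q (γ t)) (λ 0≤t t≤1 → cover (Cγ 0≤t t≤1)) Pγ0 Qγ1
    open Bracket

    0≤point = ≤-trans (0≤lo (bracket 0)) (lo≤point 0)
    point≤1 = ≤-trans (point≤hi 0) (hi≤1 (bracket 0))
    Cz : C (γ point)
    Cz = Cγ 0≤point point≤1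

    close : ∀ {s n ε} → (s - point) * (s - point) ≤ ½^ n → ½^ n * D < ε →
            Ball (γ point) ε (γ s)
    close {s} {n} sq≤ small = <-respˡ-≈ (sym (segment-dist x y s point)) (≤-<-trans
      (≤-via (solve 3 (λ h u d → (h :- u) :* d := h :* d :- u :* d) refl (½^ n) _ D)
        (nonNeg*nonNeg (≤⇒0≤- sq≤) (nonNeg _)))
      small)

    -- Balls are measured by squared distance; as parameters differ by at most 1, the width of the
    -- bracket also bounds the square.
    square≤ : ∀ {u d} → 0# ≤ u → u ≤ 1# → u ≤ d → u * u ≤ d
    square≤ {u} {d} 0≤u u≤1 u≤d = ≤-trans (≤-via
      (trans (solve 2 (λ o u → u :* (o :- u) := o :* u :- u :* u) refl 1# u) (+-congʳ (*-identityˡ u)))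
      (nonNeg*nonNeg 0≤u (≤⇒0≤- u≤1))) u≤d

    inP : ¬ P (γ point)
    inP Pz =
      let ε , 0<ε , ball = openP Cz Pz
          n , small = ½^-small D 0<ε
          b = bracket n
          0≤u = ≤⇒0≤- (point≤hi n)
          u≤d = ≤-via (trans (solve 3 (λ l p d → p :- l := d :- (l :+ d :- p)) refl (lo b) point (½^ n))
                             (+-congˡ (-‿cong (+-congʳ (width b))))) (≤⇒0≤- (lo≤point n))
          u≤1 = ≤-via (solve 3 (λ h p o → (o :- h) :+ p := o :- (h :- p)) refl (hi b) point 1#)
                  (nonNeg+nonNeg (≤⇒0≤- (hi≤1 b)) 0≤point)
          Chi = Cγ (≤-trans 0≤point (point≤hi n)) (hi≤1 b)
      in  disjoint Chi (ball Chi (close {n = n} (square≤ 0≤u u≤1 u≤d) small) , Q-hi b)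

    inQ : ¬ Q (γ point)
    inQ Qz =
      let ε , 0<ε , ball = openQ Cz Qz
          n , small = ½^-small D 0<ε
          b = bracket n
          0≤u = ≤⇒0≤- (lo≤point n)
          u≤d = ≤-via (trans (+-congʳ (sym (width b)))
            (solve 3 (λ l p d → l :+ d :- p := d :- (p :- l)) refl (lo b) point (½^ n)))
                  (≤⇒0≤- (point≤hi n))
          u≤1 = ≤-via (solve 3 (λ l p o → (o :- p) :+ l := o :- (p :- l)) refl (lo b) point 1#)
                  (nonNeg+nonNeg (≤⇒0≤- point≤1) (0≤lo b))
          Clo = Cγ (0≤lo b) (≤-trans (lo≤point n) point≤1)
          sq  = solve 2 (λ l p → (p :- l) :* (p :- l) := (l :- p) :* (l :- p)) refl (lo b) point
      in  disjoint Clo (P-lo b , ball Clo (close {n = n}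
            (≤-trans (≤-reflexive (sym sq)) (square≤ 0≤u u≤1 u≤d)) small))

  -- The vector `u` is twice the component of `w` orthogonal to `β`; the claim is `0 ≤ ⟨ u , u ⟩`
  -- after expansion.
  cauchy-schwarz : ∀ {β} w → ⟨ β , β ⟩ ≈ fromℕ 2 → ⟨ β , w ⟩ * ⟨ β , w ⟩ ≤ fromℕ 2 * ⟨ w , w ⟩
  cauchy-schwarz {β} w norm = ≤-via′ (nonNeg u)
    where
    t = ⟨ β , w ⟩
    u = fromℕ 2 *ₗ w -ᴹ t *ₗ β
    pair : ∀ z → ⟨ z , u ⟩ ≈ fromℕ 2 * ⟨ z , w ⟩ - t * ⟨ z , β ⟩
    pair z = trans (⟨⟩-−ʳ z _ _) (+-cong (⟨⟩-*ʳ _ z w) (-‿cong (⟨⟩-*ʳ t z β)))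
    expand : ⟨ u , u ⟩ ≈ fromℕ 2 * (fromℕ 2 * ⟨ w , w ⟩ - t * t)
    expand = begin
      ⟨ u , u ⟩                                   ≈⟨ pair u ⟩
      fromℕ 2 * ⟨ u , w ⟩ - t * ⟨ u , β ⟩         ≈⟨ +-cong (*-congˡ (trans (⟨⟩-sym u w) (pair w)))
                                                       (-‿cong (*-congˡ (trans (⟨⟩-sym u β)
                                                         (pair β)))) ⟩
      fromℕ 2 * (fromℕ 2 * ⟨ w , w ⟩ - t * ⟨ w , β ⟩) - t * (fromℕ 2 * t - t * ⟨ β , β ⟩)
        ≈⟨ +-cong (*-congˡ (+-congˡ (-‿cong (*-congˡ (⟨⟩-sym w β)))))
          (-‿cong (*-congˡ (+-congˡ (-‿cong (*-congˡ norm))))) ⟩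
      fromℕ 2 * (fromℕ 2 * ⟨ w , w ⟩ - t * t) - t * (fromℕ 2 * t - t * fromℕ 2)
        ≈⟨ solve 2 (λ a t → con (+ 2) :* (con (+ 2) :* a :- t :* t) :- t :*
          (con (+ 2) :* t :- t :* con (+ 2))
                          := con (+ 2) :* (con (+ 2) :* a :- t :* t)) refl ⟨ w , w ⟩ t ⟩
      fromℕ 2 * (fromℕ 2 * ⟨ w , w ⟩ - t * t) ∎
      where open SetoidReasoning setoid
    ≤-via′ : 0# ≤ ⟨ u , u ⟩ → t * t ≤ fromℕ 2 * ⟨ w , w ⟩
    ≤-via′ 0≤ lt = 0≤ (<-respˡ-≈ (sym expand) (<-via
      (solve 2 (λ b t → con (+ 2) :* (t :- b) := con (+ 0) :- con (+ 2) :* (b :- t)) refl _ _)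
      (*-pos (0<fromℕ-suc 1) (<⇒0<- lt))))

  -- `(d - t) * (d + t)` is invertible, so `d + t` is apart from 0; were it negative, `t * t` would
  -- exceed `d * d`.
  square-< : ∀ {t d} → 0# < d → t * t < d * d → 0# < d + t
  square-< {t} {d} 0<d tt<dd =
    let z , z*≈1 = #0⇒inverse (>⇒# (<⇒0<- tt<dd))
    in  [ (λ d+t<0 → contradiction tt<dd (<-asym (<-via
            (solve 2 (λ d t → (con (+ 0) :- (d :+ t)) :* (d :+ d :- (d :+ t)) := t :* t :- d :* d) refl d t)
            (*-pos (<⇒0<- d+t<0) (<⇒0<- (<-trans d+t<0 (pos+nonNeg 0<d (<⇒≤ 0<d))))))))
        , (λ 0<d+t → 0<d+t) ]′
        (Equivalence.to #⇔<⊎> (inverse⇒#0 {d + t} (z * (d - t))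
          (trans (solve 3 (λ d t z → z :* (d :- t) :* (d :+ t) := z :* (d :* d :- t :* t)) refl d t z) z*≈1)))

  module _ {β} (norm : ⟨ β , β ⟩ ≈ fromℕ 2) (p : Carrier) where

    private
      near : ∀ {d x y} → 0# < d → Ball x (proj₁ (reciprocal (0<fromℕ-suc 1)) * (d * d)) y →
             ⟨ β , y -ᴹ x ⟩ * ⟨ β , y -ᴹ x ⟩ < d * d
      near {d} {x} {y} 0<d ball = ≤-<-trans (cauchy-schwarz (y -ᴹ x) norm)
        (<-respʳ-≈ (trans (solve 2 (λ h d → con (+ 2) :* (h :* d) := h :* con (+ 2) :* d) refl _
          (d * d))
            (trans (*-congʳ (proj₂ (proj₂ (reciprocal (0<fromℕ-suc 1))))) (*-identityˡ _)))
          (*-monoˡ-< (0<fromℕ-suc 1) ball))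
      radius-pos : ∀ {d} → 0# < d → 0# < proj₁ (reciprocal (0<fromℕ-suc 1)) * (d * d)
      radius-pos 0<d = *-pos (proj₁ (proj₂ (reciprocal (0<fromℕ-suc 1)))) (*-pos 0<d 0<d)

    -- The squared radius is `d * d / 2` with `d = ⟨ β , x ⟩ - p`: since `⟨ β , β ⟩` is 2,
    -- Cauchy-Schwarz keeps the change of the pairing with `β` below `d`.
    upper-open : ∀ C → OpenIn C (λ z → p < ⟨ β , z ⟩)
    upper-open C {x} _ p<x = _ , radius-pos (<⇒0<- p<x) , λ {y} _ ball → <-via
      (trans (+-congˡ (⟨⟩-−ʳ β y x))
        (solve 3 (λ p x y → x :- p :+ (y :- x) := y :- p) refl p ⟨ β , x ⟩ ⟨ β , y ⟩))
      (square-< (<⇒0<- p<x) (near (<⇒0<- p<x) ball))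

    lower-open : ∀ C → OpenIn C (λ z → ⟨ β , z ⟩ < p)
    lower-open C {x} _ x<p = _ , radius-pos (<⇒0<- x<p) , λ {y} _ ball → <-via
      (trans (+-congˡ (-‿cong (⟨⟩-−ʳ β y x)))
        (solve 3 (λ p x y → p :- x :+ :- (y :- x) := p :- y) refl p ⟨ β , x ⟩ ⟨ β , y ⟩))
      (square-< (<⇒0<- x<p) (<-respˡ-≈ (solve 1 (λ t → t :* t := (:- t) :* (:- t)) refl _)
        (near (<⇒0<- x<p) ball)))

-- Alcoves as regions with prescribed floors.

module Alcoves {ℓ} {ℝ : Reals ℓ} (V : EuclideanSpace ℝ) {k} (T : TypeA V k) where
  open Reals ℝ hiding (zero)
  open OrderedFieldProperties orderedField
  open RealProperties ℝ
  open EuclideanSpace V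
  open EuclideanSpaceProperties V
  open TypeA T

  -- Off the hyperplane the two open half-spaces cover `A`, and a connected set meets only one of
  -- them.
  same-side : ∀ {A x y β} p → Connected A → A ⊆ Complement → A x → A y → Φ β →
              fromℤ p < ⟨ β , x ⟩ → fromℤ p < ⟨ β , y ⟩
  same-side {A} {x} {y} {β} p conn A⊆U Ax Ay β∈Φ p<x =
    [ (λ y<p → contradiction ((x , Ax , p<x) , (y , Ay , y<p))
        (conn _ _ (upper-open (normalised β∈Φ) (fromℤ p) A) (lower-open (normalised β∈Φ) (fromℤ p) A)
          (λ Az → [ inj₂ , inj₁ ]′ (Equivalence.to #⇔<⊎> (A⊆U Az β∈Φ p)))
          (λ _ (p<z , z<p) → <-asym p<z z<p)))
    , (λ p<y → p<y) ]′
    (Equivalence.to #⇔<⊎> (A⊆U Ay β∈Φ p))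

  module Regions {N} (r : Vector Carrierᴹ N)
           (difference∈Φ : ∀ {i j} → i ≢ j → Φ (r i -ᴹ r j))
           (∈Φ⇒difference : ∀ {β} → Φ β → ∃₂ λ i j → i ≢ j × β ≈ᴹ r i -ᴹ r j) where

    gap : Fin N → Fin N → Carrierᴹ → Carrier
    gap i j x = ⟨ r i , x ⟩ - ⟨ r j , x ⟩

    ⟨difference⟩ : ∀ i j x → ⟨ r i -ᴹ r j , x ⟩ ≈ gap i j x
    ⟨difference⟩ i j x = ⟨⟩-−ˡ (r i) (r j) x

    -- Lower bounds suffice: for an address the upper bound on `gap i j` is the lower bound on
    -- `gap j i`, by `antisym`.
    Region : (Fin N → Fin N → ℤ) → Pred Carrierᴹ ℓ
    Region q x = ∀ {i j} → i ≢ j → fromℤ (q i j) < gap i j x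

    gap-swap : ∀ i j x → gap j i x ≈ - gap i j x
    gap-swap i j x = solve 2 (λ a b → b :- a := :- (a :- b)) refl ⟨ r i , x ⟩ ⟨ r j , x ⟩

    module _ {q x} (isA : IsAddress q) (x∈R : Region q x) where
      open IsAddress isA

      region-upper : ∀ {i j} → i ≢ j → gap i j x < fromℤ (q i j ℤ.+ 1ℤ)
      region-upper {i} {j} i≢j = <-resp
        (trans (-‿cong (gap-swap i j x)) (solve 1 (λ a → :- (:- a) := a) refl _))
        (trans (sym (fromℤ-neg (q j i)))
          (reflexive (≡.cong fromℤ (ℤ-neg (q i j) (q j i) (antisym i≢j)))))
        (neg-mono-< (x∈R (i≢j ∘ ≡.sym)))
        where
        ℤ-neg : ∀ a b → a ℤ.+ b ≡ -1ℤ → ℤ.- b ≡ a ℤ.+ 1ℤ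
        ℤ-neg a b eq = ≡-transfer (≡.sym eq) (eq′ a b)
          where eq′ : ∀ a b → a ℤ.+ b ℤ.- -1ℤ ≡ a ℤ.+ 1ℤ ℤ.- ℤ.- b
                eq′ = solve-∀

      region⇒floor : ∀ i j → IsFloor (gap i j x) (q i j)
      region⇒floor i j with i Fin.≟ j
      ... | no i≢j = <⇒≤ (x∈R i≢j) , region-upper i≢j
      ... | yes ≡.refl rewrite diagonal i =
        ≤-reflexive (sym (-‿inverseʳ _)) , <-respˡ-≈ (sym (-‿inverseʳ _)) (0<fromℕ-suc 0)

      region⇒complement : Complement x
      region⇒complement {β} β∈Φ p with ∈Φ⇒difference β∈Φ
      ... | i , j , i≢j , β≈ = #-resp (p ℤ.≤? q i j)
        where
        β≈gap : ⟨ β , x ⟩ ≈ gap i j x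
        β≈gap = trans (⟨⟩-congˡ β≈) (⟨difference⟩ i j x)
        #-resp : _ → ⟨ β , x ⟩ # fromℤ p
        #-resp (yes p≤q) = >⇒# (<-respʳ-≈ (sym β≈gap) (≤-<-trans (fromℤ-mono-≤ p≤q) (x∈R i≢j)))
        #-resp (no p≰q)  = <⇒# (<-respˡ-≈ (sym β≈gap) (<-≤-trans (region-upper i≢j)
          (fromℤ-mono-≤ (<⇒+1≤ (ℤ.≰⇒> p≰q)))))

    floors⇒address : ∀ {q x} → (∀ i j → IsFloor (gap i j x) (q i j)) → Region q x → IsAddress q
    floors⇒address {q} {x} fl x∈R = record
      { diagonal = λ i → floor-unique (IsFloor-resp (-‿inverseʳ _) (fl i i))
          (≤-reflexive refl , 0<fromℕ-suc 0)
      ; antisym = λ {i} {j} i≢j → ℤ.≤-antisym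
          (-1<⇒≤ (+1≤⇒< (≤-transfer (<⇒+1≤ (fromℤ-cancel-< {q i j ℤ.+ q j i} {0ℤ}
            (<-resp (sym (fromℤ-+ (q i j) (q j i))) (trans (+-congˡ (gap-swap i j x)) (-‿inverseʳ _))
              (+-mono-< (x∈R i≢j) (x∈R (i≢j ∘ ≡.sym)))))) (eq₁ (q i j ℤ.+ q j i)))))
          (-1<⇒≤ (+1≤⇒< (≤-transfer (<⇒+1≤ (fromℤ-cancel-< {0ℤ} {(q i j ℤ.+ 1ℤ) ℤ.+ (q j i ℤ.+ 1ℤ)}
            (<-resp (trans (+-congˡ (gap-swap i j x)) (-‿inverseʳ _))
              (sym (fromℤ-+ (q i j ℤ.+ 1ℤ) (q j i ℤ.+ 1ℤ)))
              (+-mono-< (upper (fl i j)) (upper (fl j i)))))) (eq₂ (q i j) (q j i)))))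
      ; super = λ i j l → <+1⇒≤ (fromℤ-cancel-< (≤-<-trans
          (≤-via (trans (+-cong refl refl)
            (trans (solve 5 (λ a b c p q → (a :- b :- p) :+ (b :- c :- q) := (a :- c) :- (p :+ q)) refl
                   ⟨ r i , x ⟩ ⟨ r j , x ⟩ ⟨ r l , x ⟩ (fromℤ (q i j)) (fromℤ (q j l)))
                   (+-congˡ (-‿cong (sym (fromℤ-+ (q i j) (q j l)))))))
            (nonNeg+nonNeg (≤⇒0≤- (lower (fl i j))) (≤⇒0≤- (lower (fl j l)))))
          (upper (fl i l))))
      }
      where
      eq₁ : ∀ s → 0ℤ ℤ.- (s ℤ.+ 1ℤ) ≡ -1ℤ ℤ.- ((s ℤ.- 1ℤ) ℤ.+ 1ℤ)
      eq₁ = solve-∀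
      eq₂ : ∀ a b → (a ℤ.+ 1ℤ) ℤ.+ (b ℤ.+ 1ℤ) ℤ.- (0ℤ ℤ.+ 1ℤ) ≡ (a ℤ.+ b) ℤ.- ((-1ℤ ℤ.- 1ℤ) ℤ.+ 1ℤ)
      eq₂ = solve-∀

    region-exists : ∀ {x} → Complement x → ∃ λ q → IsAddress q × Region q x
    region-exists {x} x∈U = q , floors⇒address fl strict , strict
      where
      floor : ∀ {i j} → i ≢ j → ∃ λ q → fromℤ q < gap i j x × gap i j x < fromℤ (q ℤ.+ 1ℤ)
      floor {i} {j} i≢j = floor-exists λ p → [ (λ <p → <⇒# (<-respˡ-≈ (⟨difference⟩ i j x) <p))
                                             , (λ p< → >⇒# (<-respʳ-≈ (⟨difference⟩ i j x) p<)) ]′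
        (Equivalence.to #⇔<⊎> (x∈U (difference∈Φ i≢j) p))
      entry : ∀ i j → ∃ λ q → IsFloor (gap i j x) q × (i ≢ j → fromℤ q < gap i j x)
      entry i j with i Fin.≟ j
      ... | yes ≡.refl = 0ℤ , (≤-reflexive (sym (-‿inverseʳ _)) , <-respˡ-≈ (sym (-‿inverseʳ _))
        (0<fromℕ-suc 0)) ,
                         λ i≢i → contradiction ≡.refl i≢i
      ... | no i≢j = let q , q< , <q = floor i≢j in q , (<⇒≤ q< , <q) , λ _ → q<
      q : Fin N → Fin N → ℤ
      q i j = proj₁ (entry i j)
      fl : ∀ i j → IsFloor (gap i j x) (q i j)
      fl i j = proj₁ (proj₂ (entry i j))
      strict : Region q x
      strict {i} {j} = proj₂ (proj₂ (entry i j))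

    region-convex : ∀ q → Convex (Region q)
    region-convex q {x} {y} {t} Rx Ry 0≤t t≤1 {i} {j} i≢j = <-via
      (trans (solve 5 (λ q a b t o → (o :- t) :* (a :- q) :+ t :* (b :- q) := o :* (a :- q) :+ t :*
        (b :- a)) refl
                (fromℤ (q i j)) (gap i j x) (gap i j y) t 1#)
        (trans (+-congʳ (*-identityˡ _))
          (trans (solve 6 (λ q a b c d t → a :- b :- q :+ t :* (c :- d :- (a :- b)) :=
            (a :+ t :* (c :- a)) :- (b :+ t :* (d :- b)) :- q) refl
                    (fromℤ (q i j)) ⟨ r i , x ⟩ ⟨ r j , x ⟩ ⟨ r i , y ⟩ ⟨ r j , y ⟩ t)
             (+-congʳ (sym (+-cong (⟨⟩-segment (r i) x y t) (-‿cong (⟨⟩-segment (r j) x y t))))))))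
      (combine (<⇒0<- (Rx i≢j)) (<⇒0<- (Ry i≢j)))
      where
      -- Either `0 < t` or `t < 1`, and in each case one of the two summands is positive.
      combine : ∀ {a b} → 0# < a → 0# < b → 0# < (1# - t) * a + t * b
      combine {a} {b} 0<a 0<b with <-cotrans 0<1 t
      ... | inj₁ 0<t = <-respʳ-≈ (+-comm _ _)
            (pos+nonNeg (*-pos 0<t 0<b) (nonNeg*nonNeg (≤⇒0≤- t≤1) (<⇒≤ 0<a)))
      ... | inj₂ t<1 = pos+nonNeg (*-pos (<⇒0<- t<1) 0<a) (nonNeg*nonNeg 0≤t (<⇒≤ 0<b))

    connected⊆region : ∀ {A q x} → Connected A → A ⊆ Complement → A x → Region q x → A ⊆ Region q
    connected⊆region {q = q} conn A⊆U Ax Rx Ay {i} {j} i≢j =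
      <-respʳ-≈ (⟨difference⟩ i j _)
        (same-side (q i j) conn A⊆U Ax Ay (difference∈Φ i≢j) (<-respʳ-≈ (sym (⟨difference⟩ i j _))
          (Rx i≢j)))

    -- Stated for any set with the same points as a region, so that it also covers the image of an
    -- alcove under `ρ`.
    region⇒alcove : ∀ {A q x} → IsAddress q → Region q x → A ⊆ Region q → Region q ⊆ A → IsAlcove A
    region⇒alcove {A} {q} {x} isA Rx A⊆R R⊆A = record
      { inhabited = x , R⊆A Rx
      ; within    = λ Ay → region⇒complement isA (A⊆R Ay)
      ; connected = λ P Q openP openQ cover disjoint ((y , Ay , Py) , (z , Az , Qz)) →
          convex⇒connected (region-convex q) P Q (restrict openP) (restrict openQ)
            (λ Ry → cover (R⊆A Ry)) (λ Ry → disjoint (R⊆A Ry))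
            ((y , A⊆R Ay , Py) , (z , A⊆R Az , Qz))
      ; maximal   = λ C C⊆U conn A⊆C Cy → R⊆A (connected⊆region {q = q} conn C⊆U (A⊆C (R⊆A Rx)) Rx Cy)
      }
      where
      restrict : ∀ {P} → OpenIn A P → OpenIn (Region q) P
      restrict openP Ry Py = let ε , 0<ε , ball = openP (R⊆A Ry) Py
                             in  ε , 0<ε , λ Rz → ball (R⊆A Rz)

    region-isAlcove : ∀ {q x} → IsAddress q → Region q x → IsAlcove (Region q)
    region-isAlcove {q} isA Rx = region⇒alcove {Region q} {q} isA Rx
      (λ {y} (Ry : Region q y) {i} {j} → Ry {i} {j}) (λ {y} (Ry : Region q y) {i} {j} → Ry {i} {j})

    -- The floors at one point of `A` give a region. It contains `A` because `A` is connected, and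
    -- lies in `A` because it is convex, hence connected, and `A` is maximal.
    alcove⇒region : ∀ {A} → IsAlcove A → ∃₂ λ x q → A x × IsAddress q × Region q x × A ⊆ Region q ×
      Region q ⊆ A
    alcove⇒region {A} isAlcove =
      let x , Ax = inhabited
          q , isA , Rx = region-exists (within Ax)
          A⊆R : A ⊆ Region q
          A⊆R = connected⊆region {q = q} connected within Ax Rx
      in  x , q , Ax , isA , Rx , A⊆R ,
          maximal (Region q) (λ Ry → region⇒complement {q} isA Ry)
            (convex⇒connected (region-convex q)) A⊆R
      where open IsConnectedComponent isAlcove

    region-unique : ∀ {q q′ x} → IsAddress q → IsAddress q′ → Region q x → Region q′ x →
                    ∀ i j → q i j ≡ q′ i j
    region-unique isA isA′ Rx Rx′ i j = floor-unique (region⇒floor isA Rx i j)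
      (region⇒floor isA′ Rx′ i j)

-- The roots of type A as differences of partial sums of simple roots.

χ : ℕ → ℕ → ℕ
χ zero    zero    = 1
χ zero    (suc b) = 0
χ (suc a) zero    = 0
χ (suc a) (suc b) = χ a b

χ-refl : ∀ a → χ a a ≡ 1
χ-refl zero    = ≡.refl
χ-refl (suc a) = χ-refl a

χ-≢ : ∀ {a b} → a ≢ b → χ a b ≡ 0
χ-≢ {zero}  {zero}  a≢b = contradiction ≡.refl a≢b
χ-≢ {zero}  {suc b} a≢b = ≡.refl
χ-≢ {suc a} {zero}  a≢b = ≡.refl
χ-≢ {suc a} {suc b} a≢b = χ-≢ (a≢b ∘ ≡.cong suc)

-- The coordinates of the i-th simple root and of the j-th partial sum of
-- simple roots are eᵢ₊₁ - eᵢ and eⱼ - e₀; this is their inner product.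
pairing : ℕ → ℕ → ℤ
pairing i j = + χ (suc i) j ℤ.- + χ i j ℤ.+ + χ i 0

cartan-χ : ∀ a b → ℤ
cartan-χ a b = + 2 ℤ.* + χ a b ℤ.- + χ a (suc b) ℤ.- + χ (suc a) b

-- The recursion of `χ` computes `χ (suc i) (suc j)` to `χ i j`, which leaves a polynomial identity.
pairing-suc : ∀ i j → pairing i (suc j) ≡ pairing i j ℤ.+ cartan-χ i j
pairing-suc i j = eq (+ χ (suc i) j) (+ χ i j) (+ χ i (suc j)) (+ χ i 0)
  where
  eq : ∀ a b c d → b ℤ.- c ℤ.+ d ≡ (a ℤ.- b ℤ.+ d) ℤ.+ (+ 2 ℤ.* b ℤ.- c ℤ.- a)
  eq = solve-∀

first-nonzero : ∀ {n} (c : Fin n → ℕ) →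
  (∀ i → c i ≡ 0) ⊎ ∃ λ a → c a ≢ 0 × (∀ i → c i ≢ 0 → toℕ a ℕ.≤ toℕ i)
first-nonzero {zero}  c = inj₁ λ ()
first-nonzero {suc n} c with c zero ℕ.≟ 0 | first-nonzero (c ∘ suc)
... | no c₀≢0  | _ = inj₂ (zero , c₀≢0 , λ _ _ → ℕ.z≤n)
... | yes c₀≡0 | inj₁ all = inj₁ λ { zero → c₀≡0 ; (suc i) → all i }
... | yes c₀≡0 | inj₂ (a , ca≢0 , min) = inj₂ (suc a , ca≢0 ,
  λ { zero c₀≢0 → contradiction c₀≡0 c₀≢0 ; (suc i) ci≢0 → ℕ.s≤s (min i ci≢0) })

last-nonzero : ∀ {n} (c : Fin n → ℕ) →
  (∀ i → c i ≡ 0) ⊎ ∃ λ b → c b ≢ 0 × (∀ i → c i ≢ 0 → toℕ i ℕ.≤ toℕ b)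
last-nonzero {zero}  c = inj₁ λ ()
last-nonzero {suc n} c with last-nonzero (c ∘ suc) | c zero ℕ.≟ 0
... | inj₂ (b , cb≢0 , max) | _ = inj₂ (suc b , cb≢0 ,
  λ { zero _ → ℕ.z≤n ; (suc i) ci≢0 → ℕ.s≤s (max i ci≢0) })
... | inj₁ all | yes c₀≡0 = inj₁ λ { zero → c₀≡0 ; (suc i) → all i }
... | inj₁ all | no c₀≢0 = inj₂ (zero , c₀≢0 ,
  λ { zero _ → ℕ.z≤n ; (suc i) ci≢0 → contradiction (all i) ci≢0 })

module Roots {ℓ} {ℝ : Reals ℓ} (V : EuclideanSpace ℝ) {k} (T : TypeA V k) where
  open Reals ℝ hiding (zero)
  open OrderedFieldProperties orderedField
  open EuclideanSpace V
  open EuclideanSpaceProperties V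
  open TypeA T
  open IsRootSystem isRootSystem using (enumerates; reflection; nonzero)
  open AreSimpleRoots simple using (α∈Φ; sameSign)

  partial : ∀ {n} → Vector Carrierᴹ n → Fin (suc n) → Carrierᴹ
  partial         v zero    = 0ᴹ
  partial {suc n} v (suc i) = v zero +ᴹ partial (v ∘ suc) i

  partial-suc : ∀ {n} (v : Vector Carrierᴹ n) i → partial v (suc i) ≈ᴹ partial v (inject₁ i) +ᴹ v i
  partial-suc v zero    = +ᴹ-comm _ _
  partial-suc v (suc i) = ≈ᴹ-trans (+ᴹ-congˡ (partial-suc (v ∘ suc) i)) (≈ᴹ-sym (+ᴹ-assoc _ _ _))

  partial-last : ∀ {n} (v : Vector Carrierᴹ n) → partial v (last n) ≈ᴹ ∑ v
  partial-last {zero}  v = ≈ᴹ-refl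
  partial-last {suc n} v = +ᴹ-congˡ (partial-last (v ∘ suc))

  σ : Fin (suc k) → Carrierᴹ
  σ = partial α

  cartan-≡ : ∀ (i j : Fin k) → cartanA V i j ≡ cartan-χ (toℕ i) (toℕ j)
  cartan-≡ i j = ≡.trans unfold (formula (toℕ i) (toℕ j))
    where
    entry : ℕ → ℤ
    entry 0 = + 2
    entry 1 = -[1+ 0 ]
    entry (suc (suc _)) = + 0
    unfold : cartanA V i j ≡ entry ℕ.∣ toℕ i - toℕ j ∣
    unfold with ℕ.∣ toℕ i - toℕ j ∣
    ... | 0 = ≡.refl
    ... | 1 = ≡.refl
    ... | suc (suc _) = ≡.refl
    formula : ∀ a b → entry ℕ.∣ a - b ∣ ≡ cartan-χ a b
    formula zero zero = ≡.refl
    formula zero (suc zero) = ≡.refl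
    formula zero (suc (suc b)) = ≡.refl
    formula (suc zero) zero = ≡.refl
    formula (suc (suc a)) zero = ≡.refl
    formula (suc a) (suc b) = formula a b

  ⟨α,σ⟩ : ∀ i j → ⟨ α i , σ j ⟩ ≈ fromℤ (pairing (toℕ i) (toℕ j))
  ⟨α,σ⟩ i = <-weakInduction (λ j → ⟨ α i , σ j ⟩ ≈ fromℤ (pairing (toℕ i) (toℕ j)))
    (trans (trans (⟨⟩-sym _ _) (⟨⟩-0ˡ _)) (reflexive (≡.cong fromℤ (≡.sym (eq (+ χ (toℕ i) 0))))))
    λ j IH → begin
      ⟨ α i , σ (suc j) ⟩
        ≈⟨ trans (⟨⟩-congʳ (partial-suc α j)) (⟨⟩-+ʳ (α i) (σ (inject₁ j)) (α j)) ⟩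
      ⟨ α i , σ (inject₁ j) ⟩ + ⟨ α i , α j ⟩
        ≈⟨ +-cong IH (trans (cartan i j) (reflexive (≡.cong fromℤ (cartan-≡ i j)))) ⟩
      fromℤ (pairing (toℕ i) (toℕ (inject₁ j))) + fromℤ (cartan-χ (toℕ i) (toℕ j))
        ≡⟨ ≡.cong (λ t → fromℤ (pairing (toℕ i) t) + fromℤ (cartan-χ (toℕ i) (toℕ j)))
          (Fin.toℕ-inject₁ j) ⟩
      fromℤ (pairing (toℕ i) (toℕ j)) + fromℤ (cartan-χ (toℕ i) (toℕ j))
        ≈⟨ fromℤ-+ (pairing (toℕ i) (toℕ j)) (cartan-χ (toℕ i) (toℕ j)) ⟨
      fromℤ (pairing (toℕ i) (toℕ j) ℤ.+ cartan-χ (toℕ i) (toℕ j))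
        ≡⟨ ≡.cong fromℤ (pairing-suc (toℕ i) (toℕ j)) ⟨
      fromℤ (pairing (toℕ i) (suc (toℕ j))) ∎
    where
    open SetoidReasoning setoid
    eq : ∀ a → + 0 ℤ.- a ℤ.+ a ≡ + 0
    eq = solve-∀

  Φ-resp : ∀ {x y} → x ≈ᴹ y → Φ x → Φ y
  Φ-resp {x} {y} x≈y x∈Φ =
    let i , x≈i = Equivalence.to (enumerates x) x∈Φ
    in  Equivalence.from (enumerates y) (i , ≈ᴹ-trans (≈ᴹ-sym x≈y) x≈i)

  reflect : ∀ {β γ c} → Φ β → Φ γ → ⟨ β , γ ⟩ ≈ fromℤ c → Φ (β -ᴹ fromℤ c *ₗ γ)
  reflect {β} {γ} {c} β∈Φ γ∈Φ βγ≈c =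
    let n , n-eq , refl∈Φ = reflection β∈Φ γ∈Φ
        n≈c : fromℤ n ≈ fromℤ c
        n≈c = *-cancelˡ-≈ (0<fromℕ-suc 1) (trans (*-comm _ _)
          (trans (*-congˡ (sym (normalised γ∈Φ))) (trans n-eq (*-congˡ βγ≈c))))
    in  Φ-resp (+ᴹ-congˡ (-ᴹ‿cong (*ₗ-cong n≈c ≈ᴹ-refl))) refl∈Φ

  -ᴹ∈Φ : ∀ {β} → Φ β → Φ (-ᴹ β)
  -ᴹ∈Φ {β} β∈Φ = Φ-resp (⟨⟩-ext λ z → trans (⟨⟩-−ˡ β _ z) (trans (+-congˡ (-‿cong (⟨⟩-*ˡ _ β z)))
      (trans (solve 1 (λ a → a :- con (+ 2) :* a := :- a) refl ⟨ β , z ⟩) (sym (⟨⟩--ˡ β z)))))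
    (reflect {c = + 2} β∈Φ β∈Φ (normalised β∈Φ))

  -- Induction on `j`: the root reached so far pairs to `-1` with the next simple root, so
  -- reflecting in that simple root adds it.
  σ-−∈Φ : ∀ i j → toℕ i ℕ.< toℕ j → Φ (σ j -ᴹ σ i)
  σ-−∈Φ i = <-weakInduction (λ j → toℕ i ℕ.< toℕ j → Φ (σ j -ᴹ σ i)) (λ ()) step
    where
    extended : ∀ j {x} → x ≈ᴹ σ (inject₁ j) -ᴹ σ i +ᴹ α j → σ (suc j) -ᴹ σ i ≈ᴹ x
    extended j x≈ = ≈ᴹ-trans (⟨⟩-ext λ z → trans (⟨⟩-−ˡ _ _ z)
      (trans (+-congʳ (trans (⟨⟩-congˡ (partial-suc α j)) (⟨⟩-+ˡ _ _ z)))
        (trans (solve 3 (λ a b c → a :+ b :- c := a :- c :+ b) refl _ _ _)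
          (sym (trans (⟨⟩-+ˡ _ _ z) (+-congʳ (⟨⟩-−ˡ _ _ z))))))) (≈ᴹ-sym x≈)
    step : ∀ j → (toℕ i ℕ.< toℕ (inject₁ j) → Φ (σ (inject₁ j) -ᴹ σ i)) →
           toℕ i ℕ.< suc (toℕ j) → Φ (σ (suc j) -ᴹ σ i)
    step j IH i<1+j with ℕ.m≤n⇒m<n∨m≡n (ℕ.s≤s⁻¹ i<1+j)
    ... | inj₂ i≡j = Φ-resp (≈ᴹ-sym (extended j (⟨⟩-ext λ z → sym (trans (⟨⟩-+ˡ _ _ z)
            (trans (+-congʳ (trans (⟨⟩-−ˡ _ _ z)
              (trans (+-congˡ (-‿cong (reflexive (≡.cong (λ i → ⟨ σ i , z ⟩) i≡inj))))
              (-‿inverseʳ _)))) (+-identityˡ _)))))) (α∈Φ j)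
      where
      i≡inj : i ≡ inject₁ j
      i≡inj = Fin.toℕ-injective (≡.trans i≡j (≡.sym (Fin.toℕ-inject₁ j)))
    ... | inj₁ i<j = Φ-resp (≈ᴹ-sym (extended j (+ᴹ-congˡ (⟨⟩-ext λ z →
            trans (⟨⟩--ˡ _ z) (trans (-‿cong (⟨⟩-*ˡ _ _ z))
              (solve 1 (λ a → :- (con (ℤ.- + 1) :* a) := a) refl _))))))
        (reflect {c = ℤ.- + 1} (IH (≡.subst (toℕ i ℕ.<_) (≡.sym (Fin.toℕ-inject₁ j)) i<j)) (α∈Φ j) (begin
          ⟨ σ (inject₁ j) -ᴹ σ i , α j ⟩
            ≈⟨ trans (⟨⟩-sym _ _) (⟨⟩-−ʳ _ _ _) ⟩
          ⟨ α j , σ (inject₁ j) ⟩ - ⟨ α j , σ i ⟩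
            ≈⟨ +-cong (⟨α,σ⟩ j (inject₁ j)) (-‿cong (⟨α,σ⟩ j i)) ⟩
          fromℤ (pairing (toℕ j) (toℕ (inject₁ j))) - fromℤ (pairing (toℕ j) (toℕ i))
            ≈⟨ fromℤ-- (pairing (toℕ j) (toℕ (inject₁ j))) (pairing (toℕ j) (toℕ i)) ⟨
          fromℤ (pairing (toℕ j) (toℕ (inject₁ j)) ℤ.- pairing (toℕ j) (toℕ i))
            ≡⟨ ≡.cong fromℤ (≡.trans (≡.cong (λ t → pairing (toℕ j) t ℤ.- pairing (toℕ j) (toℕ i))
              (Fin.toℕ-inject₁ j)) (value i<j)) ⟩
          fromℤ (ℤ.- + 1) ∎))
      where
      open SetoidReasoning setoid
      value : ∀ {i j} → i ℕ.< j → pairing j j ℤ.- pairing j i ≡ ℤ.- + 1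
      value {i} {j} i<j rewrite χ-refl j | χ-≢ {suc j} {j} ℕ.1+n≢n
        | χ-≢ {suc j} {i} (ℕ.>⇒≢ (ℕ.m<n⇒m<1+n i<j)) | χ-≢ {j} {i} (ℕ.>⇒≢ i<j) = eq (+ χ j 0)
        where
        eq : ∀ a → (+ 0 ℤ.- + 1 ℤ.+ a) ℤ.- (+ 0 ℤ.- + 0 ℤ.+ a) ≡ ℤ.- + 1
        eq = solve-∀

  ∈sum-≤ : ∀ {n} {f : Vector Carrier n} → (∀ i → 0# ≤ f i) → ∀ i → f i ≤ sum f
  sum-nonNeg : ∀ {n} {f : Vector Carrier n} → (∀ i → 0# ≤ f i) → 0# ≤ sum f
  sum-nonNeg {zero}  0≤f = ≤-reflexive refl
  sum-nonNeg {suc n} 0≤f = nonNeg+nonNeg (0≤f zero) (sum-nonNeg (0≤f ∘ suc))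
  ∈sum-≤ {suc n} {f} 0≤f zero    = ≤-via (solve 2 (λ a b → b := a :+ b :- a) refl _ _)
    (sum-nonNeg (0≤f ∘ suc))
  ∈sum-≤ {suc n} {f} 0≤f (suc i) = ≤-trans (∈sum-≤ (0≤f ∘ suc) i)
    (≤-via (solve 2 (λ a b → a := a :+ b :- b) refl _ _) (0≤f zero))

  -- The equality case of the Cauchy-Schwarz inequality.
  roots-coincide : ∀ {β γ} → Φ β → Φ γ → fromℕ 2 ≤ ⟨ β , γ ⟩ → β ≈ᴹ γ
  roots-coincide {β} {γ} β∈Φ γ∈Φ 2≤βγ = ≈ᴹ-from-− (definite (≤-antisym
    (≤-via {e = fromℕ 2 * (⟨ β , γ ⟩ - fromℕ 2)}
      (sym (trans (+-congˡ (-‿cong expand))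
        (solve 1 (λ t → con (+ 0) :- (con (+ 4) :- con (+ 2) :* t) := con (+ 2) :* (t :- con (+ 2)))
        refl ⟨ β , γ ⟩)))
      (nonNeg*nonNeg (<⇒≤ (0<fromℕ-suc 1)) (≤⇒0≤- 2≤βγ)))
    (nonNeg _)))
    where
    expand : ⟨ β -ᴹ γ , β -ᴹ γ ⟩ ≈ fromℕ 4 - fromℕ 2 * ⟨ β , γ ⟩
    expand = trans (⟨⟩-−ˡ β γ _) (trans (+-cong (⟨⟩-−ʳ β β γ) (-‿cong (⟨⟩-−ʳ γ β γ)))
      (trans (+-cong (+-congʳ (normalised β∈Φ))
        (-‿cong (+-cong (⟨⟩-sym γ β) (-‿cong (normalised γ∈Φ)))))
        (solve 1 (λ t → con (+ 2) :- t :- (t :- con (+ 2)) := con (+ 4) :- con (+ 2) :* t) refl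
          ⟨ β , γ ⟩)))

  -- Let `a` and `b` be the first and last index in the support of `c`. The root `γ = α_a + … + α_b`
  -- pairs with `β` to `c a + c b`, which is at least 2, and two roots of squared length 2 with such
  -- a pairing coincide.
  positive-root : ∀ {β} (c : Vector ℕ k) → Φ β → β ≈ᴹ comb (λ i → fromℕ (c i)) α →
                  ∃₂ λ i j → i ≢ j × β ≈ᴹ σ j -ᴹ σ i
  positive-root {β} c β∈Φ β≈ with first-nonzero c | last-nonzero c
  ... | inj₁ c≡0 | _ = contradiction (≈ᴹ-trans β≈ (comb-0 c≡0)) (nonzero β∈Φ)
    where
    comb-0 : (∀ i → c i ≡ 0) → comb (λ i → fromℕ (c i)) α ≈ᴹ 0ᴹ
    comb-0 c≡0 = ⟨⟩-ext λ z → trans (⟨⟩-comb (λ i → fromℕ (c i)) α z)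
      (trans (sum-0 (λ i → trans (*-congʳ (reflexive (≡.cong fromℕ (c≡0 i)))) (zeroˡ _)))
        (sym (⟨⟩-0ˡ z)))
      where
      sum-0 : ∀ {n} {f : Vector Carrier n} → (∀ i → f i ≈ 0#) → sum f ≈ 0#
      sum-0 {zero}  f≈0 = refl
      sum-0 {suc n} f≈0 = trans (+-cong (f≈0 zero) (sum-0 (f≈0 ∘ suc))) (+-identityˡ 0#)
  ... | inj₂ (a , ca≢0 , _) | inj₁ c≡0 = contradiction (c≡0 a) ca≢0
  ... | inj₂ (a , ca≢0 , min) | inj₂ (b , cb≢0 , max) =
    inject₁ a , suc b , (λ eq → ℕ.<⇒≢ a<b+1 (≡.cong toℕ eq)) ,
    roots-coincide β∈Φ (σ-−∈Φ (inject₁ a) (suc b) a<b+1) 2≤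
    where
    a<b+1 : toℕ (inject₁ a) ℕ.< suc (toℕ b)
    a<b+1 = ℕ.s≤s (≡.subst (ℕ._≤ toℕ b) (≡.sym (Fin.toℕ-inject₁ a)) (min b cb≢0))
    γ = σ (suc b) -ᴹ σ (inject₁ a)
    weight : Fin k → Fin k → ℕ
    weight l i = c i ℕ.* χ (toℕ i) (toℕ l)

    coefficient : ∀ i → fromℕ (c i) * ⟨ α i , γ ⟩ ≈ fromℕ (weight a i) + fromℕ (weight b i)
    coefficient i = begin
      fromℕ (c i) * ⟨ α i , γ ⟩
        ≈⟨ *-congˡ (trans (⟨⟩-−ʳ _ _ _) (+-cong (⟨α,σ⟩ i (suc b)) (-‿cong (⟨α,σ⟩ i (inject₁ a))))) ⟩
      fromℤ (+ c i) * (fromℤ (pairing (toℕ i) (suc (toℕ b))) - fromℤ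
        (pairing (toℕ i) (toℕ (inject₁ a))))
        ≡⟨ ≡.cong (λ t → fromℤ (+ c i) *
          (fromℤ (pairing (toℕ i) (suc (toℕ b))) - fromℤ (pairing (toℕ i) t))) (Fin.toℕ-inject₁ a) ⟩
      fromℤ (+ c i) * (fromℤ (pairing (toℕ i) (suc (toℕ b))) - fromℤ (pairing (toℕ i) (toℕ a)))
        ≈⟨ *-congˡ (fromℤ-- (pairing (toℕ i) (suc (toℕ b))) (pairing (toℕ i) (toℕ a))) ⟨
      fromℤ (+ c i) * fromℤ (pairing (toℕ i) (suc (toℕ b)) ℤ.- pairing (toℕ i) (toℕ a))
        ≈⟨ fromℤ-* (+ c i) _ ⟨
      fromℤ (+ c i ℤ.* (pairing (toℕ i) (suc (toℕ b)) ℤ.- pairing (toℕ i) (toℕ a)))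
        ≡⟨ ≡.cong fromℤ (integral i) ⟩
      fromℤ (+ weight a i ℤ.+ + weight b i)
        ≈⟨ fromℤ-+ (+ weight a i) (+ weight b i) ⟩
      fromℕ (weight a i) + fromℕ (weight b i) ∎
      where
      open SetoidReasoning setoid
      integral : ∀ i → + c i ℤ.* (pairing (toℕ i) (suc (toℕ b)) ℤ.- pairing (toℕ i) (toℕ a)) ≡
                       + weight a i ℤ.+ + weight b i
      -- `γ` pairs negatively only with simple roots just outside the range from `a` to `b`, where
      -- the coefficient of `β` vanishes.
      integral i with c i ℕ.≟ 0
      ... | yes ci≡0 rewrite ci≡0 = ≡.refl
      ... | no ci≢0 rewrite χ-≢ {toℕ i} {suc (toℕ b)} (ℕ.<⇒≢ (ℕ.s≤s (max i ci≢0)))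
                          | χ-≢ {suc (toℕ i)} {toℕ a} (ℕ.>⇒≢ (ℕ.s≤s (min i ci≢0))) =
        ≡.trans (eq (+ c i) (+ χ (toℕ i) (toℕ b)) (+ χ (toℕ i) (toℕ a)) (+ χ (toℕ i) 0))
          (≡.sym (≡.cong₂ ℤ._+_ (ℤ.pos-* (c i) _) (ℤ.pos-* (c i) _)))
        where
        eq : ∀ c x y z → c ℤ.* ((x ℤ.- + 0 ℤ.+ z) ℤ.- (+ 0 ℤ.- y ℤ.+ z)) ≡ c ℤ.* y ℤ.+ c ℤ.* x
        eq = solve-∀

    βγ≈ : ⟨ β , γ ⟩ ≈ sum (λ i → fromℕ (weight a i)) + sum (λ i → fromℕ (weight b i))
    βγ≈ = trans (⟨⟩-congˡ β≈) (trans (⟨⟩-comb (λ i → fromℕ (c i)) α γ)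
      (trans (sum-cong-≋ {k} coefficient)
        (∑-distrib-+ {k} (λ i → fromℕ (weight a i)) (λ i → fromℕ (weight b i)))))

    1≤sum : ∀ l → c l ≢ 0 → fromℕ 1 ≤ sum (λ i → fromℕ (weight l i))
    1≤sum l cl≢0 = ≤-trans (fromℤ-mono-≤ {+ 1} {+ weight l l} (ℤ.+≤+ 1≤weight))
      (∈sum-≤ {k} {λ i → fromℕ (weight l i)} (λ i → fromℕ-nonNeg (weight l i)) l)
      where
      1≤weight : 1 ℕ.≤ weight l l
      1≤weight = ≡.subst (1 ℕ.≤_)
        (≡.sym (≡.trans (≡.cong (c l ℕ.*_) (χ-refl (toℕ l))) (ℕ.*-identityʳ (c l)))) (ℕ.n≢0⇒n>0 cl≢0)

    2≤ : fromℕ 2 ≤ ⟨ β , γ ⟩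
    2≤ = ≤-via (trans (solve 2 (λ x y → (x :- con (+ 1)) :+ (y :- con (+ 1)) := (x :+ y) :- con (+ 2))
      refl _ _) (+-congʳ (sym βγ≈)))
      (nonNeg+nonNeg (≤⇒0≤- (1≤sum a ca≢0)) (≤⇒0≤- (1≤sum b cb≢0)))

  root-classification : ∀ {β} → Φ β → ∃₂ λ i j → i ≢ j × β ≈ᴹ σ j -ᴹ σ i
  root-classification {β} β∈Φ with sameSign β∈Φ
  ... | c , inj₁ β≈ = positive-root c β∈Φ β≈
  ... | c , inj₂ β≈- =
    let i , j , i≢j , -β≈ = positive-root c (-ᴹ∈Φ β∈Φ) (⟨⟩-ext λ z → trans (⟨⟩--ˡ β z)
          (trans (-‿cong (trans (⟨⟩-congˡ β≈-) (⟨⟩--ˡ _ z))) (solve 1 (λ a → :- (:- a) := a) refl _)))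
    in  j , i , i≢j ∘ ≡.sym , ⟨⟩-ext λ z → begin
          ⟨ β , z ⟩               ≈⟨ solve 1 (λ a → a := :- (:- a)) refl _ ⟩
          - (- ⟨ β , z ⟩)         ≈⟨ -‿cong
            (trans (sym (⟨⟩--ˡ β z)) (trans (⟨⟩-congˡ -β≈) (⟨⟩-−ˡ _ _ z))) ⟩
          - (⟨ σ j , z ⟩ - ⟨ σ i , z ⟩) ≈⟨ solve 2 (λ a b → :- (a :- b) := b :- a) refl _ _ ⟩
          ⟨ σ i , z ⟩ - ⟨ σ j , z ⟩ ≈⟨ ⟨⟩-−ˡ _ _ z ⟨
          ⟨ σ i -ᴹ σ j , z ⟩      ∎
    where open SetoidReasoning setoid

  σ-difference∈Φ : ∀ {i j} → i ≢ j → Φ (σ i -ᴹ σ j)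
  σ-difference∈Φ {i} {j} i≢j with ℕ.<-cmp (toℕ i) (toℕ j)
  ... | tri≈ _ i≡j _ = contradiction (Fin.toℕ-injective i≡j) i≢j
  ... | tri> _ _ j<i = σ-−∈Φ j i j<i
  ... | tri< i<j _ _ = Φ-resp (⟨⟩-ext λ z → trans (⟨⟩--ˡ _ z) (trans (-‿cong (⟨⟩-−ˡ _ _ z))
    (trans (solve 2 (λ a b → :- (b :- a) := a :- b) refl _ _) (sym (⟨⟩-−ˡ _ _ z)))))
      (-ᴹ∈Φ (σ-−∈Φ i j i<j))

-- The map `ρ` in coordinates.

snoc : ∀ {a} {A : Set a} {n} → (Fin n → A) → A → Fin (suc n) → A
snoc {n = zero}  f a zero    = a
snoc {n = suc n} f a zero    = f zero
snoc {n = suc n} f a (suc i) = snoc (f ∘ suc) a i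

module _ {a} {A : Set a} where

  snoc-last : ∀ {n} (f : Fin n → A) a → snoc f a (last n) ≡ a
  snoc-last {zero}  f a = ≡.refl
  snoc-last {suc n} f a = snoc-last (f ∘ suc) a

  snoc-inject₁ : ∀ {n} (f : Fin n → A) a i → snoc f a (inject₁ i) ≡ f i
  snoc-inject₁ f a zero    = ≡.refl
  snoc-inject₁ f a (suc i) = snoc-inject₁ (f ∘ suc) a i

mod-last : ∀ n → suc (toℕ (last n)) mod suc n ≡ zero
mod-last n = Fin.toℕ-injective (≡.trans (Fin.toℕ-fromℕ< (m%n<n (suc (toℕ (last n))) (suc n)))
  (≡.trans (≡.cong (λ l → suc l % suc n) (Fin.toℕ-fromℕ n)) (n%n≡0 (suc n))))

mod-inject₁ : ∀ {n} (i : Fin n) → suc (toℕ (inject₁ i)) mod suc n ≡ suc i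
mod-inject₁ {n} i = Fin.toℕ-injective (≡.trans (Fin.toℕ-fromℕ< (m%n<n (suc (toℕ (inject₁ i))) (suc n)))
  (≡.trans (≡.cong (λ l → suc l % suc n) (Fin.toℕ-inject₁ i)) (m<n⇒m%n≡m (ℕ.s≤s (Fin.toℕ<n i)))))

module CyclicSymmetry {ℓ} {ℝ : Reals ℓ} (V : EuclideanSpace ℝ) {k : ℕ} (m : ℕ) .{{_ : ℕ.NonZero m}}
  (T : TypeA V (suc k)) where
  open Reals ℝ hiding (zero)
  open OrderedFieldProperties orderedField
  open EuclideanSpace V
  open EuclideanSpaceProperties V
  open TypeA T
  open Roots V T
  open CommutativeMonoidSum (CommutativeRing.+-commutativeMonoid ℝ-commutativeRing)
    using (sum-replicate-zero)

  private
    K : ℕ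
    K = suc k

    M : Carrier
    M = fromℕ m

    0<M : 0# < M
    0<M = fromℤ-mono-< {+ 0} {+ m} (ℤ.+<+ (ℕ.>-nonZero⁻¹ m))

    μ : Carrier
    μ = proj₁ (reciprocal 0<M)

    μM≈1 : μ * M ≈ 1#
    μM≈1 = proj₂ (proj₂ (reciprocal 0<M))

    kronecker : ∀ {n} → Carrier → Fin n → Fin n → Carrier
    kronecker a i j = if does (i Fin.≟ j) then a else 0#

    kronecker-refl : ∀ {n} a (i : Fin n) → kronecker a i i ≈ a
    kronecker-refl a i with i Fin.≟ i
    ... | yes _  = refl
    ... | no i≢i = contradiction ≡.refl i≢i

    kronecker-≢ : ∀ {n} a {i j : Fin n} → i ≢ j → kronecker a i j ≈ 0#
    kronecker-≢ a {i} {j} i≢j with i Fin.≟ j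
    ... | yes i≡j = contradiction i≡j i≢j
    ... | no _    = refl

    kronecker-inject₁ : ∀ {n} a (i j : Fin n) → kronecker a (inject₁ i) (inject₁ j) ≈ kronecker a i j
    kronecker-inject₁ a i j with i Fin.≟ j
    ... | yes ≡.refl = kronecker-refl a (inject₁ i)
    ... | no i≢j     = kronecker-≢ a (i≢j ∘ Fin.inject₁-injective)

    sum-kronecker : ∀ {n} (f : Vector Carrier n) a j → sum (λ i → f i * kronecker a i j) ≈ f j * a
    sum-kronecker {suc n} f a zero = trans
      (+-congˡ (trans (sum-cong-≋ {n} λ i → zeroʳ (f (suc i))) (sum-replicate-zero n)))
      (+-identityʳ _)
    sum-kronecker {suc n} f a (suc j) = trans
      (+-cong (zeroʳ (f zero)) (sum-kronecker (f ∘ suc) a j))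
      (+-identityˡ _)

  α-determine : ∀ {x y} → (∀ j → ⟨ α j , x ⟩ ≈ ⟨ α j , y ⟩) → x ≈ᴹ y
  α-determine {x} {y} eq = ⟨⟩-ext λ z →
    let c , z≈ = AreSimpleRoots.spanning simple z
        expand : ∀ u → ⟨ u , z ⟩ ≈ sum (λ i → c i * ⟨ α i , u ⟩)
        expand u = trans (⟨⟩-sym u z) (trans (⟨⟩-congˡ z≈) (⟨⟩-comb c α u))
    in  trans (expand x) (trans (sum-cong-≋ {K} (λ i → *-congˡ {c i} (eq i))) (sym (expand y)))

  ⟨α⟩-σ : ∀ i x → ⟨ α i , x ⟩ ≈ ⟨ σ (suc i) , x ⟩ - ⟨ σ (inject₁ i) , x ⟩
  ⟨α⟩-σ i x = trans (solve 2 (λ a b → a := b :+ a :- b) refl ⟨ α i , x ⟩ ⟨ σ (inject₁ i) , x ⟩)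
    (+-congʳ (sym (trans (⟨⟩-congˡ (partial-suc α i)) (⟨⟩-+ˡ _ _ x))))

  module _ {v : Vector Carrierᴹ (suc K)} (isVertices : AreVertices m v) where
    open AreVertices isVertices

    private
      basis : (Fin K → Carrier) → Carrierᴹ
      basis c = comb (λ i → μ * c i) (v ∘ suc)

    -- Divided by `m`, the vertices other than 0 form the basis dual to `α`.
    realise : ∀ c → ∃ λ x → ∀ j → ⟨ α j , x ⟩ ≈ c j
    realise c = basis c , λ j → begin
      ⟨ α j , basis c ⟩
        ≈⟨ trans (⟨⟩-sym _ _) (⟨⟩-comb (λ i → μ * c i) (v ∘ suc) (α j)) ⟩
      sum (λ i → μ * c i * ⟨ v (suc i) , α j ⟩)
        ≈⟨ sum-cong-≋ {K} (λ i → *-congˡ {μ * c i} (trans (⟨⟩-sym _ _) (vᵢ₊₁ j i))) ⟩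
      sum (λ i → μ * c i * kronecker M i j)
        ≈⟨ sum-kronecker (λ i → μ * c i) M j ⟩
      μ * c j * M
        ≈⟨ solve 3 (λ a b c → a :* b :* c := a :* c :* b) refl μ (c j) M ⟩
      μ * M * c j
        ≈⟨ trans (*-congʳ μM≈1) (*-identityˡ _) ⟩
      c j ∎
      where open SetoidReasoning setoid

    realise-σ : ∀ (s : Fin (suc K) → Carrier) → ∃ λ x → ∀ j → ⟨ σ j , x ⟩ ≈ s j - s zero
    realise-σ s =
      let x , ⟨α⟩≈ = realise (λ i → s (suc i) - s (inject₁ i))
      in  x , <-weakInduction (λ j → ⟨ σ j , x ⟩ ≈ s j - s zero)
            (trans (⟨⟩-0ˡ x) (sym (-‿inverseʳ _)))
            λ i IH → trans (⟨⟩-congˡ (partial-suc α i)) (trans (⟨⟩-+ˡ _ _ x)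
              (trans (+-cong IH (⟨α⟩≈ i))
                (solve 3 (λ a b c → a :- c :+ (b :- a) := b :- c) refl (s (inject₁ i)) (s (suc i))
                  (s zero))))

  module _ {v ρ} (isCyclic : IsCyclicSymmetry m v ρ) where
    open IsCyclicSymmetry isCyclic
    open AreVertices vertices
    open IsAffine affine
    open LeftModuleMorphisms rawLeftModule rawLeftModule using (module IsLeftModuleHomomorphism)
    open IsLeftModuleHomomorphism isLinear using (⟦⟧-cong; +ᴹ-homo; 0ᴹ-homo; *ₗ-homo)

    private
      L : Carrierᴹ → Carrierᴹ
      L = linearPart

      L-comb : ∀ {n} (c : Vector Carrier n) u → L (comb c u) ≈ᴹ comb c (L ∘ u)
      L-comb {zero}  c u = 0ᴹ-homo
      L-comb {suc n} c u = ≈ᴹ-trans (+ᴹ-homo _ _) (+ᴹ-cong (*ₗ-homo _ _) (L-comb (c ∘ suc) (u ∘ suc)))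

      cycles-inject₁ : ∀ i → ρ (v (inject₁ i)) ≈ᴹ v (suc i)
      cycles-inject₁ i = ≈ᴹ-trans (cycles (inject₁ i)) (≈ᴹ-reflexive (≡.cong v (mod-inject₁ i)))

      cycles-last : ρ (v (last K)) ≈ᴹ v zero
      cycles-last = ≈ᴹ-trans (cycles (last K)) (≈ᴹ-reflexive (≡.cong v (mod-last K)))

      τ≈v₁ : translation ≈ᴹ v (suc zero)
      τ≈v₁ = ≈ᴹ-trans (≈ᴹ-sym (+ᴹ-identityˡ _))
        (≈ᴹ-trans (+ᴹ-congʳ (≈ᴹ-sym (≈ᴹ-trans (⟦⟧-cong v₀) 0ᴹ-homo)))
        (≈ᴹ-trans (≈ᴹ-sym (decomposition (v zero))) (cycles-inject₁ zero)))

      ⟨α,ρ⟩ : ∀ j x → ⟨ α j , ρ x ⟩ ≈ ⟨ α j , L x ⟩ + ⟨ α j , v (suc zero) ⟩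
      ⟨α,ρ⟩ j x = trans (⟨⟩-congʳ (≈ᴹ-trans (decomposition x) (+ᴹ-congˡ τ≈v₁))) (⟨⟩-+ʳ _ _ _)

      ⟨α,Lv⟩ : ∀ j i → ⟨ α j , L (v i) ⟩ ≈ ⟨ α j , ρ (v i) ⟩ - ⟨ α j , v (suc zero) ⟩
      ⟨α,Lv⟩ j i = trans (solve 2 (λ a b → a := a :+ b :- b) refl _ ⟨ α j , v (suc zero) ⟩)
        (+-congʳ (sym (⟨α,ρ⟩ j (v i))))

      coordinates : ∀ x → x ≈ᴹ comb (λ i → μ * ⟨ α i , x ⟩) (v ∘ suc)
      coordinates x = α-determine λ j → sym (proj₂ (realise vertices (λ i → ⟨ α i , x ⟩)) j)

      ⟨α,L⟩ : ∀ j x → ⟨ α j , L x ⟩ ≈ sum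
        (λ i → μ * ⟨ α i , x ⟩ * (⟨ α j , ρ (v (suc i)) ⟩ - ⟨ α j , v (suc zero) ⟩))
      ⟨α,L⟩ j x = trans (⟨⟩-congʳ
        (≈ᴹ-trans (⟦⟧-cong (coordinates x)) (L-comb (λ i → μ * ⟨ α i , x ⟩) (v ∘ suc))))
        (trans (⟨⟩-sym _ _) (trans (⟨⟩-comb (λ i → μ * ⟨ α i , x ⟩) (L ∘ v ∘ suc) (α j))
          (sum-cong-≋ {K} (λ i → *-congˡ {μ * ⟨ α i , x ⟩} (trans (⟨⟩-sym _ _) (⟨α,Lv⟩ j (suc i)))))))

      ⟨α,0⟩ : ∀ j → ⟨ α j , v zero ⟩ ≈ 0#
      ⟨α,0⟩ j = trans (⟨⟩-congʳ v₀) (trans (⟨⟩-sym _ _) (⟨⟩-0ˡ _))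

      ⟨α₁,ρv⟩ : ∀ i → ⟨ α zero , ρ (v (suc i)) ⟩ ≈ 0#
      ⟨α₁,ρv⟩ i with view i
      ... | ‵fromℕ     = trans (⟨⟩-congʳ cycles-last) (⟨α,0⟩ zero)
      ... | ‵inject₁ l = trans (⟨⟩-congʳ (cycles-inject₁ (suc l))) (vᵢ₊₁ zero (suc l))

      ⟨αⱼ,ρv⟩ : ∀ j i → ⟨ α (suc j) , ρ (v (suc i)) ⟩ ≈ kronecker M i (inject₁ j)
      ⟨αⱼ,ρv⟩ j i with view i
      ... | ‵fromℕ     = trans (trans (⟨⟩-congʳ cycles-last) (⟨α,0⟩ (suc j)))
        (sym (kronecker-≢ M {last k} {inject₁ j} Fin.fromℕ≢inject₁))
      ... | ‵inject₁ l = trans (trans (⟨⟩-congʳ (cycles-inject₁ (suc l))) (vᵢ₊₁ (suc j) (suc l)))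
        (sym (kronecker-inject₁ M l j))

    -- The value is `m + ⟨ α₀ , x ⟩`; with `⟨αⱼ,ρ⟩` it expresses that the linear part of `ρ`
    -- permutes the `αᵢ` and `α₀` cyclically. Both follow by expanding `x` in the vertices, whose
    -- images are given.
    ⟨α₁,ρ⟩ : ∀ x → ⟨ α zero , ρ x ⟩ ≈ M - ⟨ σ (last K) , x ⟩
    ⟨α₁,ρ⟩ x = begin
      ⟨ α zero , ρ x ⟩
        ≈⟨ trans (⟨α,ρ⟩ zero x) (+-cong (⟨α,L⟩ zero x) (vᵢ₊₁ zero zero)) ⟩
      sum (λ i → μ * ⟨ α i , x ⟩ * (⟨ α zero , ρ (v (suc i)) ⟩ - ⟨ α zero , v (suc zero) ⟩)) + M
        ≈⟨ +-congʳ (sum-cong-≋ {K}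
          (λ i → trans (*-congˡ {μ * ⟨ α i , x ⟩} (+-cong (⟨α₁,ρv⟩ i) (-‿cong (vᵢ₊₁ zero zero))))
             (trans (solve 3 (λ a b c → a :* b :* (con (+ 0) :- c) := a :* c :* (:- b)) refl μ
               ⟨ α i , x ⟩ M)
               (trans (*-congʳ μM≈1) (trans (*-identityˡ _) (sym (⟨⟩--ˡ (α i) x))))))) ⟩
      sum (λ i → ⟨ -ᴹ α i , x ⟩) + M
        ≈⟨ +-congʳ (trans (sum-neg (λ i → ⟨ α i , x ⟩) (λ i → ⟨⟩--ˡ (α i) x))
          (-‿cong (sym (trans (⟨⟩-congˡ (partial-last α)) (⟨⟩-∑ˡ α x))))) ⟩
      - ⟨ σ (last K) , x ⟩ + M
        ≈⟨ +-comm _ _ ⟩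
      M - ⟨ σ (last K) , x ⟩ ∎
      where
      open SetoidReasoning setoid
      sum-neg : ∀ {n} (f : Vector Carrier n) {g} → (∀ i → g i ≈ - f i) → sum g ≈ - sum f
      sum-neg {zero}  f eq = solve 0 (con (+ 0) := :- con (+ 0)) refl
      sum-neg {suc n} f eq = trans (+-cong (eq zero) (sum-neg (f ∘ suc) (eq ∘ suc)))
        (solve 2 (λ a b → :- a :+ :- b := :- (a :+ b)) refl _ _)

    ⟨αⱼ,ρ⟩ : ∀ j x → ⟨ α (suc j) , ρ x ⟩ ≈ ⟨ α (inject₁ j) , x ⟩
    ⟨αⱼ,ρ⟩ j x = begin
      ⟨ α (suc j) , ρ x ⟩
        ≈⟨ trans (⟨α,ρ⟩ (suc j) x) (+-cong (⟨α,L⟩ (suc j) x) (vᵢ₊₁ (suc j) zero)) ⟩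
      sum (λ i → μ * ⟨ α i , x ⟩ * (⟨ α (suc j) , ρ (v (suc i)) ⟩ - ⟨ α (suc j) , v (suc zero) ⟩)) + 0#
        ≈⟨ trans (+-identityʳ _) (sum-cong-≋ {K}
          (λ i → *-congˡ {μ * ⟨ α i , x ⟩} (trans (+-cong (⟨αⱼ,ρv⟩ j i) (-‿cong (vᵢ₊₁ (suc j) zero)))
             (solve 1 (λ a → a :- con (+ 0) := a) refl _)))) ⟩
      sum (λ i → μ * ⟨ α i , x ⟩ * kronecker M i (inject₁ j))
        ≈⟨ sum-kronecker (λ i → μ * ⟨ α i , x ⟩) M (inject₁ j) ⟩
      μ * ⟨ α (inject₁ j) , x ⟩ * M
        ≈⟨ solve 3 (λ a b c → a :* b :* c := a :* c :* b) refl μ _ M ⟩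
      μ * M * ⟨ α (inject₁ j) , x ⟩
        ≈⟨ trans (*-congʳ μM≈1) (*-identityˡ _) ⟩
      ⟨ α (inject₁ j) , x ⟩ ∎
      where open SetoidReasoning setoid

    -- The previous two formulas telescope: `ρ` moves the coordinates by one place, up to a summand
    -- common to all of them that drops out of differences.
    ⟨σ,ρ⟩ : ∀ x j → ⟨ σ (suc j) , ρ x ⟩ ≈ M - ⟨ σ (last K) , x ⟩ + ⟨ σ (inject₁ j) , x ⟩
    ⟨σ,ρ⟩ x = <-weakInduction (λ j → ⟨ σ (suc j) , ρ x ⟩ ≈ M - ⟨ σ (last K) , x ⟩ +
      ⟨ σ (inject₁ j) , x ⟩)
      (trans (⟨⟩-+ˡ _ _ _) (trans (+-cong (⟨α₁,ρ⟩ x) (⟨⟩-0ˡ _)) (+-congˡ (sym (⟨⟩-0ˡ x)))))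
      λ j IH → begin
        ⟨ σ (suc (suc j)) , ρ x ⟩
          ≈⟨ trans (⟨⟩-congˡ (partial-suc α (suc j))) (⟨⟩-+ˡ _ _ _) ⟩
        ⟨ σ (suc (inject₁ j)) , ρ x ⟩ + ⟨ α (suc j) , ρ x ⟩
          ≈⟨ +-cong IH (⟨αⱼ,ρ⟩ j x) ⟩
        M - ⟨ σ (last K) , x ⟩ + ⟨ σ (inject₁ (inject₁ j)) , x ⟩ + ⟨ α (inject₁ j) , x ⟩
          ≈⟨ trans (+-assoc _ _ _) (+-congˡ
            (sym (trans (⟨⟩-congˡ (partial-suc α (inject₁ j))) (⟨⟩-+ˡ _ _ _)))) ⟩
        M - ⟨ σ (last K) , x ⟩ + ⟨ σ (inject₁ (suc j)) , x ⟩ ∎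
      where open SetoidReasoning setoid

    ρ-surjective : ∀ y → ∃ λ z → ρ z ≈ᴹ y
    ρ-surjective y =
      -- The coordinates of `y` moved back by one place. The last entry `M` is the coordinate
      -- `⟨ σ zero , y ⟩ = 0` raised by the period `m`.
      let s = snoc (λ i → ⟨ σ (suc i) , y ⟩) M
          z , ⟨σ,z⟩ = realise-σ vertices s
          σ-eq : ∀ i → ⟨ σ (suc i) , ρ z ⟩ ≈ ⟨ σ (suc i) , y ⟩
          σ-eq i = trans (⟨σ,ρ⟩ z i)
            (trans (+-cong (+-congˡ (-‿cong (⟨σ,z⟩ (last K)))) (⟨σ,z⟩ (inject₁ i)))
            (trans (+-cong (+-congˡ (-‿cong
              (+-congʳ (reflexive (snoc-last (λ i → ⟨ σ (suc i) , y ⟩) M)))))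
              (+-congʳ (reflexive (snoc-inject₁ (λ i → ⟨ σ (suc i) , y ⟩) M i))))
              (solve 3 (λ a b c → a :- (a :- b) :+ (c :- b) := c) refl M (s zero) _)))
          σ-eq′ : ∀ j → ⟨ σ j , ρ z ⟩ ≈ ⟨ σ j , y ⟩
          σ-eq′ = λ { zero → trans (⟨⟩-0ˡ _) (sym (⟨⟩-0ˡ _)) ; (suc i) → σ-eq i }
      in  z , α-determine λ j → trans (⟨α⟩-σ j (ρ z))
            (trans (+-cong (σ-eq′ (suc j)) (-‿cong (σ-eq′ (inject₁ j)))) (sym (⟨α⟩-σ j y)))

-- The sum condition on words, as an integer equation.

module Words {N m : ℕ} .{{_ : ℕ.NonZero m}} where

  total-tabulate : ∀ {n} (w : Fin n → Fin m) → + total (tabulate w) ≡ sumℤ (λ i → + toℕ (w i))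
  total-tabulate {zero}  w = ≡.refl
  total-tabulate {suc n} w = ≡.cong (ℤ._+_ (+ toℕ (w zero))) (total-tabulate (w ∘ suc))

  private
    residue-sum : ∀ n → + n ≡ + toℕ (fromℕ< (m%n<n n m)) ℤ.+ + (n / m) ℤ.* + m
    residue-sum n = ≡.trans (≡.cong +_ (m≡m%n+[m/n]*n n m)) (≡.cong₂ ℤ._+_
      (≡.cong +_ (≡.sym (Fin.toℕ-fromℕ< (m%n<n n m)))) (ℤ.pos-* (n / m) m))

  sum⇒InW : ∀ (w : Fin N → Fin m) J → 1ℤ ℤ.+ sumℤ (λ i → + toℕ (w i)) ≡ + m ℤ.* J → InW m (tabulate w)
  sum⇒InW w J Σ≡ = ≡.trans (≡.sym (Fin.toℕ-fromℕ< (m%n<n S m)))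
    (≡.trans (≡.cong toℕ (toℕ-mod-injective {y = + (S / m)} {+ ((m ℕ.∸ 1) / m) ℤ.+ (J ℤ.- 1ℤ)} (begin
      + toℕ (fromℕ< (m%n<n S m)) ℤ.+ + (S / m) ℤ.* + m
        ≡⟨ residue-sum S ⟨
      + S
        ≡⟨ ≡-transfer (≡.trans (≡.cong (ℤ._+_ 1ℤ) (total-tabulate w)) Σ≡) (eq (+ S) (+ m) J) ⟩
      + m ℤ.- 1ℤ ℤ.+ (J ℤ.- 1ℤ) ℤ.* + m
        ≡⟨ ≡.cong (λ l → l ℤ.+ (J ℤ.- 1ℤ) ℤ.* + m) (≡.trans pred≡ (residue-sum (m ℕ.∸ 1))) ⟩
      + toℕ (fromℕ< (m%n<n (m ℕ.∸ 1) m)) ℤ.+ + ((m ℕ.∸ 1) / m) ℤ.* + m ℤ.+ (J ℤ.- 1ℤ) ℤ.* + m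
        ≡⟨ eq′ (+ toℕ (fromℕ< (m%n<n (m ℕ.∸ 1) m))) (+ ((m ℕ.∸ 1) / m)) (+ m) J ⟩
      + toℕ (fromℕ< (m%n<n (m ℕ.∸ 1) m)) ℤ.+ (+ ((m ℕ.∸ 1) / m) ℤ.+ (J ℤ.- 1ℤ)) ℤ.* + m ∎)))
    (Fin.toℕ-fromℕ< (m%n<n (m ℕ.∸ 1) m)))
    where
    open ≡.≡-Reasoning
    S = total (tabulate w)
    eq : ∀ s m j → m ℤ.* j ℤ.- (1ℤ ℤ.+ s) ≡ m ℤ.- 1ℤ ℤ.+ (j ℤ.- 1ℤ) ℤ.* m ℤ.- s
    eq = solve-∀
    eq′ : ∀ r q m j → r ℤ.+ q ℤ.* m ℤ.+ (j ℤ.- 1ℤ) ℤ.* m ≡ r ℤ.+ (q ℤ.+ (j ℤ.- 1ℤ)) ℤ.* m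
    eq′ = solve-∀
    pred≡ : + m ℤ.- 1ℤ ≡ + (m ℕ.∸ 1)
    pred≡ = ≡.trans (≡.cong (λ l → + l ℤ.- 1ℤ) (≡.sym (ℕ.suc-pred m))) (eq″ (+ (m ℕ.∸ 1)))
      where
      eq″ : ∀ a → 1ℤ ℤ.+ a ℤ.- 1ℤ ≡ a
      eq″ = solve-∀

  InW⇒sum : ∀ (u : Vec (Fin m) N) → InW m u → ∃ λ J → 1ℤ ℤ.+ sumℤ (λ i → + toℕ (lookup u i)) ≡ + m ℤ.* J
  InW⇒sum u u∈W = 1ℤ ℤ.+ + (S / m) , (begin
    1ℤ ℤ.+ sumℤ (λ i → + toℕ (lookup u i))
      ≡⟨ ≡.cong (ℤ._+_ 1ℤ) (≡.trans (≡.sym (total-tabulate (lookup u)))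
        (≡.cong (λ u → + total u) (tabulate∘lookup u))) ⟩
    1ℤ ℤ.+ + S
      ≡⟨ ≡.cong (λ l → 1ℤ ℤ.+ + l)
        (≡.trans (m≡m%n+[m/n]*n S m) (≡.cong (ℕ._+ S / m ℕ.* m) (≡.trans u∈W (m<n⇒m%n≡m pred<)))) ⟩
    + (suc (m ℕ.∸ 1) ℕ.+ S / m ℕ.* m)
      ≡⟨ ≡.cong (λ l → + (l ℕ.+ S / m ℕ.* m)) (ℕ.suc-pred m) ⟩
    + (m ℕ.+ S / m ℕ.* m)
      ≡⟨ ≡.cong (ℤ._+_ (+ m)) (ℤ.pos-* (S / m) m) ⟩
    + m ℤ.+ + (S / m) ℤ.* + m
      ≡⟨ eq (+ m) (+ (S / m)) ⟩
    + m ℤ.* (1ℤ ℤ.+ + (S / m)) ∎)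
    where
    open ≡.≡-Reasoning
    S = total u
    pred< : m ℕ.∸ 1 ℕ.< m
    pred< = ≡.subst (m ℕ.∸ 1 ℕ.<_) (ℕ.suc-pred m) (ℕ.n<1+n (m ℕ.∸ 1))
    eq : ∀ m q → m ℤ.+ q ℤ.* m ≡ m ℤ.* (1ℤ ℤ.+ q)
    eq = solve-∀

-- The bijection between alcoves and words, and its equivariance.

tabulate-∷ʳ : ∀ {a} {A : Set a} {n} (f : Fin (suc n) → A) →
              tabulate f ≡ tabulate (f ∘ inject₁) ∷ʳ f (last n)
tabulate-∷ʳ {n = zero}  f = ≡.refl
tabulate-∷ʳ {n = suc n} f = ≡.cong (f zero ∷_) (tabulate-∷ʳ (f ∘ suc))

opposite-inject₁ : ∀ {n} (i : Fin n) → opposite (inject₁ i) ≡ suc (opposite i)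
opposite-inject₁ zero    = ≡.refl
opposite-inject₁ (suc i) = ≡.cong inject₁ (opposite-inject₁ i)

opposite-last : ∀ n → opposite (last n) ≡ zero
opposite-last zero    = ≡.refl
opposite-last (suc n) = ≡.cong inject₁ (opposite-last n)

opposite-injective : ∀ {n} → Injective _≡_ _≡_ (opposite {n})
opposite-injective {n} {i} {j} eq = ≡.trans (≡.sym (Fin.opposite-involutive i))
  (≡.trans (≡.cong opposite eq) (Fin.opposite-involutive j))

opposite-anti : ∀ {n} {i j : Fin n} → toℕ i ℕ.≤ toℕ j → toℕ (opposite j) ℕ.≤ toℕ (opposite i)
opposite-anti {n} {i} {j} i≤j = ≡.subst₂ ℕ._≤_ (≡.sym (Fin.opposite-prop j))
  (≡.sym (Fin.opposite-prop i))
  (ℕ.∸-monoʳ-≤ n (ℕ.s≤s i≤j))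

module AlcoveWords {ℓ} {ℝ : Reals ℓ} (V : EuclideanSpace ℝ) {k : ℕ} (m : ℕ) .{{_ : ℕ.NonZero m}}
  (T : TypeA V (suc k)) where
  open Reals ℝ hiding (zero)
  open OrderedFieldProperties orderedField
  open EuclideanSpace V
  open EuclideanSpaceProperties V
  open TypeA T
  open Roots V T
  open CyclicSymmetry V m T

  private
    K N : ℕ
    K = suc k
    N = suc K

  -- Reversed, so that ρ acts on the indices as the left rotation.
  r : Fin N → Carrierᴹ
  r j = -ᴹ σ (opposite j)

  ⟨r⟩ : ∀ j x → ⟨ r j , x ⟩ ≈ - ⟨ σ (opposite j) , x ⟩
  ⟨r⟩ j x = ⟨⟩--ˡ (σ (opposite j)) x

  r-− : ∀ i j → r i -ᴹ r j ≈ᴹ σ (opposite j) -ᴹ σ (opposite i)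
  r-− i j = ⟨⟩-ext λ z → trans (⟨⟩-−ˡ _ _ z) (trans (+-cong (⟨r⟩ i z) (-‿cong (⟨r⟩ j z)))
    (trans (solve 2 (λ a b → :- a :- :- b := b :- a) refl _ _) (sym (⟨⟩-−ˡ _ _ z))))

  difference∈Φ : ∀ {i j} → i ≢ j → Φ (r i -ᴹ r j)
  difference∈Φ {i} {j} i≢j = Φ-resp (≈ᴹ-sym (r-− i j))
    (σ-difference∈Φ (i≢j ∘ ≡.sym ∘ opposite-injective))

  ∈Φ⇒difference : ∀ {β} → Φ β → ∃₂ λ i j → i ≢ j × β ≈ᴹ r i -ᴹ r j
  ∈Φ⇒difference β∈Φ =
    let i , j , i≢j , β≈ = root-classification β∈Φ
    in  opposite i , opposite j , i≢j ∘ opposite-injective , ≈ᴹ-trans β≈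
          (≈ᴹ-sym (≈ᴹ-trans (r-− (opposite i) (opposite j))
          (≈ᴹ-reflexive (≡.cong₂ (λ i j → σ j -ᴹ σ i) (Fin.opposite-involutive i)
            (Fin.opposite-involutive j)))))

  open Alcoves.Regions V T r difference∈Φ ∈Φ⇒difference

  gap-opposite : ∀ i j x → gap (opposite i) (opposite j) x ≈ ⟨ σ j , x ⟩ - ⟨ σ i , x ⟩
  gap-opposite i j x = trans (+-cong (⟨r⟩ (opposite i) x) (-‿cong (⟨r⟩ (opposite j) x)))
    (trans (solve 2 (λ a b → :- a :- :- b := b :- a) refl _ _)
      (reflexive (≡.cong₂ (λ i j → ⟨ σ j , x ⟩ - ⟨ σ i , x ⟩) (Fin.opposite-involutive i)
        (Fin.opposite-involutive j))))

  ⟨-α₀,⟩ : ∀ x → ⟨ -ᴹ α₀ , x ⟩ ≈ ⟨ σ (last K) , x ⟩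
  ⟨-α₀,⟩ x = trans (⟨⟩--ˡ _ x) (trans (-‿cong (⟨⟩--ˡ _ x))
    (trans (solve 1 (λ a → :- (:- a) := a) refl _) (sym (⟨⟩-congˡ (partial-last α)))))

  module _ {x} (x∈Δ : DilatedSimplex m x) where

    σ-mono : ∀ i j → toℕ i ℕ.≤ toℕ j → ⟨ σ i , x ⟩ ≤ ⟨ σ j , x ⟩
    σ-mono i = <-weakInduction (λ j → toℕ i ℕ.≤ toℕ j → ⟨ σ i , x ⟩ ≤ ⟨ σ j , x ⟩)
      (λ i≤0 → ≤-reflexive (reflexive
        (≡.cong (λ i → ⟨ σ i , x ⟩) (Fin.toℕ-injective {j = zero} (ℕ.n≤0⇒n≡0 i≤0)))))
      step
      where
      step : ∀ j → (toℕ i ℕ.≤ toℕ (inject₁ j) → ⟨ σ i , x ⟩ ≤ ⟨ σ (inject₁ j) , x ⟩) →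
             toℕ i ℕ.≤ suc (toℕ j) → ⟨ σ i , x ⟩ ≤ ⟨ σ (suc j) , x ⟩
      step j IH i≤ with ℕ.m≤n⇒m<n∨m≡n i≤
      ... | inj₂ i≡ = ≤-reflexive
        (reflexive (≡.cong (λ i → ⟨ σ i , x ⟩) (Fin.toℕ-injective {j = suc j} i≡)))
      ... | inj₁ i< = ≤-trans (IH (≡.subst (toℕ i ℕ.≤_) (≡.sym (Fin.toℕ-inject₁ j)) (ℕ.s≤s⁻¹ i<)))
        (≤-via (⟨α⟩-σ j x) (proj₁ x∈Δ j))

    σ-nonNeg : ∀ j → 0# ≤ ⟨ σ j , x ⟩
    σ-nonNeg j = ≤-trans (≤-reflexive (sym (⟨⟩-0ˡ x))) (σ-mono zero j ℕ.z≤n)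

    σ-≤ : ∀ j → ⟨ σ j , x ⟩ ≤ fromℕ m
    σ-≤ j = ≤-trans (σ-mono j (last K)
      (≡.subst (toℕ j ℕ.≤_) (≡.sym (Fin.toℕ-fromℕ K)) (ℕ.s≤s⁻¹ (Fin.toℕ<n j))))
      (≤-trans (≤-reflexive (sym (⟨-α₀,⟩ x))) (proj₂ x∈Δ))

    simplex⇒dilation : ∀ {q} → IsAddress q → Region q x → InDilation m q
    simplex⇒dilation {q} isA x∈R = record
      { increasing = λ {i} {j} i≤j → below j i (≤-via
          (trans (solve 2 (λ a b → b :- a := :- a :- :- b :- con (+ 0)) refl _ _)
            (+-congʳ (sym (+-cong (⟨r⟩ j x) (-‿cong (⟨r⟩ i x))))))
          (≤⇒0≤- (σ-mono (opposite j) (opposite i) (opposite-anti i≤j))))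
      ; bounded = λ i j → below i j (≤-via
          (trans (solve 3 (λ a b m → b :+ (m :- a) := :- a :- :- b :- :- m) refl _ _ (fromℕ m))
            (+-cong (sym (+-cong (⟨r⟩ i x) (-‿cong (⟨r⟩ j x)))) (-‿cong (sym (fromℤ-neg (+ m))))))
          (nonNeg+nonNeg (σ-nonNeg (opposite j)) (≤⇒0≤- (σ-≤ (opposite i)))))
      }
      where
      below : ∀ i j {z} → fromℤ z ≤ gap i j x → z ℤ.≤ q i j
      below i j z≤ = <+1⇒≤ (fromℤ-cancel-< (≤-<-trans z≤ (upper (region⇒floor isA x∈R i j))))

  dilation⇒simplex : ∀ {q x} → InDilation m q → Region q x → DilatedSimplex m x
  dilation⇒simplex {q} {x} inD x∈R =
    (λ i → <⇒≤ (<-respʳ-≈ (sym (⟨α⟩-σ i x)) (between (inject₁ i) (suc i) (i≢ i)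
      (increasing (opposite-anti {i = inject₁ i} {suc i}
        (≡.subst (ℕ._≤ suc (toℕ i)) (≡.sym (Fin.toℕ-inject₁ i)) (ℕ.n≤1+n (toℕ i)))))))) ,
    <⇒≤ (<-via
      (trans (+-cong (+-cong (⟨⟩-0ˡ x) refl) (-‿cong (fromℤ-neg (+ m))))
        (trans (solve 2 (λ s m → con (+ 0) :- s :- :- m := m :- s) refl ⟨ σ (last K) , x ⟩ (fromℕ m))
          (+-congˡ (-‿cong (sym ⟨-α₀⟩)))))
      (<⇒0<- (between (last K) zero (λ ()) (bounded (opposite (last K)) (opposite zero)))))
    where
    open InDilation inD
    ⟨-α₀⟩ : ⟨ -ᴹ α₀ , x ⟩ ≈ ⟨ σ (last K) , x ⟩
    ⟨-α₀⟩ = ⟨-α₀,⟩ x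
    i≢ : ∀ i → inject₁ i ≢ suc i
    i≢ i eq = ℕ.<⇒≢ (ℕ.n<1+n (toℕ i)) (≡.trans (≡.sym (Fin.toℕ-inject₁ i)) (≡.cong toℕ eq))
    between : ∀ i j {z} → i ≢ j → z ℤ.≤ q (opposite i) (opposite j) → fromℤ z < ⟨ σ j , x ⟩ -
      ⟨ σ i , x ⟩
    between i j i≢j z≤q = <-respʳ-≈ (gap-opposite i j x)
      (≤-<-trans (fromℤ-mono-≤ z≤q) (x∈R (i≢j ∘ opposite-injective)))

  -- Under `ρ`, index `i` receives the coordinate of index `p i`, up to a common summand. The last
  -- index receives that of index 0 raised by the period `m`, which `δ` records.
  p : Fin N → Fin N
  p = snoc suc zero

  δ : Fin N → ℤ
  δ = snoc (λ _ → 0ℤ) 1ℤ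

  p-last : p (last K) ≡ zero
  p-last = snoc-last {n = K} suc zero

  p-inject₁ : ∀ i → p (inject₁ i) ≡ suc i
  p-inject₁ = snoc-inject₁ {n = K} suc zero

  p-injective : Injective _≡_ _≡_ p
  p-injective {i} {j} eq with view i | view j
  ... | ‵fromℕ     | ‵fromℕ     = ≡.refl
  ... | ‵fromℕ     | ‵inject₁ j = contradiction (≡.trans (≡.sym p-last) (≡.trans eq (p-inject₁ j))) λ ()
  ... | ‵inject₁ i | ‵fromℕ     = contradiction (≡.trans (≡.sym (p-inject₁ i)) (≡.trans eq p-last)) λ ()
  ... | ‵inject₁ i | ‵inject₁ j = ≡.cong inject₁ (Fin.suc-injective
        (≡.trans (≡.sym (p-inject₁ i)) (≡.trans eq (p-inject₁ j))))

  rotate-tabulate : ∀ (w : Fin N → Fin m) (w∈W : InW m (tabulate w)) →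
                    proj₁ (rotate (tabulate w , w∈W)) ≡ tabulate (w ∘ p)
  rotate-tabulate w _ = ≡.sym (≡.trans (tabulate-∷ʳ (w ∘ p))
    (≡.cong₂ _∷ʳ_ (tabulate-cong (≡.cong w ∘ p-inject₁)) (≡.cong w p-last)))

  shifted : (Fin N → Fin N → ℤ) → Fin N → Fin N → ℤ
  shifted q i j = q (p i) (p j) ℤ.+ + m ℤ.* (δ i ℤ.- δ j)

  shifted-isAddress : ∀ {q} → IsAddress q → IsAddress (shifted q)
  shifted-isAddress {q} isA = record
    { diagonal = λ i → ≡.trans (≡.cong (ℤ._+ + m ℤ.* (δ i ℤ.- δ i)) (diagonal (p i))) (eq₁ (+ m) (δ i))
    ; antisym  = λ {i} {j} i≢j → ≡.trans (eq₂ (q (p i) (p j)) (q (p j) (p i)) (+ m) (δ i) (δ j))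
      (antisym (i≢j ∘ p-injective))
    ; super    = λ i j l → ≤-transfer (super (p i) (p j) (p l))
        (eq₃ (q (p i) (p j)) (q (p j) (p l)) (q (p i) (p l)) (+ m) (δ i) (δ j) (δ l))
    }
    where
    open IsAddress isA
    eq₁ : ∀ m d → 0ℤ ℤ.+ m ℤ.* (d ℤ.- d) ≡ 0ℤ
    eq₁ = solve-∀
    eq₂ : ∀ a b m d e → (a ℤ.+ m ℤ.* (d ℤ.- e)) ℤ.+ (b ℤ.+ m ℤ.* (e ℤ.- d)) ≡ a ℤ.+ b
    eq₂ = solve-∀
    eq₃ : ∀ a b c m d e f → c ℤ.- (a ℤ.+ b) ≡
      (c ℤ.+ m ℤ.* (d ℤ.- f)) ℤ.- ((a ℤ.+ m ℤ.* (d ℤ.- e)) ℤ.+ (b ℤ.+ m ℤ.* (e ℤ.- f)))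
    eq₃ = solve-∀

  record Code (A : Pred Carrierᴹ ℓ) : Set ℓ where
    field
      point   : Carrierᴹ
      q       : Fin N → Fin N → ℤ
      w       : Fin N → Fin m
      point∈A : A point
      address : IsAddress q
      point∈R : Region q point
      A⊆R     : A ⊆ Region q
      R⊆A     : Region q ⊆ A
      isWord  : IsWord (position q) w

    InW-w : InW m (tabulate w)
    InW-w = let J , Σ≡ = sum-word {N} {m} {position q} {w} isWord in Words.sum⇒InW w J Σ≡

  open Code

  -- A common point of the two regions forces equal floors, hence equal positions, hence equal
  -- letters. The word thus does not depend on the choices stored in `Code`.
  code-unique : ∀ {A q′ w′} (c : Code A) → IsAddress q′ → A ⊆ Region q′ →
                IsWord (position q′) w′ → ∀ i → w c i ≡ w′ i
  code-unique {A} {q′} {w′} c isA′ A⊆R′ isW′ = word-unique {N} {m} {position (q c)} {w c} {w′}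
    (isWord c)
    (word-translate {N} {m} {position q′} {position (q c)} {w′} 0ℤ
      (λ i → ≡.trans (sumℤ-cong {N} (region-unique (address c) isA′ (point∈R c) (A⊆R′ (point∈A c)) i))
        (≡.sym (ℤ.+-identityʳ _)))
      isW′)

  -- Abstract, since comparing unfolded alcoves and floors is very slow.
  abstract
    code : ∀ {A} → IsAlcove A → Code A
    code isAlcove =
      let x , q , Ax , isA , Rx , A⊆R , R⊆A = alcove⇒region isAlcove
          w , isW = word-exists {N} {m} {position q} (position-distinct isA)
      in  record { point = x ; q = q ; w = w ; point∈A = Ax ; address = isA ; point∈R = Rx
                 ; A⊆R = A⊆R ; R⊆A = R⊆A ; isWord = isW }

    encode : Setoid.Carrier (𝒵 m) → Setoid.Carrier (𝒲 K m)
    encode (A , A∈𝒵) = tabulate (w (code (proj₁ A∈𝒵))) , InW-w (code (proj₁ A∈𝒵))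

    encode-code : ∀ A → proj₁ (encode A) ≡ tabulate (w (code (proj₁ (proj₂ A))))
    encode-code A = ≡.refl

    rotate-encode : ∀ A → proj₁ (rotate (encode A)) ≡ tabulate (w (code (proj₁ (proj₂ A))) ∘ p)
    rotate-encode (A , A∈𝒵) = rotate-tabulate (w (code (proj₁ A∈𝒵))) (InW-w (code (proj₁ A∈𝒵)))

  encode-≡ : ∀ {q w′} (A : Setoid.Carrier (𝒵 m)) → IsAddress q → proj₁ A ⊆ Region q →
             IsWord (position q) w′ → proj₁ (encode A) ≡ tabulate w′
  encode-≡ {q} {w′} A isA A⊆R isW = ≡.trans (encode-code A)
    (tabulate-cong (code-unique {proj₁ A} {q} {w′} (code (proj₁ (proj₂ A))) isA A⊆R isW))

  encode-cong : ∀ {A B} → Setoid._≈_ (𝒵 m) A B → proj₁ (encode A) ≡ proj₁ (encode B)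
  encode-cong {A} {B} (A⊆B , _) = ≡.trans
    (encode-≡ {q c} {w c} A (address c) (A⊆R c ∘ A⊆B) (isWord c)) (≡.sym (encode-code B))
    where c = code (proj₁ (proj₂ B))

  encode-injective : ∀ {A B} → proj₁ (encode A) ≡ proj₁ (encode B) → Setoid._≈_ (𝒵 m) A B
  encode-injective {A , alcA , A⊆Δ} {B , alcB , B⊆Δ} eq =
    (λ Ax → R⊆A b λ {i} {j} i≢j → <-respˡ-≈ (reflexive (≡.cong fromℤ (same i j))) (A⊆R a Ax i≢j)) ,
    (λ Bx → R⊆A a λ {i} {j} i≢j → <-respˡ-≈ (reflexive (≡.cong fromℤ (≡.sym (same i j))))
      (A⊆R b Bx i≢j))
    where
    a = code alcA
    b = code alcB
    w≗ : ∀ i → w a i ≡ w b i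
    w≗ i = ≡.trans (≡.sym (lookup∘tabulate (w a) i)) (≡.trans (≡.cong (λ u → lookup u i)
      (≡.trans (≡.sym (encode-code (A , alcA , A⊆Δ))) (≡.trans eq (encode-code (B , alcB , B⊆Δ)))))
      (lookup∘tabulate (w b) i))
    same : ∀ i j → q a i j ≡ q b i j
    same = address-unique {N} {m} {q a} {q b} {w a} (address a) (address b)
      (simplex⇒dilation (A⊆Δ (point∈A a)) (address a) (point∈R a))
      (simplex⇒dilation (B⊆Δ (point∈A b)) (address b) (point∈R b))
      (isWord a) (word-cong {a = position (q b)} w≗ (isWord b))
      where
      word-cong : ∀ {a : Fin N → ℤ} {u u′ : Fin N → Fin m} → (∀ i → u i ≡ u′ i) → IsWord a u′ → IsWord a u
      word-cong {a} u≗ isW i = ≡.subst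
        (λ l → ∃₂ λ j ε → a i ℤ.+ (1ℤ ℤ.+ + toℕ l ℤ.* + N) ≡ a j ℤ.+ ε ℤ.* + (m ℕ.* N))
        (≡.sym (u≗ i)) (isW i)

  module _ {v} (isVertices : AreVertices m v) where

    -- The point is chosen so that `⟨ r i , x ⟩` is `b i / N` up to a common constant; the sign and
    -- `opposite` in `s` undo those in `r`. `Distinct` keeps the gaps off the integers, so the
    -- floors are strict lower bounds.
    floors-realised : ∀ {b : Fin N → ℤ} → Distinct b → ∃ (Region (λ i j → (b i ℤ.- b j) ℤ./ℕ N))
    floors-realised {b} dist = x , x∈R
      where
      ν s₀ : Carrier
      ν = proj₁ (reciprocal (0<fromℕ-suc K))
      0<ν = proj₁ (proj₂ (reciprocal (0<fromℕ-suc K)))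
      νN≈1 = proj₂ (proj₂ (reciprocal (0<fromℕ-suc K)))
      s : Fin N → Carrier
      s j = - (ν * fromℤ (b (opposite j)))
      s₀ = s zero
      x : Carrierᴹ
      x = proj₁ (realise-σ isVertices s)
      side : ∀ i → - (- (ν * fromℤ (b i)) - s₀) ≈ ⟨ r i , x ⟩
      side i = trans (-‿cong (trans
        (+-congʳ (reflexive (≡.cong (λ i → - (ν * fromℤ (b i))) (≡.sym (Fin.opposite-involutive i)))))
        (sym (proj₂ (realise-σ isVertices s) (opposite i))))) (sym (⟨r⟩ i x))
      gap≈ : ∀ i j → ν * fromℤ (b i ℤ.- b j) ≈ gap i j x
      gap≈ i j = begin
        ν * fromℤ (b i ℤ.- b j)
          ≈⟨ *-congˡ (fromℤ-- (b i) (b j)) ⟩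
        ν * (fromℤ (b i) - fromℤ (b j))
          ≈⟨ solve 4 (λ n a b c → n :* (a :- b) := :- (:- (n :* a) :- c) :- :- (:- (n :* b) :- c)) refl
            ν (fromℤ (b i)) (fromℤ (b j)) s₀ ⟩
        - (- (ν * fromℤ (b i)) - s₀) - - (- (ν * fromℤ (b j)) - s₀)
          ≈⟨ +-cong (side i) (-‿cong (side j)) ⟩
        ⟨ r i , x ⟩ - ⟨ r j , x ⟩ ∎
        where open SetoidReasoning setoid
      x∈R : Region (λ i j → (b i ℤ.- b j) ℤ./ℕ N) x
      x∈R {i} {j} i≢j = <-resp
        (trans (*-congˡ (trans (fromℤ-* z (+ N)) (*-comm _ _)))
          (trans (sym (*-assoc _ _ _)) (trans (*-congʳ νN≈1) (*-identityˡ _))))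
        (gap≈ i j)
        (*-monoˡ-< 0<ν (fromℤ-mono-< {z ℤ.* + N} {b i ℤ.- b j}
          (ℤ.≤∧≢⇒< ([n/ℕd]*d≤n (b i ℤ.- b j) N) λ eq →
          i≢j (dist z (≡-transfer (≡.sym eq) (eq′ (b i) (b j) (z ℤ.* + N)))))))
        where
        z : ℤ
        z = (b i ℤ.- b j) ℤ./ℕ N
        eq′ : ∀ a b z → z ℤ.- (a ℤ.- b) ≡ (b ℤ.+ z) ℤ.- a
        eq′ = solve-∀

    preimage : ∀ (u : Vec (Fin m) N) →
      (∃ λ b → Distinct b × InDilation m (λ i j → (b i ℤ.- b j) ℤ./ℕ N) ×
               IsWord {N} {m} (position (λ i j → (b i ℤ.- b j) ℤ./ℕ N)) (lookup u)) →
      ∃ λ A → ∀ {B} → Setoid._≈_ (𝒵 m) B A → proj₁ (encode B) ≡ u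
    preimage u (b , dist , inD , isW) =
      (Region q′ , region-isAlcove isA (proj₂ (floors-realised dist)) , λ {x} → dilation⇒simplex {q′}
        {x} inD) ,
      λ {B} B≈R → ≡.trans (encode-≡ {q′} {lookup u} B isA (proj₁ B≈R) isW) (tabulate∘lookup u)
      where
      q′ : Fin N → Fin N → ℤ
      q′ i j = (b i ℤ.- b j) ℤ./ℕ N
      isA : IsAddress q′
      isA = floors-isAddress {N} {m} dist

    encode-surjective : ∀ (u : Setoid.Carrier (𝒲 K m)) →
      ∃ λ A → ∀ {B} → Setoid._≈_ (𝒵 m) B A → proj₁ (encode B) ≡ proj₁ u
    encode-surjective (u , u∈W) = preimage u
      (word-realised (lookup u) (proj₁ (Words.InW⇒sum u u∈W)) (proj₂ (Words.InW⇒sum u u∈W)))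

    encode-bijection : Bijection (𝒵 m) (𝒲 K m)
    encode-bijection = record
      { to        = encode
      ; cong      = λ {A} {B} → encode-cong {A} {B}
      ; bijective = (λ {A} {B} → encode-injective {A} {B}) , encode-surjective
      }

  module _ {v ρ} (isCyclic : IsCyclicSymmetry m v ρ) where

    gap-ρ : ∀ i j x → gap i j (ρ x) ≈ gap (p i) (p j) x + fromℤ (+ m ℤ.* (δ i ℤ.- δ j))
    gap-ρ i j x = begin
      ⟨ r i , ρ x ⟩ - ⟨ r j , ρ x ⟩
        ≈⟨ +-cong (⟨r,ρ⟩ i) (-‿cong (⟨r,ρ⟩ j)) ⟩
      (⟨ r (p i) , x ⟩ + M * fromℤ (δ i) - C) - (⟨ r (p j) , x ⟩ + M * fromℤ (δ j) - C)
        ≈⟨ solve 6 (λ a b m d e c → (a :+ m :* d :- c) :- (b :+ m :* e :- c) := (a :- b) :+ m :*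
          (d :- e)) refl _ _ M (fromℤ (δ i)) (fromℤ (δ j)) C ⟩
      gap (p i) (p j) x + M * (fromℤ (δ i) - fromℤ (δ j))
        ≈⟨ +-congˡ (trans (*-congˡ (sym (fromℤ-- (δ i) (δ j)))) (sym (fromℤ-* (+ m) (δ i ℤ.- δ j)))) ⟩
      gap (p i) (p j) x + fromℤ (+ m ℤ.* (δ i ℤ.- δ j)) ∎
      where
      open SetoidReasoning setoid
      M C : Carrier
      M = fromℕ m
      C = M - ⟨ σ (last K) , x ⟩
      ⟨r,ρ⟩ : ∀ j → ⟨ r j , ρ x ⟩ ≈ ⟨ r (p j) , x ⟩ + M * fromℤ (δ j) - C
      ⟨r,ρ⟩ j with view j
      ... | ‵fromℕ = begin
        ⟨ r (last K) , ρ x ⟩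
          ≈⟨ trans (⟨r⟩ (last K) (ρ x))
            (-‿cong (trans (reflexive (≡.cong (λ l → ⟨ σ l , ρ x ⟩) (opposite-last K))) (⟨⟩-0ˡ _))) ⟩
        - 0#
          ≈⟨ solve 2 (λ m s → :- con (+ 0) := :- s :+ m :* con (+ 1) :- (m :- s)) refl M
            ⟨ σ (last K) , x ⟩ ⟩
        - ⟨ σ (last K) , x ⟩ + M * fromℤ 1ℤ - C
          ≈⟨ +-congʳ (+-cong (trans (sym (⟨r⟩ zero x))
            (reflexive (≡.cong (λ l → ⟨ r l , x ⟩) (≡.sym p-last))))
               (*-congˡ (reflexive (≡.cong fromℤ (≡.sym (snoc-last {n = K} (λ _ → 0ℤ) 1ℤ)))))) ⟩
        ⟨ r (p (last K)) , x ⟩ + M * fromℤ (δ (last K)) - C ∎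
      ... | ‵inject₁ i = begin
        ⟨ r (inject₁ i) , ρ x ⟩
          ≈⟨ trans (⟨r⟩ (inject₁ i) (ρ x))
            (-‿cong (trans (reflexive (≡.cong (λ l → ⟨ σ l , ρ x ⟩) (opposite-inject₁ i))) (⟨σ,ρ⟩
            isCyclic x (opposite i)))) ⟩
        - (C + ⟨ σ (inject₁ (opposite i)) , x ⟩)
          ≈⟨ solve 3 (λ m c s → :- (c :+ s) := :- s :+ m :* con (+ 0) :- c) refl M C _ ⟩
        - ⟨ σ (inject₁ (opposite i)) , x ⟩ + M * fromℤ 0ℤ - C
          ≈⟨ +-congʳ (+-cong (trans (sym (⟨r⟩ (suc i) x))
            (reflexive (≡.cong (λ l → ⟨ r l , x ⟩) (≡.sym (p-inject₁ i)))))
               (*-congˡ (reflexive (≡.cong fromℤ (≡.sym (snoc-inject₁ {n = K} (λ _ → 0ℤ) 1ℤ i)))))) ⟩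
        ⟨ r (p (inject₁ i)) , x ⟩ + M * fromℤ (δ (inject₁ i)) - C ∎

    region-ρ : ∀ {q x} → Region q x → Region (shifted q) (ρ x)
    region-ρ {q} {x} Rx {i} {j} i≢j = <-resp (sym (fromℤ-+ (q (p i) (p j)) _)) (sym (gap-ρ i j x))
      (+-monoˡ-< _ (Rx (i≢j ∘ p-injective)))

    region-ρ⁻¹ : ∀ {q x} → Region (shifted q) (ρ x) → Region q x
    region-ρ⁻¹ {q} {x} Rρx {i} {j} i≢j =
      let i′ , pi′≡i = injective⇒surjective p-injective i
          j′ , pj′≡j = injective⇒surjective p-injective j
          D = fromℤ (+ m ℤ.* (δ i′ ℤ.- δ j′))
          i′≢j′ = λ i′≡j′ → i≢j (≡.trans (≡.sym pi′≡i) (≡.trans (≡.cong p i′≡j′) pj′≡j))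
      in  <-resp (reflexive (≡.cong₂ (λ i j → fromℤ (q i j)) pi′≡i pj′≡j))
            (reflexive (≡.cong₂ (λ i j → gap i j x) pi′≡i pj′≡j))
            (<-via (solve 3 (λ a b d → (b :+ d) :- (a :+ d) := b :- a) refl _ _ D)
              (<⇒0<- (<-resp (fromℤ-+ (q (p i′) (p j′)) _) (gap-ρ i′ j′ x) (Rρx {i′} {j′} i′≢j′))))

    region-cong : ∀ {q x y} → x ≈ᴹ y → Region q x → Region q y
    region-cong x≈y Rx i≢j = <-respʳ-≈ (+-cong (⟨⟩-congʳ x≈y) (-‿cong (⟨⟩-congʳ x≈y))) (Rx i≢j)

    image⊆region : ∀ {A q} → A ⊆ Region q → Image ρ A ⊆ Region (shifted q)
    image⊆region {A} {q} A⊆R (x , Ax , ρx≈y) = region-cong {shifted q} ρx≈y (region-ρ {q} (A⊆R Ax))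

    region⊆image : ∀ {A q} → Region q ⊆ A → Region (shifted q) ⊆ Image ρ A
    region⊆image {A} {q} R⊆A {y} Ry =
      let z , ρz≈y = ρ-surjective isCyclic y
      in  z , R⊆A (region-ρ⁻¹ {q} (region-cong {shifted q} (≈ᴹ-sym ρz≈y) Ry)) , ρz≈y

    abstract
      ρ-permutes : ∀ A → InZ m A → InZ m (Image ρ A)
      ρ-permutes A (isAlcove , A⊆Δ) =
        region⇒alcove {q = shifted (q c)} (shifted-isAddress (address c)) (region-ρ {q c} (point∈R c))
          (image⊆region {A} {q c} (A⊆R c)) (region⊆image {A} {q c} (R⊆A c)) ,
        λ {y} (x , Ax , ρx≈y) → simplex-cong ρx≈y (simplex-ρ (A⊆Δ Ax))
        where
        c : Code A
        c = code isAlcove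
        simplex-cong : ∀ {x y} → x ≈ᴹ y → DilatedSimplex m x → DilatedSimplex m y
        simplex-cong x≈y (0≤ , ≤m) = (λ i → ≤-trans (0≤ i) (≤-reflexive (⟨⟩-congʳ x≈y))) ,
          ≤-trans (≤-reflexive (⟨⟩-congʳ (≈ᴹ-sym x≈y))) ≤m
        simplex-ρ : ∀ {x} → DilatedSimplex m x → DilatedSimplex m (ρ x)
        simplex-ρ {x} x∈Δ =
          (λ { zero    → ≤-trans (≤⇒0≤- (σ-≤ x∈Δ (last K))) (≤-reflexive (sym (⟨α₁,ρ⟩ isCyclic x)))
             ; (suc j) → ≤-trans (proj₁ x∈Δ (inject₁ j)) (≤-reflexive (sym (⟨αⱼ,ρ⟩ isCyclic j x))) }) ,
          ≤-trans (≤-reflexive (trans (⟨-α₀,⟩ (ρ x)) (⟨σ,ρ⟩ isCyclic x (last k))))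
            (≤-via (trans (⟨α⟩-σ (last k) x)
              (solve 3 (λ m a b → a :- b := m :- (m :- a :+ b)) refl (fromℕ m) ⟨ σ (last K) , x ⟩
              ⟨ σ (inject₁ (last k)) , x ⟩))
              (proj₁ x∈Δ (last k)))

    -- The image lies in the region of the shifted address, whose word is `w c ∘ p` by
    -- `word-reindex`; composition with `p` is the left rotation.
    encode-ρ : ∀ A (A∈𝒵 : InZ m A) → proj₁ (encode (Image ρ A , ρ-permutes A A∈𝒵)) ≡ proj₁
      (rotate (encode (A , A∈𝒵)))
    encode-ρ A A∈𝒵 = ≡.trans
      (encode-≡ {shifted (q c)} {w c ∘ p} (Image ρ A , ρ-permutes A A∈𝒵) (shifted-isAddress (address c))
        (image⊆region {A} {q c} (A⊆R c))
        (word-reindex {N} {m} {q c} {shifted (q c)} {w c} {p} δ p-injective (λ _ _ → ≡.refl)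
          (isWord c)))
      (≡.sym (rotate-encode (A , A∈𝒵)))
      where c = code (proj₁ A∈𝒵)

theorem1p1 :
  ∀ {ℓ} (ℝ : Reals ℓ) (V : EuclideanSpace ℝ) →
  (k m : ℕ) .{{_ : NonZero k}} .{{_ : NonZero m}} →
  (T : TypeA V k) →
  let open EuclideanSpace V
      open TypeA T in
  (v : Fin (suc k) → Carrierᴹ) (ρ : Carrierᴹ → Carrierᴹ) →
  IsCyclicSymmetry m v ρ →
  Σ[ ρ-permutes ∈ (∀ A → InZ m A → InZ m (Image ρ A)) ]
  Σ[ F ∈ Bijection (𝒵 m) (𝒲 k m) ]
    (∀ A (A∈𝒵 : InZ m A) →
      Setoid._≈_ (𝒲 k m)
        (Bijection.to F (Image ρ A , ρ-permutes A A∈𝒵))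
        (rotate (Bijection.to F (A , A∈𝒵))))
theorem1p1 ℝ V zero    m T v ρ isCyclic = ⊥-elim (ℕ.≢-nonZero⁻¹ 0 ≡.refl)
theorem1p1 ℝ V (suc k) m T v ρ isCyclic =
  ρ-permutes isCyclic , encode-bijection (IsCyclicSymmetry.vertices isCyclic) , encode-ρ isCyclic
  where
  open TypeA T using (module IsCyclicSymmetry)
  open AlcoveWords V m T
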